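{- Let $\mathcal{C}$ be a cubical complex with a stable shelling. Then the $h$-polynomial $h(\mathrm{sd}(\mathcal{C});x)$ of its barycentric subdivision is real-rooted.
   Context: A polytopal complex is a collection of (abstract) polytopes that contains the empty polytope $\emptyset$ (of dimension $-1$), is closed under taking faces, and in which any two members intersect in a common face of both. Its maximal members are its facets; it is pure if all facets have the same dimension; it is cubical if all facets are (combinatorial) cubes. For a polytope $P$, $\mathcal{C}(P)$ is the complex of all faces of $P$ (including $\emptyset$ and $P$) and $\mathcal{C}(\partial P)$ the complex of all proper faces; for a finite collection of polytopes, $\mathcal{C}(\{P_1,\dots,P_m\})=\mathcal{C}(P_1\cup\cdots\cup P_m)=\bigcup_i\mathcal{C}(P_i)$ (having no faces at all if the collection is empty). If $\mathcal{D}$ is a subcomplex of $\mathcal{C}$, $\mathcal{C}\setminus\mathcal{D}=\{P\in\mathcal{C}:P\notin\mathcal{D}\}$ is a relative complex. A shelling of a pure $d$-dimensional polytopal complex is a linear ordering $(F_1,\ldots,F_s)$ of its facets such that either $d=0$, or (1) $\mathcal{C}(\partial F_1)$ has a shelling, and (2) for $2\le j\le s$, $F_j\cap\bigcup_{i<j}F_i$ is nonempty and equals $G_1\cup\cdots\cup G_r$ for some shelling $(G_1,\ldots,G_r,\ldots,G_t)$ of $\mathcal{C}(\partial F_j)$ and some $r\in[t]$. For a polytope $P$, let $L(P)$ be its face lattice, $[F,P]$ the closed interval of faces containing $F$, ${}^\ast$ the dual poset, and $A(\cdot)$ the set of atoms of a poset with a least element. Thus $A([F,P]^\ast)$ is the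 set of facets of $P$ containing $F$ (empty if $F=P$, all facets if $F=\emptyset$), and $A(L(P)^\ast)$ is the set of all facets. The reciprocal domains associated to a face $F$ of $P$ are $$\mathcal{C}(P)\setminus\mathcal{C}(A([F,P]^\ast))\quad\text{and}\quad \mathcal{C}(P)\setminus\mathcal{C}(A(L(P)^\ast)\setminus A([F,P]^\ast)).$$ A relative complex is stable if it is isomorphic to one of the reciprocal domains associated to some face $F$ (possibly $\emptyset$ or $P$) of some polytope $P$; here $\mathcal{C}\setminus\mathcal{D}$ and $\mathcal{C}'\setminus\mathcal{D}'$ are isomorphic if there is an inclusion-preserving (both ways) bijection $\mathcal{C}\to\mathcal{C}'$ mapping $\mathcal{D}$ onto $\mathcal{D}'$. A shelling $(F_1,\ldots,F_s)$ of $\mathcal{C}$ is stable if for all $i\in[s]$ the relative complex $\mathcal{R}_i=\mathcal{C}(F_i)\setminus\mathcal{C}(F_1\cup\cdots\cup F_{i-1})$, viewed as $\mathcal{C}(F_i)$ minus its subcomplex $\mathcal{C}(F_i)\cap\bigcup_{k<i}\mathcal{C}(F_k)$, is stable. The barycentric subdivision $\mathrm{sd}(\mathcal{C})$ is the simplicial complex whose $k$-dimensional faces are the sets $\{F_0,\ldots,F_k\}$ of faces of $\mathcal{C}$ with $\emptyset\subsetneq F_0\subsetneq F_1\subsetneq\cdots\subsetneq F_k$ (together with the empty face). For an $(m-1)$-dimensional complex $\mathcal{K}$, $f(\mathcal{K};x)=\sum_{k=-1}^{m-1}f_k(\mathcal{K})x^{k+1}$, where $f_k$ is the number of $k$-dimensional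 faces ($f_{ -1}=1$), and $h(\mathcal{K};x)=(1-x)^m f(\mathcal{K};\frac{x}{1-x})$. A real polynomial is real-rooted if it is identically zero or has only real zeros. -}

module Defs where

open import Level using (0ℓ)
open import Algebra.Bundles using (CommutativeMonoid)
import Algebra.Properties.CommutativeSemigroup as CommutativeSemigroupProperties
open import Data.Bool.Base using (Bool)
open import Data.Fin.Base using (Fin)
import Data.Fin.Properties as Fin
open import Data.Fin.Subset using (Subset; inside; outside; ∣_∣; _∈_; _⊆_) renaming (⊥ to ∅ₛ)
open import Data.Fin.Subset.Properties using (_∈?_; ∉⊥)
open import Data.Integer.Base as ℤ using (ℤ; +_; 0ℤ; 1ℤ; -1ℤ)
open import Data.List.Base
  using (List; []; _∷_; _++_; map; foldr; filter; length; upTo; take)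
open import Data.List.Membership.Propositional using () renaming (_∈_ to _∈ₗ_)
open import Data.List.Relation.Unary.All using (All)
open import Data.List.Relation.Unary.Any using (Any)
open import Data.List.Relation.Unary.Unique.Propositional using (Unique)
open import Data.Nat.Base as ℕ using (ℕ; zero; suc; _∸_)
import Data.Nat.Properties as ℕ
open import Data.Product.Base using (Σ; ∃; _×_; _,_; proj₁; proj₂)
open import Data.Rational.Base as ℚ using (ℚ; 0ℚ; 1ℚ; ½)
import Data.Rational.Properties as ℚ
open import Data.Sum.Base using (_⊎_; inj₁; inj₂)
open import Data.Vec.Base as Vec using (Vec)
open import Data.Vec.Relation.Binary.Pointwise.Inductive as Pointwise
  using (Pointwise; []; _∷_)
open import Function.Bundles using (_⇔_)
open import Relation.Binary.Bundles using (Poset)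
import Relation.Binary.Construct.Add.Infimum.NonStrict as AddInfimum
import Relation.Binary.Construct.Add.Supremum.NonStrict as AddSupremum
import Relation.Binary.Construct.On as On
open import Relation.Binary.Construct.Closure.ReflexiveTransitive using (Star)
open import Relation.Binary.Core using (Rel)
open import Relation.Binary.Definitions using (Antisymmetric; Minimum)
open import Relation.Binary.Lattice.Structures using (IsMeetSemilattice; IsBoundedLattice)
open import Relation.Binary.Morphism.Structures using (IsOrderIsomorphism)
import Relation.Binary.Properties.Poset as PosetProperties
open import Relation.Binary.PropositionalEquality
  using (_≡_; _≢_; refl; sym; trans; cong; cong₂; subst; isEquivalence; module ≡-Reasoning)
open import Relation.Binary.Structures using (IsPartialOrder; IsDecPartialOrder)
open import Relation.Nullary using (¬_; _×-dec_; _⊎-dec_; _→-dec_; ¬?; contradiction)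
open import Relation.Nullary.Construct.Add.Infimum using (_₋)
open import Relation.Nullary.Construct.Add.Supremum using (_⁺)
open import Relation.Unary using (Pred; Decidable; U)

------------------------------------------------------------------------
-- Posets

Poset₀ : Set₁
Poset₀ = Poset 0ℓ 0ℓ 0ℓ

record _≅_ (P Q : Poset₀) : Set where
  private
    module P = Poset P
    module Q = Poset Q
  field
    to                 : P.Carrier → Q.Carrier
    isOrderIsomorphism : IsOrderIsomorphism P._≈_ Q._≈_ P._≤_ Q._≤_ to

record FinitePoset : Set₁ where
  infix 4 _≤_
  field
    size              : ℕ
    _≤_               : Rel (Fin size) 0ℓ
    isDecPartialOrder : IsDecPartialOrder _≡_ _≤_

  open IsDecPartialOrder isDecPartialOrder public
    using (isPartialOrder; _≤?_; _≟_)

  Face : Set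
  Face = Fin size

  poset : Poset₀
  poset = record { isPartialOrder = isPartialOrder }

  ↓ : Face → Poset₀
  ↓ F = On.poset {B = Σ Face (_≤ F)} poset proj₁

------------------------------------------------------------------------
-- Abstract polytopes

-- An abstract polytope in the sense of McMullen and Schulte whose faces
-- form a lattice.  The rank of a face is its dimension plus one, so that
-- ⊥ (the empty face) has rank 0.
record IsPolytope (P : Poset₀) : Set where
  open Poset P
  open PosetProperties P using (_<_)

  Between : Carrier → Carrier → Carrier → Set
  Between F G H = F < H × H < G

  _⋖_ : Rel Carrier 0ℓ
  F ⋖ G = F < G × (∀ H → ¬ Between F G H)

  Incident : Carrier → Carrier → Rel Carrier 0ℓ
  Incident F G H K = Between F G H × Between F G K × (H ≤ K ⊎ K ≤ H)

  field
    _∨_ _∧_          : Carrier → Carrier → Carrier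
    ⊤ ⊥              : Carrier
    isBoundedLattice : IsBoundedLattice _≈_ _≤_ _∨_ _∧_ ⊤ ⊥

    rank             : Carrier → ℕ
    rank-cong        : ∀ {F G} → F ≈ G → rank F ≡ rank G
    rank-mono-<      : ∀ {F G} → F < G → rank F ℕ.< rank G
    rank-⋖           : ∀ {F G} → F ⋖ G → rank G ≡ suc (rank F)
    rank-⊥           : rank ⊥ ≡ 0

    diamond : ∀ {F G} → F ≤ G → rank G ≡ 2 ℕ.+ rank F →
              ∃ λ H → ∃ λ K → ¬ H ≈ K × Between F G H × Between F G K ×
                (∀ L → Between F G L → L ≈ H ⊎ L ≈ K)

    stronglyConnected : ∀ {F G} → F ≤ G → 3 ℕ.+ rank F ℕ.≤ rank G →
                        ∀ {H K} → Between F G H → Between F G K →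
                        Star (Incident F G) H K

record Polytope : Set₁ where
  field
    faces      : FinitePoset
  open FinitePoset faces public
  field
    isPolytope : IsPolytope poset
  open IsPolytope isPolytope public

-- The nonempty faces of [0,1] are {0}, {1} and [0,1], that is, the
-- antichain Bool with a top element added; the nonempty faces of [0,1]ᵈ
-- are d-fold products of these.
module _ where
  private
    open AddSupremum {A = Bool} _≡_
      using (_≤⁺_; ≤⁺-reflexive-≡; ≤⁺-trans; ≤⁺-antisym-≡)

    isPartialOrder : ∀ d → IsPartialOrder _≡_ (Pointwise _≤⁺_ {d} {d})
    isPartialOrder d = record
      { isPreorder = record
        { isEquivalence = isEquivalence
        ; reflexive     = λ { refl → Pointwise.refl (≤⁺-reflexive-≡ (λ p → p) refl) }
        ; trans         = Pointwise.trans (≤⁺-trans trans)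
        }
      ; antisym    = antisym
      }
      where
      antisym : ∀ {d} → Antisymmetric _≡_ (Pointwise _≤⁺_ {d} {d})
      antisym []       []       = refl
      antisym (p ∷ ps) (q ∷ qs) = cong₂ Vec._∷_ (≤⁺-antisym-≡ (λ e _ → e) p q) (antisym ps qs)

  cube : ℕ → Poset₀
  cube d = record
    { Carrier        = (Vec (Bool ⁺) d) ₋
    ; isPartialOrder = AddInfimum.≤₋-isPartialOrder-≡ (Pointwise _≤⁺_) (isPartialOrder d)
    }

------------------------------------------------------------------------
-- Polytopal complexes

-- A complex is given by the inclusion order on its members: the faces of
-- a member F are the members below F, and F ∧ G is the common face in
-- which F and G intersect.
record PolytopalComplex : Set₁ where
  field
    members           : FinitePoset
  open FinitePoset members public
  field
    ∅                 : Face
    ∅-minimum         : Minimum _≤_ ∅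
    _∧_               : Face → Face → Face
    isMeetSemilattice : IsMeetSemilattice _≡_ _≤_ _∧_
    isPolytope        : ∀ F → IsPolytope (↓ F)

  -- dimension plus one
  rank : Face → ℕ
  rank F = IsPolytope.rank (isPolytope F) (IsPolytope.⊤ (isPolytope F))

  Subcomplex : Set₁
  Subcomplex = Pred Face 0ℓ

  𝒞 : List Face → Subcomplex
  𝒞 Fs G = Any (G ≤_) Fs

  𝒞∂ : Face → Subcomplex
  𝒞∂ F G = G ≤ F × G ≢ F

  IsFacet : Subcomplex → Pred Face 0ℓ
  IsFacet 𝒟 F = 𝒟 F × (∀ G → 𝒟 G → F ≤ G → F ≡ G)

  PureOfDim : ℕ → Subcomplex → Set
  PureOfDim d 𝒟 = ∀ F → IsFacet 𝒟 F → rank F ≡ suc d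

  IsFacetOrdering : Subcomplex → List Face → Set
  IsFacetOrdering 𝒟 Fs = Unique Fs × (∀ F → F ∈ₗ Fs ⇔ IsFacet 𝒟 F)

  -- Unions of members are compared through the subcomplexes they
  -- generate: F ∩ ⋃ earlier becomes the common members of 𝒞(F) and
  -- 𝒞(earlier).  The case earlier = [] is the condition on the first facet.
  mutual
    IsShelling : ℕ → Subcomplex → List Face → Set
    IsShelling zero    𝒟 Fs = PureOfDim 0 𝒟 × IsFacetOrdering 𝒟 Fs
    IsShelling (suc d) 𝒟 Fs =
      PureOfDim (suc d) 𝒟 × IsFacetOrdering 𝒟 Fs ×
      (∀ earlier F later → Fs ≡ earlier ++ F ∷ later → Attaches d earlier F)

    Attaches : ℕ → List Face → Face → Set
    Attaches d []                F = ∃ λ Gs → IsShelling d (𝒞∂ F) Gs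
    Attaches d earlier@(_ ∷ _)   F =
      (∃ λ H → H ≢ ∅ × H ≤ F × 𝒞 earlier H) ×
      (∃ λ Gs → ∃ λ r → IsShelling d (𝒞∂ F) Gs × 1 ℕ.≤ r × r ℕ.≤ length Gs ×
        (∀ H → (H ≤ F × 𝒞 earlier H) ⇔ 𝒞 (take r Gs) H))

IsCubical : PolytopalComplex → Set
IsCubical C = ∀ F → IsFacet U F → ∃ λ d → ↓ F ≅ cube d
  where open PolytopalComplex C

------------------------------------------------------------------------
-- Relative complexes and stability

record RelativeComplex : Set₁ where
  field
    complex : Poset₀
    Removed : Pred (Poset.Carrier complex) 0ℓ

record _≅ᵣ_ (R S : RelativeComplex) : Set where
  private
    module R = RelativeComplex R
    module S = RelativeComplex S
  field
    iso     : R.complex ≅ S.complex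
    removed : ∀ F → R.Removed F ⇔ S.Removed (_≅_.to iso F)

module _ (P : Polytope) where
  open Polytope P

  -- The facets of P are the H ⋖ ⊤, and those among them lying above F are
  -- the atoms of the dual of [F,P].
  reciprocal₁ reciprocal₂ : Face → RelativeComplex
  reciprocal₁ F = record
    { complex = poset
    ; Removed = λ G → ∃ λ H → H ⋖ ⊤ × F ≤ H × G ≤ H
    }
  reciprocal₂ F = record
    { complex = poset
    ; Removed = λ G → ∃ λ H → H ⋖ ⊤ × ¬ F ≤ H × G ≤ H
    }

IsStable : RelativeComplex → Set₁
IsStable R = Σ Polytope λ P → ∃ λ F → (R ≅ᵣ reciprocal₁ P F) ⊎ (R ≅ᵣ reciprocal₂ P F)

module _ (C : PolytopalComplex) where
  open PolytopalComplex C

  HasStableShelling : Set₁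
  HasStableShelling = ∃ λ d → ∃ λ Fs → IsShelling d U Fs ×
    (∀ earlier F later → Fs ≡ earlier ++ F ∷ later →
      IsStable (record { complex = ↓ F ; Removed = λ G → 𝒞 earlier (proj₁ G) }))

------------------------------------------------------------------------
-- Simplicial complexes and the h-polynomial

record SimplicialComplex (n : ℕ) : Set₁ where
  field
    IsFace  : Pred (Subset n) 0ℓ
    isFace? : Decidable IsFace
    empty   : IsFace ∅ₛ
    closed  : ∀ {S T} → S ⊆ T → IsFace T → IsFace S

subsets : ∀ n → List (Subset n)
subsets zero    = Vec.[] ∷ []
subsets (suc n) = map (inside Vec.∷_) (subsets n) ++ map (outside Vec.∷_) (subsets n)

-- Coefficient lists, constant term first.
ℤ[x] : Set
ℤ[x] = List ℤ

infixl 6 _⊕_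
infixl 7 _⊗_
infixr 8 _^_

_⊕_ : ℤ[x] → ℤ[x] → ℤ[x]
[]      ⊕ q       = q
(a ∷ p) ⊕ []      = a ∷ p
(a ∷ p) ⊕ (b ∷ q) = a ℤ.+ b ∷ p ⊕ q

_⊗_ : ℤ[x] → ℤ[x] → ℤ[x]
[]      ⊗ q = []
(a ∷ p) ⊗ q = map (a ℤ.*_) q ⊕ (0ℤ ∷ p ⊗ q)

_^_ : ℤ[x] → ℕ → ℤ[x]
p ^ zero  = 1ℤ ∷ []
p ^ suc k = p ⊗ p ^ k

module _ {n} (K : SimplicialComplex n) where
  open SimplicialComplex K

  allFaces : List (Subset n)
  allFaces = filter isFace? (subsets n)

  -- number of faces with k vertices, i.e. of dimension k - 1
  faceCount : ℕ → ℕ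
  faceCount k = length (filter (λ S → ∣ S ∣ ℕ.≟ k) allFaces)

  -- dimension plus one
  rankₛ : ℕ
  rankₛ = foldr ℕ._⊔_ 0 (map ∣_∣ allFaces)

  -- With m = rankₛ, clearing denominators in (1-x)ᵐ f(x/(1-x)) gives
  -- Σ_{k ≤ m} f_{k-1} xᵏ (1-x)ᵐ⁻ᵏ.
  hPolynomial : ℤ[x]
  hPolynomial = foldr _⊕_ [] (map term (upTo (suc rankₛ)))
    where
    x 1-x : ℤ[x]
    x   = 0ℤ ∷ 1ℤ ∷ []
    1-x = 1ℤ ∷ -1ℤ ∷ []
    term : ℕ → ℤ[x]
    term k = (+ faceCount k ∷ []) ⊗ x ^ k ⊗ 1-x ^ (rankₛ ∸ k)

module _ (C : PolytopalComplex) where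
  open PolytopalComplex C

  sd : SimplicialComplex size
  sd = record
    { IsFace  = λ S → (∀ F → F ∈ S → F ≢ ∅) ×
                      (∀ F G → F ∈ S → G ∈ S → F ≤ G ⊎ G ≤ F)
    ; isFace? = λ S →
        Fin.all? (λ F → (F ∈? S) →-dec ¬? (F ≟ ∅)) ×-dec
        Fin.all? (λ F → Fin.all? (λ G →
          (F ∈? S) →-dec ((G ∈? S) →-dec ((F ≤? G) ⊎-dec (G ≤? F)))))
    ; empty   = (λ F F∈∅ _ → ∉⊥ F∈∅) , λ F G F∈∅ _ → contradiction F∈∅ ∉⊥
    ; closed  = λ S⊆T (nonempty , chain) →
        (λ F F∈S → nonempty F (S⊆T F∈S)) ,
        (λ F G F∈S G∈S → chain F G (S⊆T F∈S) (S⊆T G∈S))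
    }

------------------------------------------------------------------------
-- Real and complex numbers

-- A real number is a Cauchy sequence of rationals with a modulus of
-- convergence.
IsCauchy : (ℕ → ℚ) → Set
IsCauchy x = ∀ ε → 0ℚ ℚ.< ε →
  ∃ λ N → ∀ m n → N ℕ.≤ m → N ℕ.≤ n → ℚ.∣ x m ℚ.- x n ∣ ℚ.< ε

record ℝ : Set where
  constructor mkℝ
  field
    seq    : ℕ → ℚ
    cauchy : IsCauchy seq

open ℝ

infix 4 _≈_

_≈_ : Rel ℝ 0ℓ
x ≈ y = ∀ ε → 0ℚ ℚ.< ε → ∃ λ N → ∀ n → N ℕ.≤ n → ℚ.∣ seq x n ℚ.- seq y n ∣ ℚ.< ε

private
  open CommutativeSemigroupProperties
    (CommutativeMonoid.commutativeSemigroup ℚ.+-0-commutativeMonoid) using (interchange)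

  [a+b]-[c+d] : ∀ a b c d → (a ℚ.+ b) ℚ.- (c ℚ.+ d) ≡ (a ℚ.- c) ℚ.+ (b ℚ.- d)
  [a+b]-[c+d] a b c d = trans (cong (a ℚ.+ b ℚ.+_) (ℚ.neg-distrib-+ c d))
    (interchange a b (ℚ.- c) (ℚ.- d))

  a-c≡[a-b]+[b-c] : ∀ a b c → a ℚ.- c ≡ (a ℚ.- b) ℚ.+ (b ℚ.- c)
  a-c≡[a-b]+[b-c] a b c = sym (begin
    (a ℚ.- b) ℚ.+ (b ℚ.- c)       ≡⟨ ℚ.+-assoc a (ℚ.- b) (b ℚ.- c) ⟩
    a ℚ.+ (ℚ.- b ℚ.+ (b ℚ.- c))   ≡⟨ cong (a ℚ.+_) (ℚ.+-assoc (ℚ.- b) b (ℚ.- c)) ⟨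
    a ℚ.+ (ℚ.- b ℚ.+ b ℚ.- c)     ≡⟨ cong (λ t → a ℚ.+ (t ℚ.- c)) (ℚ.+-inverseˡ b) ⟩
    a ℚ.+ (0ℚ ℚ.- c)              ≡⟨ cong (a ℚ.+_) (ℚ.+-identityˡ (ℚ.- c)) ⟩
    a ℚ.- c                       ∎)
    where open ≡-Reasoning

  a≡[a-b]+b : ∀ a b → a ≡ (a ℚ.- b) ℚ.+ b
  a≡[a-b]+b a b = sym (trans (ℚ.+-assoc a (ℚ.- b) b)
    (trans (cong (a ℚ.+_) (ℚ.+-inverseˡ b)) (ℚ.+-identityʳ a)))

  ab-cd : ∀ a b c d → a ℚ.* b ℚ.- c ℚ.* d ≡ a ℚ.* (b ℚ.- d) ℚ.+ d ℚ.* (a ℚ.- c)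
  ab-cd a b c d = begin
    a ℚ.* b ℚ.- c ℚ.* d
      ≡⟨ a-c≡[a-b]+[b-c] (a ℚ.* b) (a ℚ.* d) (c ℚ.* d) ⟩
    (a ℚ.* b ℚ.- a ℚ.* d) ℚ.+ (a ℚ.* d ℚ.- c ℚ.* d)
      ≡⟨ cong₂ ℚ._+_ (distrib a b d)
           (trans (cong₂ ℚ._-_ (ℚ.*-comm a d) (ℚ.*-comm c d)) (distrib d a c)) ⟩
    a ℚ.* (b ℚ.- d) ℚ.+ d ℚ.* (a ℚ.- c) ∎
    where
    open ≡-Reasoning
    distrib : ∀ p q r → p ℚ.* q ℚ.- p ℚ.* r ≡ p ℚ.* (q ℚ.- r)
    distrib p q r = trans (cong (p ℚ.* q ℚ.+_) (ℚ.neg-distribʳ-* p r))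
      (sym (ℚ.*-distribˡ-+ p q (ℚ.- r)))

  0<½ε : ∀ {ε} → 0ℚ ℚ.< ε → 0ℚ ℚ.< ½ ℚ.* ε
  0<½ε {ε} 0<ε = subst (ℚ._< ½ ℚ.* ε) (ℚ.*-zeroʳ ½) (ℚ.*-monoʳ-<-pos ½ 0<ε)

  ½ε+½ε : ∀ ε → ½ ℚ.* ε ℚ.+ ½ ℚ.* ε ≡ ε
  ½ε+½ε ε = trans (sym (ℚ.*-distribʳ-+ ε ½ ½)) (ℚ.*-identityˡ ε)

  const-cauchy : ∀ q → IsCauchy (λ _ → q)
  const-cauchy q ε 0<ε =
    0 , λ _ _ _ _ → subst (ℚ._< ε) (sym (cong ℚ.∣_∣ (ℚ.+-inverseʳ q))) 0<ε

  neg-cauchy : ∀ x → IsCauchy x → IsCauchy (λ n → ℚ.- x n)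
  neg-cauchy x cx ε 0<ε with N , hx ← cx ε 0<ε =
    N , λ m n N≤m N≤n → subst (ℚ._< ε) (eq (x m) (x n)) (hx m n N≤m N≤n)
    where
    eq : ∀ a b → ℚ.∣ a ℚ.- b ∣ ≡ ℚ.∣ ℚ.- a ℚ.- ℚ.- b ∣
    eq a b = trans (sym (ℚ.∣-p∣≡∣p∣ (a ℚ.- b)))
      (cong ℚ.∣_∣ (ℚ.neg-distrib-+ a (ℚ.- b)))

  +-cauchy : ∀ x y → IsCauchy x → IsCauchy y → IsCauchy (λ n → x n ℚ.+ y n)
  +-cauchy x y cx cy ε 0<ε
    with M , hx ← cx (½ ℚ.* ε) (0<½ε 0<ε)
       | N , hy ← cy (½ ℚ.* ε) (0<½ε 0<ε) =
    M ℕ.⊔ N , λ m n l l′ → begin-strict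
      ℚ.∣ (x m ℚ.+ y m) ℚ.- (x n ℚ.+ y n) ∣
        ≡⟨ cong ℚ.∣_∣ ([a+b]-[c+d] (x m) (y m) (x n) (y n)) ⟩
      ℚ.∣ (x m ℚ.- x n) ℚ.+ (y m ℚ.- y n) ∣
        ≤⟨ ℚ.∣p+q∣≤∣p∣+∣q∣ (x m ℚ.- x n) (y m ℚ.- y n) ⟩
      ℚ.∣ x m ℚ.- x n ∣ ℚ.+ ℚ.∣ y m ℚ.- y n ∣
        <⟨ ℚ.+-mono-< (hx m n (ℕ.m⊔n≤o⇒m≤o M N l) (ℕ.m⊔n≤o⇒m≤o M N l′))
                      (hy m n (ℕ.m⊔n≤o⇒n≤o M N l) (ℕ.m⊔n≤o⇒n≤o M N l′)) ⟩
      ½ ℚ.* ε ℚ.+ ½ ℚ.* ε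
        ≡⟨ ½ε+½ε ε ⟩
      ε ∎
    where open ℚ.≤-Reasoning

  bounded : ∀ x → IsCauchy x →
            ∃ λ B → 0ℚ ℚ.< B × ∃ λ N → ∀ n → N ℕ.≤ n → ℚ.∣ x n ∣ ℚ.≤ B
  bounded x cx with N , hx ← cx 1ℚ (ℚ.positive⁻¹ 1ℚ) =
    1ℚ ℚ.+ ℚ.∣ x N ∣ ,
    ℚ.+-mono-<-≤ (ℚ.positive⁻¹ 1ℚ) (ℚ.0≤∣p∣ (x N)) ,
    N , λ n N≤n → begin
      ℚ.∣ x n ∣
        ≡⟨ cong ℚ.∣_∣ (a≡[a-b]+b (x n) (x N)) ⟩
      ℚ.∣ (x n ℚ.- x N) ℚ.+ x N ∣
        ≤⟨ ℚ.∣p+q∣≤∣p∣+∣q∣ (x n ℚ.- x N) (x N) ⟩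
      ℚ.∣ x n ℚ.- x N ∣ ℚ.+ ℚ.∣ x N ∣
        ≤⟨ ℚ.+-monoˡ-≤ ℚ.∣ x N ∣ (ℚ.<⇒≤ (hx n N N≤n ℕ.≤-refl)) ⟩
      1ℚ ℚ.+ ℚ.∣ x N ∣ ∎
    where open ℚ.≤-Reasoning

  small : ∀ B → 0ℚ ℚ.< B → ∀ ε → 0ℚ ℚ.< ε → ∃ λ δ → 0ℚ ℚ.< δ × B ℚ.* δ ≡ ε
  small B 0<B ε 0<ε =
    1/B ℚ.* ε ,
    subst (ℚ._< 1/B ℚ.* ε) (ℚ.*-zeroʳ 1/B) (ℚ.*-monoʳ-<-pos 1/B 0<ε) ,
    trans (sym (ℚ.*-assoc B 1/B ε))
      (trans (cong (ℚ._* ε) (ℚ.*-inverseʳ B)) (ℚ.*-identityˡ ε))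
    where
    instance
      _ = ℚ.positive 0<B
      _ = ℚ.pos⇒nonZero B
    1/B = ℚ.1/ B
    instance
      _ = ℚ.1/pos⇒pos B

  *-small : ∀ a b B δ → 0ℚ ℚ.< B → ℚ.∣ a ∣ ℚ.≤ B → ℚ.∣ b ∣ ℚ.< δ →
            ℚ.∣ a ℚ.* b ∣ ℚ.< B ℚ.* δ
  *-small a b B δ 0<B a≤B b<δ = begin-strict
    ℚ.∣ a ℚ.* b ∣          ≡⟨ ℚ.∣p*q∣≡∣p∣*∣q∣ a b ⟩
    ℚ.∣ a ∣ ℚ.* ℚ.∣ b ∣    ≤⟨ ℚ.*-monoʳ-≤-nonNeg ℚ.∣ b ∣ a≤B ⟩
    B ℚ.* ℚ.∣ b ∣          <⟨ ℚ.*-monoʳ-<-pos B b<δ ⟩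
    B ℚ.* δ                ∎
    where
    open ℚ.≤-Reasoning
    instance
      _ = ℚ.positive 0<B
      _ = ℚ.∣-∣-nonNeg b

  *-cauchy : ∀ x y → IsCauchy x → IsCauchy y → IsCauchy (λ n → x n ℚ.* y n)
  *-cauchy x y cx cy ε 0<ε
    with A , 0<A , K , x≤A ← bounded x cx
       | B , 0<B , L , y≤B ← bounded y cy
    with δ , 0<δ , Aδ≡ ← small A 0<A (½ ℚ.* ε) (0<½ε 0<ε)
       | η , 0<η , Bη≡ ← small B 0<B (½ ℚ.* ε) (0<½ε 0<ε)
    with M , hy ← cy δ 0<δ
       | N , hx ← cx η 0<η =
    (K ℕ.⊔ L) ℕ.⊔ (M ℕ.⊔ N) , λ m n l l′ → begin-strict
      ℚ.∣ x m ℚ.* y m ℚ.- x n ℚ.* y n ∣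
        ≡⟨ cong ℚ.∣_∣ (ab-cd (x m) (y m) (x n) (y n)) ⟩
      ℚ.∣ x m ℚ.* (y m ℚ.- y n) ℚ.+ y n ℚ.* (x m ℚ.- x n) ∣
        ≤⟨ ℚ.∣p+q∣≤∣p∣+∣q∣ (x m ℚ.* (y m ℚ.- y n)) (y n ℚ.* (x m ℚ.- x n)) ⟩
      ℚ.∣ x m ℚ.* (y m ℚ.- y n) ∣ ℚ.+ ℚ.∣ y n ℚ.* (x m ℚ.- x n) ∣
        <⟨ ℚ.+-mono-<
             (*-small (x m) (y m ℚ.- y n) A δ 0<A (x≤A m (≤K l)) (hy m n (≤M l) (≤M l′)))
             (*-small (y n) (x m ℚ.- x n) B η 0<B (y≤B n (≤L l′)) (hx m n (≤N l) (≤N l′))) ⟩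
      A ℚ.* δ ℚ.+ B ℚ.* η
        ≡⟨ cong₂ ℚ._+_ Aδ≡ Bη≡ ⟩
      ½ ℚ.* ε ℚ.+ ½ ℚ.* ε
        ≡⟨ ½ε+½ε ε ⟩
      ε ∎
    where
    open ℚ.≤-Reasoning
    ≤K : ∀ {m} → (K ℕ.⊔ L) ℕ.⊔ (M ℕ.⊔ N) ℕ.≤ m → K ℕ.≤ m
    ≤K l = ℕ.m⊔n≤o⇒m≤o K L (ℕ.m⊔n≤o⇒m≤o (K ℕ.⊔ L) (M ℕ.⊔ N) l)
    ≤L : ∀ {m} → (K ℕ.⊔ L) ℕ.⊔ (M ℕ.⊔ N) ℕ.≤ m → L ℕ.≤ m
    ≤L l = ℕ.m⊔n≤o⇒n≤o K L (ℕ.m⊔n≤o⇒m≤o (K ℕ.⊔ L) (M ℕ.⊔ N) l)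
    ≤M : ∀ {m} → (K ℕ.⊔ L) ℕ.⊔ (M ℕ.⊔ N) ℕ.≤ m → M ℕ.≤ m
    ≤M l = ℕ.m⊔n≤o⇒m≤o M N (ℕ.m⊔n≤o⇒n≤o (K ℕ.⊔ L) (M ℕ.⊔ N) l)
    ≤N : ∀ {m} → (K ℕ.⊔ L) ℕ.⊔ (M ℕ.⊔ N) ℕ.≤ m → N ℕ.≤ m
    ≤N l = ℕ.m⊔n≤o⇒n≤o M N (ℕ.m⊔n≤o⇒n≤o (K ℕ.⊔ L) (M ℕ.⊔ N) l)

infixl 6 _+ᴿ_ _+ᶜ_
infixl 7 _*ᴿ_ _*ᶜ_

fromℚ : ℚ → ℝ
fromℚ q = mkℝ (λ _ → q) (const-cauchy q)

fromℤ : ℤ → ℝ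
fromℤ a = fromℚ (a ℚ./ 1)

0ᴿ : ℝ
0ᴿ = fromℚ 0ℚ

-ᴿ_ : ℝ → ℝ
-ᴿ x = mkℝ (λ n → ℚ.- seq x n) (neg-cauchy (seq x) (cauchy x))

_+ᴿ_ _*ᴿ_ : ℝ → ℝ → ℝ
x +ᴿ y = mkℝ (λ n → seq x n ℚ.+ seq y n) (+-cauchy (seq x) (seq y) (cauchy x) (cauchy y))
x *ᴿ y = mkℝ (λ n → seq x n ℚ.* seq y n) (*-cauchy (seq x) (seq y) (cauchy x) (cauchy y))

record ℂ : Set where
  constructor _+i_
  field
    re im : ℝ

open ℂ

_+ᶜ_ _*ᶜ_ : ℂ → ℂ → ℂ
(a +i b) +ᶜ (c +i d) = (a +ᴿ c) +i (b +ᴿ d)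
(a +i b) *ᶜ (c +i d) = (a *ᴿ c +ᴿ -ᴿ (b *ᴿ d)) +i (a *ᴿ d +ᴿ b *ᴿ c)

------------------------------------------------------------------------
-- Real-rootedness

-- Coefficient lists, constant term first.
ℝ[x] : Set
ℝ[x] = List ℝ

evaluate : ℝ[x] → ℂ → ℂ
evaluate []      z = 0ᴿ +i 0ᴿ
evaluate (a ∷ p) z = (a +i 0ᴿ) +ᶜ z *ᶜ evaluate p z

IsZeroOf : ℝ[x] → ℂ → Set
IsZeroOf p z = re (evaluate p z) ≈ 0ᴿ × im (evaluate p z) ≈ 0ᴿ

-- The Cauchy reals above contain all real algebraic numbers, so for
-- polynomials with integer coefficients quantifying over these complex
-- numbers misses no zero.
RealRooted : ℝ[x] → Set
RealRooted p = All (_≈ 0ᴿ) p ⊎ (∀ z → IsZeroOf p z → im z ≈ 0ᴿ)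

toℝ[x] : ℤ[x] → ℝ[x]
toℝ[x] = map fromℤ

{-# OPTIONS --safe #-}
module Submission where

-- Counting chains by their largest element, the f-polynomial of sd(C) is the
-- sum over the facets of the chain polynomials of the relative complexes R_i.
-- By stability each R_i is a d-cube with some facets removed, and only 2d + 2
-- polynomials p_0, …, p_d, q_0, …, q_d can occur; the first facet contributes
-- p_0, the polynomial of the full cube.  Consecutive members of this list differ
-- by the members of the list for d - 1, and (1 + y) q_d = y p_0.
--
-- Fix y in the upper half plane.  By induction on d the values of the list at y
-- turn monotonically through at most the angle from 1 + y to y, so a sum of
-- members containing p_0 cannot vanish unless p_0 does, and p_0 is 1 + y times
-- the sum of the list for d - 1.  Quantitatively, this gives
-- (Im z)^2e ≤ |h(z)|² M(z) with a polynomial M for all rational complex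
-- z = y / (1 + y), which is an inequality along the Cauchy sequences
-- representing a zero and forces Im z = 0.

-- In terms of z = y / (1 + y), passing from one list to the next sends (f_j) to the sums z (f_1 +
-- ... + f_i) + (f_{i+1} + ... + f_n) up to the factor 1 + y. Such Eulerian recursions are usually
-- treated by showing that they preserve interlacing, which compares zeros with one another. At a
-- fixed non-real point interlacing becomes a statement on arguments: the values turn one way,
-- through an angle below π because 1 + y and y lie in the same open half plane. Signs of bilinear
-- forms express this, and these signs are inherited by sums.
--
-- Neither Im z = 0 nor z = 1 can be decided for a complex number given by Cauchy sequences, while
-- over the rationals both can. The argument therefore runs at Gaussian rationals, and its outcome
-- is stated as an inequality between polynomials in the coordinates of z. Being free of
-- denominators it also covers z = 1, where y is undefined; and since operations on Cauchy sequences
-- act termwise, it can be read at every index of a given zero.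

open import Defs

open import Algebra.Bundles using (CommutativeRing; CommutativeSemiring)
open import Algebra.Core using (Op₂)
import Algebra.Properties.CommutativeSemigroup as CommutativeSemigroupProperties
import Algebra.Properties.CommutativeSemiring.Exp as Exp
import Algebra.Properties.Group as GroupProperties
import Algebra.Solver.Ring.NaturalCoefficients.Default as SemiringSolver
open import Algebra.Structures using (IsCommutativeSemiring)
open import Algebra.Structures.Biased using (isCommutativeSemiringˡ)
open import Data.Bool.Base using (Bool; true; false; if_then_else_)
import Data.Bool.Properties as Bool
open import Data.Fin.Base using (Fin; zero; suc)
open import Data.Fin.Induction using (po-noetherian)
import Data.Fin.Properties as Fin
open import Data.Fin.Subset using (Subset; inside; outside; ∣_∣; _∈_; _∉_; Nonempty)
  renaming (⊥ to ∅ₛ)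
open import Data.Fin.Subset.Properties
  using (_∈?_; nonempty?; ∣⊥∣≡0; drop-there)
open import Data.Integer.Base as ℤ using (ℤ; 0ℤ; 1ℤ; -1ℤ)
import Data.Integer.Properties as ℤ
open import Data.List.Base
  using (List; []; _∷_; _++_; map; foldr; filter; length; upTo; allFin; replicate; cartesianProductWith)
open import Data.List.Membership.Propositional using (lose) renaming (_∈_ to _∈ₗ_)
open import Data.List.Membership.Propositional.Properties
  using (∈-allFin; ∈-filter⁺; ∈-filter⁻; ∈-map⁺; ∈-map⁻; ∈-++⁺ˡ; ∈-++⁺ʳ; ∈-upTo⁺; ∈-upTo⁻;
         ∈-cartesianProductWith⁺)
open import Data.List.Membership.Propositional.Properties.WithK using (unique∧set⇒bag)
open import Data.List.Properties using (++-assoc)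
open import Data.List.Relation.Binary.BagAndSetEquality using (∼bag⇒↭)
open import Data.List.Relation.Binary.Permutation.Propositional as ↭ using (_↭_; prep)
open import Data.List.Relation.Binary.Permutation.Propositional.Properties using (shift)
open import Data.List.Relation.Unary.All as All using (All; []; _∷_)
import Data.List.Relation.Unary.All.Properties as All
open import Data.List.Relation.Unary.AllPairs using (AllPairs; []; _∷_)
open import Data.List.Relation.Unary.Any as Any using (here; there)
import Data.List.Relation.Unary.Any.Properties as Any
open import Data.List.Relation.Unary.Unique.Propositional using (Unique)
import Data.List.Relation.Unary.Unique.Propositional.Properties as Unique
open import Data.Nat.Base as ℕ using (ℕ; zero; suc; _∸_)
open import Data.Nat.Induction using (<-wellFounded)
import Data.Nat.Properties as ℕ
open import Data.Product.Base using (∃; _×_; _,_; proj₁; proj₂)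
open import Data.Rational.Base as ℚ using (ℚ; 0ℚ; 1ℚ; ½)
import Data.Rational.Properties as ℚ
import Data.Rational.Solver as ℚSolver
open import Data.Rational.Unnormalised.Base as ℚᵘ using (mkℚᵘ)
import Data.Rational.Unnormalised.Properties as ℚᵘ
open import Data.Sum.Base using (_⊎_; inj₁; inj₂)
open import Data.Vec.Base as Vec using (Vec; []; here; there; lookup; _[_]≔_)
  renaming (_∷_ to _∷ᵥ_)
import Data.Vec.Properties as Vec
open import Data.Vec.Relation.Binary.Pointwise.Inductive as Pointwise using (Pointwise; []; _∷_)
open import Function.Base using (_∘_)
open import Function.Bundles using (_⇔_; mk⇔; Equivalence)
open import Function.Construct.Composition using (_⇔-∘_)
open import Induction.WellFounded using (Acc; acc)
open import Level using (0ℓ)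
open import Relation.Binary.Bundles using (Poset)
import Relation.Binary.Construct.Add.Infimum.NonStrict as AddInfimum
open import Relation.Binary.Core using (Rel; REL)
open import Relation.Binary.Definitions using (DecidableEquality; tri<; tri≈; tri>)
  renaming (Decidable to Decidable₂)
open import Relation.Binary.Lattice.Structures using (IsBoundedLattice)
open import Relation.Binary.Morphism.Structures using (IsOrderIsomorphism)
open import Relation.Binary.PropositionalEquality
  using (_≡_; _≢_; _≗_; refl; sym; trans; cong; cong₂; subst; subst₂; isEquivalence; module ≡-Reasoning)
open import Relation.Binary.Construct.Add.Supremum.NonStrict {A = Bool} _≡_
  using (_≤⁺_; _≤⊤⁺; [_]; ≤⁺-dec; ≤⁺-reflexive-≡; ≤⁺-antisym-≡)
open import Relation.Binary.Structures using (IsPartialOrder)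
open import Relation.Nullary using (¬_; Dec; yes; no; does; contradiction; ¬?; _×-dec_; _→-dec_)
open import Relation.Nullary.Construct.Add.Infimum using (_₋; ⊥₋)
open import Relation.Nullary.Construct.Add.Supremum using (_⁺; ⊤⁺; [_]; ≡-dec; []-injective)
open import Relation.Nullary.Decidable using (map′)
open import Relation.Unary using (Pred; Decidable; U)

-- Finite sums and indicators

module FiniteSums {A : Set} {plus times : Op₂ A} {0# 1# : A}
  (isCommutativeSemiring : IsCommutativeSemiring _≡_ plus times 0# 1#) where

  commutativeSemiring : CommutativeSemiring 0ℓ 0ℓ
  commutativeSemiring = record { isCommutativeSemiring = isCommutativeSemiring }

  open CommutativeSemiring commutativeSemiring
    using (_+_; _*_; +-identityˡ; +-identityʳ; +-assoc; zeroʳ; distribˡ; +-commutativeSemigroup)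
  open CommutativeSemigroupProperties +-commutativeSemigroup using (interchange; x∙yz≈y∙xz)

  private
    variable
      X Y : Set
      P Q : Set

  opaque
    when : Dec P → A → A
    when d x = if does d then x else 0#

    when-yes : (d : Dec P) → P → ∀ x → when d x ≡ x
    when-yes (yes _) _ _ = refl
    when-yes (no ¬p) p _ = contradiction p ¬p

    when-no : (d : Dec P) → ¬ P → ∀ x → when d x ≡ 0#
    when-no (yes p) ¬p _ = contradiction p ¬p
    when-no (no _)  _  _ = refl

    when-⇔ : (d : Dec P) (e : Dec Q) → (P → Q) → (Q → P) → ∀ {x y} → (P → x ≡ y) →
             when d x ≡ when e y
    when-⇔ (yes p) e f g eq = trans (eq p) (sym (when-yes e (f p) _))
    when-⇔ (no ¬p) e f g eq = sym (when-no e (¬p ∘ g) _)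

    when-× : (d : Dec P) (e : Dec Q) → ∀ x → when (d ×-dec e) x ≡ when d (when e x)
    when-× (yes _) (yes _) _ = refl
    when-× (yes _) (no _)  _ = refl
    when-× (no _)  _       _ = refl

    when-split : (d : Dec P) → ∀ x → x ≡ when d x + when (¬? d) x
    when-split (yes _) x = sym (+-identityʳ x)
    when-split (no _)  x = sym (+-identityˡ x)

    when-0 : (d : Dec P) → when d 0# ≡ 0#
    when-0 (yes _) = refl
    when-0 (no _)  = refl

    when-+ : (d : Dec P) → ∀ x y → when d (x + y) ≡ when d x + when d y
    when-+ (yes _) x y = refl
    when-+ (no _)  x y = sym (+-identityˡ 0#)

    when-* : (d : Dec P) → ∀ c x → c * when d x ≡ when d (c * x)
    when-* (yes _) c x = refl
    when-* (no _)  c x = zeroʳ c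

    ∑ : List X → (X → A) → A
    ∑ []       f = 0#
    ∑ (x ∷ xs) f = f x + ∑ xs f

    ∑-cong-∈ : ∀ (xs : List X) {f g} → (∀ x → x ∈ₗ xs → f x ≡ g x) → ∑ xs f ≡ ∑ xs g
    ∑-cong-∈ []       eq = refl
    ∑-cong-∈ (x ∷ xs) eq = cong₂ _+_ (eq x (here refl)) (∑-cong-∈ xs (λ z → eq z ∘ there))

    ∑-cong : ∀ (xs : List X) {f g} → (∀ x → f x ≡ g x) → ∑ xs f ≡ ∑ xs g
    ∑-cong xs eq = ∑-cong-∈ xs (λ x _ → eq x)

    ∑-zero : ∀ (xs : List X) → ∑ xs (λ _ → 0#) ≡ 0#
    ∑-zero []       = refl
    ∑-zero (x ∷ xs) = trans (+-identityˡ _) (∑-zero xs)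

    ∑-zero′ : ∀ (xs : List X) {f} → (∀ x → f x ≡ 0#) → ∑ xs f ≡ 0#
    ∑-zero′ xs eq = trans (∑-cong xs eq) (∑-zero xs)

    ∑-+ : ∀ (xs : List X) f g → ∑ xs (λ x → f x + g x) ≡ ∑ xs f + ∑ xs g
    ∑-+ []       f g = sym (+-identityˡ 0#)
    ∑-+ (x ∷ xs) f g = trans (cong ((f x + g x) +_) (∑-+ xs f g)) (interchange _ _ _ _)

    ∑-* : ∀ (xs : List X) c f → ∑ xs (λ x → c * f x) ≡ c * ∑ xs f
    ∑-* []       c f = sym (zeroʳ c)
    ∑-* (x ∷ xs) c f = trans (cong ((c * f x) +_) (∑-* xs c f)) (sym (distribˡ c _ _))

    ∑-++ : ∀ (xs ys : List X) f → ∑ (xs ++ ys) f ≡ ∑ xs f + ∑ ys f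
    ∑-++ []       ys f = sym (+-identityˡ _)
    ∑-++ (x ∷ xs) ys f = trans (cong (f x +_) (∑-++ xs ys f)) (sym (+-assoc _ _ _))

    ∑-map : ∀ (h : X → Y) xs f → ∑ (map h xs) f ≡ ∑ xs (f ∘ h)
    ∑-map h []       f = refl
    ∑-map h (x ∷ xs) f = cong (f (h x) +_) (∑-map h xs f)

    ∑-swap : ∀ (xs : List X) (ys : List Y) (f : X → Y → A) →
             ∑ xs (λ x → ∑ ys (f x)) ≡ ∑ ys (λ y → ∑ xs (λ x → f x y))
    ∑-swap []       ys f = sym (∑-zero ys)
    ∑-swap (x ∷ xs) ys f = trans (cong (∑ ys (f x) +_) (∑-swap xs ys f)) (sym (∑-+ ys (f x) _))

    ∑-when : ∀ (d : Dec P) (xs : List X) f → ∑ xs (λ x → when d (f x)) ≡ when d (∑ xs f)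
    ∑-when (yes _) xs f = refl
    ∑-when (no _)  xs f = ∑-zero xs

    ∑-filter : ∀ {P : Pred X 0ℓ} (P? : Decidable P) xs f →
               ∑ (filter P? xs) f ≡ ∑ xs (λ x → when (P? x) (f x))
    ∑-filter P? []       f = refl
    ∑-filter P? (x ∷ xs) f with P? x
    ... | yes _ = cong (f x +_) (∑-filter P? xs f)
    ... | no _  = trans (∑-filter P? xs f) (sym (+-identityˡ _))

    ∑-↭ : ∀ {xs ys : List X} → xs ↭ ys → ∀ f → ∑ xs f ≡ ∑ ys f
    ∑-↭ ↭.refl         f = refl
    ∑-↭ (↭.prep x p)   f = cong (f x +_) (∑-↭ p f)
    ∑-↭ (↭.swap x y p) f = trans (x∙yz≈y∙xz _ _ _) (cong (λ s → f y + (f x + s)) (∑-↭ p f))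
    ∑-↭ (↭.trans p q)  f = trans (∑-↭ p f) (∑-↭ q f)

    ∑-[] : ∀ (f : X → A) → ∑ [] f ≡ 0#
    ∑-[] f = refl

    ∑-∷ : ∀ (x : X) xs f → ∑ (x ∷ xs) f ≡ f x + ∑ xs f
    ∑-∷ x xs f = refl

  -- Duplicate-free lists with the same members are permutations of each other; this applies to the
  -- filtered `xs` and the image of `ys`.
  ∑-reindex : ∀ {xs : List X} {ys : List Y} → Unique xs → Unique ys →
              (h : Y → X) → (∀ {y z} → h y ≡ h z → y ≡ z) →
              {P : Pred X 0ℓ} (P? : Decidable P) →
              (∀ {x} → x ∈ₗ xs → P x → ∃ λ y → y ∈ₗ ys × x ≡ h y) →
              (∀ {y} → y ∈ₗ ys → h y ∈ₗ xs × P (h y)) →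
              ∀ f → ∑ xs (λ x → when (P? x) (f x)) ≡ ∑ ys (f ∘ h)
  ∑-reindex {xs = xs} {ys} uxs uys h h-inj P? cover image f = begin
    ∑ xs (λ x → when (P? x) (f x)) ≡⟨ ∑-filter P? xs f ⟨
    ∑ (filter P? xs) f             ≡⟨ ∑-↭ (∼bag⇒↭ (unique∧set⇒bag (Unique.filter⁺ P? uxs)
                                       (Unique.map⁺ h-inj uys) (mk⇔ to from))) f ⟩
    ∑ (map h ys) f                 ≡⟨ ∑-map h ys f ⟩
    ∑ ys (f ∘ h)                   ∎
    where
    open ≡-Reasoning
    to : ∀ {x} → x ∈ₗ filter P? xs → x ∈ₗ map h ys
    to x∈ with ∈-filter⁻ P? x∈
    ... | x∈xs , px with cover x∈xs px
    ...   | y , y∈ys , refl = ∈-map⁺ h y∈ys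
    from : ∀ {x} → x ∈ₗ map h ys → x ∈ₗ filter P? xs
    from x∈ with ∈-map⁻ h x∈
    ... | y , y∈ys , refl = ∈-filter⁺ P? (proj₁ (image y∈ys)) (proj₂ (image y∈ys))

  ∑-δ : ∀ (_≟_ : DecidableEquality X) {xs} → Unique xs → ∀ {x} → x ∈ₗ xs → ∀ f →
        ∑ xs (λ y → when (x ≟ y) (f y)) ≡ f x
  ∑-δ _≟_ uxs {x} x∈xs f = trans
    (∑-reindex {ys = x ∷ []} uxs ([] ∷ []) (λ y → y) (λ eq → eq) (x ≟_)
      (λ { _ refl → x , here refl , refl }) (λ { (here refl) → x∈xs , refl }) f)
    (trans (∑-∷ x [] f) (trans (cong (f x +_) (∑-[] f)) (+-identityʳ (f x))))

-- Chains of faces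

∈-insert⁻ : ∀ {n} {S : Subset n} {F G} → G ∈ S [ F ]≔ inside → G ≡ F ⊎ G ∈ S
∈-insert⁻ {S = _ ∷ᵥ _} {zero}  {zero}  _         = inj₁ refl
∈-insert⁻ {S = _ ∷ᵥ _} {zero}  {suc G} (there p) = inj₂ (there p)
∈-insert⁻ {S = _ ∷ᵥ _} {suc F} {zero}  here      = inj₂ here
∈-insert⁻ {S = _ ∷ᵥ _} {suc F} {suc G} (there p) with ∈-insert⁻ {F = F} p
... | inj₁ refl = inj₁ refl
... | inj₂ q    = inj₂ (there q)

∈-insert⁺ : ∀ {n} {S : Subset n} {F G} → G ∈ S → G ∈ S [ F ]≔ inside
∈-insert⁺ {S = S} {F} {G} G∈S with F Fin.≟ G
... | yes refl = Vec.[]≔-updates S F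
... | no F≢G   = Vec.[]≔-minimal S G F (F≢G ∘ sym) G∈S

∣insert∣ : ∀ {n} {S : Subset n} {F} → F ∉ S → ∣ S [ F ]≔ inside ∣ ≡ suc ∣ S ∣
∣insert∣ {S = true  ∷ᵥ S} {zero}  F∉S = contradiction here F∉S
∣insert∣ {S = false ∷ᵥ S} {zero}  F∉S = refl
∣insert∣ {S = true  ∷ᵥ S} {suc F} F∉S = cong suc (∣insert∣ (F∉S ∘ there))
∣insert∣ {S = false ∷ᵥ S} {suc F} F∉S = ∣insert∣ (F∉S ∘ there)

module SubsetSums {A : Set} {plus times : Op₂ A} {0# 1# : A}
  (isCommutativeSemiring : IsCommutativeSemiring _≡_ plus times 0# 1#) where

  open FiniteSums isCommutativeSemiring
  open CommutativeSemiring commutativeSemiring using (_+_; +-identityˡ; +-identityʳ)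

  private
    variable
      n : ℕ

  ∑-subsets : ∀ (f : Subset (suc n) → A) → ∑ (subsets (suc n)) f ≡
              ∑ (subsets n) (f ∘ (inside ∷ᵥ_)) + ∑ (subsets n) (f ∘ (outside ∷ᵥ_))
  ∑-subsets f = trans (∑-++ (map (inside ∷ᵥ_) (subsets _)) _ f)
    (cong₂ _+_ (∑-map (inside ∷ᵥ_) (subsets _) f) (∑-map (outside ∷ᵥ_) (subsets _) f))

  ∑-subsets-empty : ∀ n (f : Subset n → A) →
                    ∑ (subsets n) (λ S → when (¬? (nonempty? S)) (f S)) ≡ f ∅ₛ
  ∑-subsets-empty zero    f = trans (∑-∷ _ _ _)
    (trans (cong₂ _+_ (when-yes (¬? (nonempty? {0} [])) (λ ()) (f [])) (∑-[] _)) (+-identityʳ _))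
  ∑-subsets-empty (suc n) f = begin
    ∑ (subsets (suc n)) (λ S → when (¬? (nonempty? S)) (f S))
      ≡⟨ ∑-subsets _ ⟩
    ∑ (subsets n) (λ S → when (¬? (nonempty? (inside ∷ᵥ S))) (f (inside ∷ᵥ S))) +
    ∑ (subsets n) (λ S → when (¬? (nonempty? (outside ∷ᵥ S))) (f (outside ∷ᵥ S)))
      ≡⟨ cong₂ _+_
           (∑-zero′ (subsets n) λ S → when-no (¬? (nonempty? (inside ∷ᵥ S))) (λ e → e (zero , here)) _)
           (∑-cong (subsets n) λ S → when-⇔ (¬? (nonempty? (outside ∷ᵥ S))) (¬? (nonempty? S))
             (λ e (x , x∈S) → e (suc x , there x∈S)) (λ { e (suc x , there x∈S) → e (x , x∈S) })
             (λ _ → refl)) ⟩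
    0# + ∑ (subsets n) (λ S → when (¬? (nonempty? S)) (f (outside ∷ᵥ S)))
      ≡⟨ +-identityˡ _ ⟩
    ∑ (subsets n) (λ S → when (¬? (nonempty? S)) (f (outside ∷ᵥ S)))
      ≡⟨ ∑-subsets-empty n _ ⟩
    f ∅ₛ ∎
    where open ≡-Reasoning

  -- Inserting `F` is a bijection from the subsets without `F` onto those containing it.
  ∑-subsets-insert : ∀ F (f : Subset n → A) →
    ∑ (subsets n) (λ S → when (F ∈? S) (f S)) ≡
    ∑ (subsets n) (λ S → when (¬? (F ∈? S)) (f (S [ F ]≔ inside)))
  ∑-subsets-insert {suc n} zero f = begin
    ∑ (subsets (suc n)) (λ S → when (zero ∈? S) (f S))
      ≡⟨ ∑-subsets _ ⟩
    ∑ (subsets n) (λ S → when (zero ∈? (inside ∷ᵥ S)) (f (inside ∷ᵥ S))) +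
    ∑ (subsets n) (λ S → when (zero ∈? (outside ∷ᵥ S)) (f (outside ∷ᵥ S)))
      ≡⟨ cong₂ _+_ (∑-cong (subsets n) λ S → when-yes (zero ∈? (inside ∷ᵥ S)) here _)
           (∑-cong (subsets n) λ S → when-no (zero ∈? (outside ∷ᵥ S)) (λ ()) _) ⟩
    ∑ (subsets n) (λ S → f (inside ∷ᵥ S)) + ∑ (subsets n) (λ _ → 0#)
      ≡⟨ cong (∑ (subsets n) (λ S → f (inside ∷ᵥ S)) +_) (∑-zero (subsets n)) ⟩
    ∑ (subsets n) (λ S → f (inside ∷ᵥ S)) + 0#
      ≡⟨ trans (+-identityʳ _) (sym (+-identityˡ _)) ⟩
    0# + ∑ (subsets n) (λ S → f (inside ∷ᵥ S))
      ≡⟨ cong (_+ ∑ (subsets n) (λ S → f (inside ∷ᵥ S))) (∑-zero (subsets n)) ⟨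
    ∑ (subsets n) (λ _ → 0#) + ∑ (subsets n) (λ S → f (inside ∷ᵥ S))
      ≡⟨ cong₂ _+_ (∑-cong (subsets n) λ S → when-no (¬? (zero ∈? (inside ∷ᵥ S))) (λ z → z here) _)
           (∑-cong (subsets n) λ S → when-yes (¬? (zero ∈? (outside ∷ᵥ S))) (λ ()) _) ⟨
    ∑ (subsets n) (λ S → when (¬? (zero ∈? (inside ∷ᵥ S))) (f (inside ∷ᵥ S))) +
    ∑ (subsets n) (λ S → when (¬? (zero ∈? (outside ∷ᵥ S))) (f (inside ∷ᵥ S)))
      ≡⟨ ∑-subsets _ ⟨
    ∑ (subsets (suc n)) (λ S → when (¬? (zero ∈? S)) (f (S [ zero ]≔ inside))) ∎
    where open ≡-Reasoning
  ∑-subsets-insert {suc n} (suc F) f = begin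
    ∑ (subsets (suc n)) (λ S → when (suc F ∈? S) (f S))
      ≡⟨ ∑-subsets _ ⟩
    ∑ (subsets n) (λ S → when (suc F ∈? (inside ∷ᵥ S)) (f (inside ∷ᵥ S))) +
    ∑ (subsets n) (λ S → when (suc F ∈? (outside ∷ᵥ S)) (f (outside ∷ᵥ S)))
      ≡⟨ cong₂ _+_ (half inside) (half outside) ⟩
    ∑ (subsets n) (λ S → when (¬? (suc F ∈? (inside ∷ᵥ S))) (f (inside ∷ᵥ (S [ F ]≔ inside)))) +
    ∑ (subsets n) (λ S → when (¬? (suc F ∈? (outside ∷ᵥ S))) (f (outside ∷ᵥ (S [ F ]≔ inside))))
      ≡⟨ ∑-subsets (λ S → when (¬? (suc F ∈? S)) (f (S [ suc F ]≔ inside))) ⟨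
    ∑ (subsets (suc n)) (λ S → when (¬? (suc F ∈? S)) (f (S [ suc F ]≔ inside))) ∎
    where
    open ≡-Reasoning
    half : ∀ b → ∑ (subsets n) (λ S → when (suc F ∈? (b ∷ᵥ S)) (f (b ∷ᵥ S))) ≡
      ∑ (subsets n) (λ S → when (¬? (suc F ∈? (b ∷ᵥ S))) (f (b ∷ᵥ (S [ F ]≔ inside))))
    half b = begin
      ∑ (subsets n) (λ S → when (suc F ∈? (b ∷ᵥ S)) (f (b ∷ᵥ S)))
        ≡⟨ ∑-cong (subsets n) (λ S → when-⇔ (suc F ∈? (b ∷ᵥ S)) (F ∈? S) drop-there there (λ _ → refl)) ⟩
      ∑ (subsets n) (λ S → when (F ∈? S) (f (b ∷ᵥ S)))
        ≡⟨ ∑-subsets-insert F (f ∘ (b ∷ᵥ_)) ⟩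
      ∑ (subsets n) (λ S → when (¬? (F ∈? S)) (f (b ∷ᵥ (S [ F ]≔ inside))))
        ≡⟨ ∑-cong (subsets n) (λ S → when-⇔ (¬? (F ∈? S)) (¬? (suc F ∈? (b ∷ᵥ S)))
             (_∘ drop-there) (_∘ there) (λ _ → refl)) ⟩
      ∑ (subsets n) (λ S → when (¬? (suc F ∈? (b ∷ᵥ S))) (f (b ∷ᵥ (S [ F ]≔ inside)))) ∎

module _ (C : PolytopalComplex) where
  open PolytopalComplex C

  𝒞? : ∀ Fs → Decidable (𝒞 Fs)
  𝒞? Fs G = Any.any? (G ≤?_) Fs

  PieceIsStable : List Face → Face → Set₁
  PieceIsStable earlier F = IsStable (record { complex = ↓ F ; Removed = λ G → 𝒞 earlier (proj₁ G) })

  PiecesAreStable : List Face → Set₁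
  PiecesAreStable Fs = ∀ earlier F later → Fs ≡ earlier ++ F ∷ later → PieceIsStable earlier F

module ChainPolynomial {A : Set} {plus times : Op₂ A} {0# 1# : A}
  (isCommutativeSemiring : IsCommutativeSemiring _≡_ plus times 0# 1#)
  (C : PolytopalComplex) (y : A) where

  open FiniteSums isCommutativeSemiring
  open SubsetSums isCommutativeSemiring
  open CommutativeSemiring commutativeSemiring
    using (_+_; _*_; +-identityˡ; +-identityʳ)
  open Exp commutativeSemiring using () renaming (_^_ to pow)
  open PolytopalComplex C
  open SimplicialComplex (sd C) using (IsFace; isFace?; closed)

  private
    module ≤ = IsPartialOrder isPartialOrder

  IsMax : Subset size → Pred Face 0ℓ
  IsMax S F = F ∈ S × (∀ G → G ∈ S → G ≤ F)

  isMax? : ∀ S → Decidable (IsMax S)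
  isMax? S F = (F ∈? S) ×-dec Fin.all? (λ G → (G ∈? S) →-dec (G ≤? F))

  isMax-unique : ∀ {S F G} → IsMax S F → IsMax S G → F ≡ G
  isMax-unique (F∈S , maxF) (G∈S , maxG) = ≤.antisym (maxG _ F∈S) (maxF _ G∈S)

  hasMax : ∀ {S} → IsFace S → Nonempty S → ∃ (IsMax S)
  hasMax {S} (_ , chain) (F , F∈S) = go F F∈S (po-noetherian isPartialOrder F)
    where
    go : ∀ F → F ∈ S → Acc _ F → ∃ (IsMax S)
    go F F∈S (acc rs) with Fin.any? (λ G → (G ∈? S) ×-dec ((F ≤? G) ×-dec ¬? (F ≟ G)))
    ... | yes (G , G∈S , F≤G , F≢G) = go G G∈S (rs (F≤G , F≢G))
    ... | no ¬∃ = F , F∈S , λ G G∈S → below G G∈S (chain F G F∈S G∈S)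
      where
      below : ∀ G → G ∈ S → F ≤ G ⊎ G ≤ F → G ≤ F
      below G G∈S (inj₂ G≤F) = G≤F
      below G G∈S (inj₁ F≤G) with F ≟ G
      ... | yes refl = ≤.refl
      ... | no F≢G   = contradiction (G , G∈S , F≤G , F≢G) ¬∃

  weight : Subset size → A
  weight S = pow y ∣ S ∣

  Inside : Pred Face 0ℓ → Pred (Subset size) 0ℓ
  Inside D S = ∀ F → F ∈ S → D F

  inside? : ∀ {D} → Decidable D → Decidable (Inside D)
  inside? D? S = Fin.all? (λ F → (F ∈? S) →-dec D? F)

  chainsIn : ∀ {D} → Decidable D → A
  chainsIn D? = ∑ (subsets size) (λ S → when (isFace? S ×-dec inside? D? S) (weight S))

  nonemptyChainsWithMax : Face → A
  nonemptyChainsWithMax F = ∑ (subsets size) (λ S → when (isFace? S ×-dec isMax? S F) (weight S))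

  -- A nonempty chain has exactly one largest element, and as `D` is closed downwards the chain lies
  -- in `D` as soon as that element does. The summand `1#` is the empty chain.
  chainsIn-decomposition : ∀ {D} (D? : Decidable D) → (∀ {F G} → G ≤ F → D F → D G) →
    chainsIn D? ≡ 1# + ∑ (allFin size) (λ F → when (D? F) (nonemptyChainsWithMax F))
  chainsIn-decomposition {D} D? down = begin
    chainsIn D?
      ≡⟨ ∑-cong (subsets size) (λ S → pointwise S (nonempty? S) (isFace? S)) ⟩
    ∑ (subsets size) (λ S → when (¬? (nonempty? S)) (weight S) + maxSum S)
      ≡⟨ ∑-+ (subsets size) _ _ ⟩
    ∑ (subsets size) (λ S → when (¬? (nonempty? S)) (weight S)) + ∑ (subsets size) maxSum
      ≡⟨ cong₂ _+_ (trans (∑-subsets-empty size weight) (cong (pow y) (∣⊥∣≡0 size)))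
           (∑-swap (subsets size) (allFin size) _) ⟩
    1# + ∑ (allFin size) (λ F → ∑ (subsets size) (λ S →
           when (D? F) (when (isFace? S ×-dec isMax? S F) (weight S))))
      ≡⟨ cong (1# +_) (∑-cong (allFin size) λ F → ∑-when (D? F) (subsets size) _) ⟩
    1# + ∑ (allFin size) (λ F → when (D? F) (nonemptyChainsWithMax F)) ∎
    where
    open ≡-Reasoning
    maxTerm : Subset size → Face → A
    maxTerm S F = when (D? F) (when (isFace? S ×-dec isMax? S F) (weight S))
    maxSum : Subset size → A
    maxSum S = ∑ (allFin size) (maxTerm S)
    noMax : ∀ S → (∀ F → ¬ (IsFace S × IsMax S F)) → maxSum S ≡ 0#
    noMax S ¬max = ∑-zero′ (allFin size) λ F →
      trans (cong (when (D? F)) (when-no (isFace? S ×-dec isMax? S F) (¬max F) _)) (when-0 (D? F))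
    pointwise : ∀ S → Dec (Nonempty S) → Dec (IsFace S) → when (isFace? S ×-dec inside? D? S) (weight S) ≡
                      when (¬? (nonempty? S)) (weight S) + maxSum S
    pointwise S (no empty) _ = begin
      when (isFace? S ×-dec inside? D? S) (weight S)
        ≡⟨ when-yes (isFace? S ×-dec inside? D? S)
             (((λ F F∈S _ → empty (F , F∈S)) , (λ F _ F∈S _ → contradiction (F , F∈S) empty))
             , λ F F∈S → contradiction (F , F∈S) empty) _ ⟩
      weight S      ≡⟨ +-identityʳ _ ⟨
      weight S + 0# ≡⟨ cong (weight S +_) (noMax S λ F (_ , F∈S , _) → empty (F , F∈S)) ⟨
      weight S + maxSum S
        ≡⟨ cong (_+ maxSum S) (when-yes (¬? (nonempty? S)) empty _) ⟨
      when (¬? (nonempty? S)) (weight S) + maxSum S ∎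
    pointwise S (yes nonempty) (no ¬face) =
      trans (when-no (isFace? S ×-dec inside? D? S) (¬face ∘ proj₁) _)
        (sym (trans (cong₂ _+_ (when-no (¬? (nonempty? S)) (λ e → e nonempty) _)
          (noMax S λ F → ¬face ∘ proj₁)) (+-identityˡ 0#)))
    pointwise S (yes nonempty) (yes face) with hasMax face nonempty
    ... | F₀ , max@(F₀∈S , F₀-max) = sym (begin
      when (¬? (nonempty? S)) (weight S) + maxSum S
        ≡⟨ cong (_+ maxSum S) (when-no (¬? (nonempty? S)) (λ e → e nonempty) _) ⟩
      0# + maxSum S ≡⟨ +-identityˡ _ ⟩
      maxSum S
        ≡⟨ ∑-cong (allFin size) (λ F → trans (sym (when-× (D? F) (isFace? S ×-dec isMax? S F) _))
             (trans (when-⇔ (D? F ×-dec (isFace? S ×-dec isMax? S F)) ((F₀ ≟ F) ×-dec D? F)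
               (λ (d , _ , m) → isMax-unique max m , d) (λ { (refl , d) → d , face , max }) (λ _ → refl))
               (when-× (F₀ ≟ F) (D? F) _))) ⟩
      ∑ (allFin size) (λ F → when (F₀ ≟ F) (when (D? F) (weight S)))
        ≡⟨ ∑-δ _≟_ (Unique.allFin⁺ size) (∈-allFin F₀) _ ⟩
      when (D? F₀) (weight S)
        ≡⟨ when-⇔ (D? F₀) (isFace? S ×-dec inside? D? S)
             (λ d → face , λ G G∈S → down (F₀-max G G∈S) d) (λ (_ , i) → i F₀ F₀∈S) (λ _ → refl) ⟩
      when (isFace? S ×-dec inside? D? S) (weight S) ∎)

  Below : Face → Pred Face 0ℓ
  Below F G = G ≤ F × G ≢ F

  below? : ∀ F → Decidable (Below F)
  below? F G = (G ≤? F) ×-dec ¬? (G ≟ F)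

  -- Deleting `F` from such a chain leaves an arbitrary chain of nonempty proper faces of `F`; the
  -- factor `y` is the weight of the deleted element.
  nonemptyChainsWithMax-≢∅ : ∀ {F} → F ≢ ∅ → nonemptyChainsWithMax F ≡ y * chainsIn (below? F)
  nonemptyChainsWithMax-≢∅ {F} F≢∅ = begin
    nonemptyChainsWithMax F
      ≡⟨ ∑-cong (subsets size) (λ S → trans
           (when-⇔ (isFace? S ×-dec isMax? S F) ((F ∈? S) ×-dec (isFace? S ×-dec isMax? S F))
             (λ (f , m) → proj₁ m , f , m) proj₂ (λ _ → refl))
           (when-× (F ∈? S) _ _)) ⟩
    ∑ (subsets size) (λ S → when (F ∈? S) (when (isFace? S ×-dec isMax? S F) (weight S)))
      ≡⟨ ∑-subsets-insert F _ ⟩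
    ∑ (subsets size) (λ S → when (¬? (F ∈? S))
      (when (isFace? (insert S) ×-dec isMax? (insert S) F) (weight (insert S))))
      ≡⟨ ∑-cong (subsets size) (λ S → trans (sym (when-× (¬? (F ∈? S)) _ _))
           (when-⇔ (¬? (F ∈? S) ×-dec (isFace? (insert S) ×-dec isMax? (insert S) F))
             (isFace? S ×-dec inside? (below? F) S) (fwd S) (bwd S)
             (λ (F∉S , _) → cong (pow y) (∣insert∣ F∉S)))) ⟩
    ∑ (subsets size) (λ S → when (isFace? S ×-dec inside? (below? F) S) (y * weight S))
      ≡⟨ ∑-cong (subsets size) (λ S → sym (when-* (isFace? S ×-dec inside? (below? F) S) y _)) ⟩
    ∑ (subsets size) (λ S → y * when (isFace? S ×-dec inside? (below? F) S) (weight S))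
      ≡⟨ ∑-* (subsets size) y _ ⟩
    y * chainsIn (below? F) ∎
    where
    open ≡-Reasoning
    insert : Subset size → Subset size
    insert S = S [ F ]≔ inside
    fwd : ∀ S → F ∉ S × IsFace (insert S) × IsMax (insert S) F → IsFace S × Inside (Below F) S
    fwd S (F∉S , face , _ , max) = closed {S} {insert S} ∈-insert⁺ face ,
      λ G G∈S → max G (∈-insert⁺ G∈S) , λ { refl → F∉S G∈S }
    bwd : ∀ S → IsFace S × Inside (Below F) S → F ∉ S × IsFace (insert S) × IsMax (insert S) F
    bwd S ((ne , chain) , below) =
      (λ F∈S → proj₂ (below F F∈S) refl) ,
      ((λ G G∈ → ne′ G (∈-insert⁻ G∈)) , (λ G H G∈ H∈ → chain′ G H (∈-insert⁻ G∈) (∈-insert⁻ H∈))) ,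
      Vec.[]≔-updates S F , (λ G G∈ → max′ G (∈-insert⁻ G∈))
      where
      ne′ : ∀ G → G ≡ F ⊎ G ∈ S → G ≢ ∅
      ne′ G (inj₁ refl) = F≢∅
      ne′ G (inj₂ G∈S)  = ne G G∈S
      chain′ : ∀ G H → G ≡ F ⊎ G ∈ S → H ≡ F ⊎ H ∈ S → G ≤ H ⊎ H ≤ G
      chain′ G H (inj₁ refl) (inj₁ refl) = inj₁ ≤.refl
      chain′ G H (inj₁ refl) (inj₂ H∈S)  = inj₂ (proj₁ (below H H∈S))
      chain′ G H (inj₂ G∈S)  (inj₁ refl) = inj₁ (proj₁ (below G G∈S))
      chain′ G H (inj₂ G∈S)  (inj₂ H∈S)  = chain G H G∈S H∈S
      max′ : ∀ G → G ≡ F ⊎ G ∈ S → G ≤ F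
      max′ G (inj₁ refl) = ≤.refl
      max′ G (inj₂ G∈S)  = proj₁ (below G G∈S)

  nonemptyChainsWithMax-∅ : nonemptyChainsWithMax ∅ ≡ 0#
  nonemptyChainsWithMax-∅ = ∑-zero′ (subsets size) λ S →
    when-no (isFace? S ×-dec isMax? S ∅) (λ ((ne , _) , ∅∈S , _) → ne ∅ ∅∈S refl) _

  -- The empty chain is booked under the member `∅`, so that the chains in any lower set containing
  -- `∅` are counted by one sum over its members.
  chainsWithMax : Face → A
  chainsWithMax F = when (∅ ≟ F) 1# + nonemptyChainsWithMax F

  chainsWithMax-∅ : chainsWithMax ∅ ≡ 1#
  chainsWithMax-∅ = trans (cong₂ _+_ (when-yes (∅ ≟ ∅) refl 1#) nonemptyChainsWithMax-∅) (+-identityʳ 1#)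

  chainsIn-∑ : ∀ {D} (D? : Decidable D) → (∀ {F G} → G ≤ F → D F → D G) → D ∅ →
    chainsIn D? ≡ ∑ (allFin size) (λ F → when (D? F) (chainsWithMax F))
  chainsIn-∑ D? down D∅ = begin
    chainsIn D?
      ≡⟨ chainsIn-decomposition D? down ⟩
    1# + ∑ (allFin size) (λ F → when (D? F) (nonemptyChainsWithMax F))
      ≡⟨ cong₂ _+_ (trans (sym (when-yes (D? ∅) D∅ 1#))
           (sym (∑-δ _≟_ (Unique.allFin⁺ size) (∈-allFin ∅) _))) refl ⟩
    ∑ (allFin size) (λ F → when (∅ ≟ F) (when (D? F) 1#)) +
    ∑ (allFin size) (λ F → when (D? F) (nonemptyChainsWithMax F))
      ≡⟨ cong₂ _+_ (∑-cong (allFin size) λ F → trans (sym (when-× (∅ ≟ F) (D? F) _))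
           (trans (when-⇔ ((∅ ≟ F) ×-dec D? F) (D? F ×-dec (∅ ≟ F)) (λ (p , q) → q , p) (λ (p , q) → q , p)
             (λ _ → refl)) (when-× (D? F) (∅ ≟ F) _))) refl ⟩
    ∑ (allFin size) (λ F → when (D? F) (when (∅ ≟ F) 1#)) +
    ∑ (allFin size) (λ F → when (D? F) (nonemptyChainsWithMax F))
      ≡⟨ ∑-+ (allFin size) _ _ ⟨
    ∑ (allFin size) (λ F → when (D? F) (when (∅ ≟ F) 1#) + when (D? F) (nonemptyChainsWithMax F))
      ≡⟨ ∑-cong (allFin size) (λ F → sym (when-+ (D? F) _ _)) ⟩
    ∑ (allFin size) (λ F → when (D? F) (chainsWithMax F)) ∎
    where open ≡-Reasoning

  chainsWithMax-≢∅ : ∀ {F} → F ≢ ∅ →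
    chainsWithMax F ≡ y * ∑ (allFin size) (λ G → when (below? F G) (chainsWithMax G))
  chainsWithMax-≢∅ {F} F≢∅ = begin
    chainsWithMax F
      ≡⟨ cong (_+ nonemptyChainsWithMax F) (when-no (∅ ≟ F) (F≢∅ ∘ sym) 1#) ⟩
    0# + nonemptyChainsWithMax F
      ≡⟨ +-identityˡ _ ⟩
    nonemptyChainsWithMax F
      ≡⟨ nonemptyChainsWithMax-≢∅ F≢∅ ⟩
    y * chainsIn (below? F)
      ≡⟨ cong (y *_) (chainsIn-∑ (below? F) down (∅-minimum F , F≢∅ ∘ sym)) ⟩
    y * ∑ (allFin size) (λ G → when (below? F G) (chainsWithMax G)) ∎
    where
    open ≡-Reasoning
    down : ∀ {G H} → H ≤ G → Below F G → Below F H
    down H≤G (G≤F , G≢F) = ≤.trans H≤G G≤F , λ { refl → G≢F (≤.antisym G≤F H≤G) }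

  ∑-allFaces-weight : ∑ (allFaces (sd C)) weight ≡ ∑ (allFin size) chainsWithMax
  ∑-allFaces-weight = begin
    ∑ (allFaces (sd C)) weight
      ≡⟨ ∑-filter isFace? (subsets size) weight ⟩
    ∑ (subsets size) (λ S → when (isFace? S) (weight S))
      ≡⟨ ∑-cong (subsets size) (λ S → when-⇔ (isFace? S) (isFace? S ×-dec inside? all S) (_, _) proj₁ (λ _ → refl)) ⟩
    chainsIn all
      ≡⟨ chainsIn-∑ all _ _ ⟩
    ∑ (allFin size) (λ F → when (all F) (chainsWithMax F))
      ≡⟨ ∑-cong (allFin size) (λ F → when-yes (all F) _ _) ⟩
    ∑ (allFin size) chainsWithMax ∎
    where
    open ≡-Reasoning
    all : Decidable {A = Face} U
    all _ = yes _

  -- Only the largest element of a chain has to avoid `𝒞 earlier`; its other elements may lie there.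
  -- This is what makes the pieces add up to all chains.
  piece : List Face → Face → A
  piece earlier F = ∑ (allFin size) (λ G → when ((G ≤? F) ×-dec ¬? (𝒞? C earlier G)) (chainsWithMax G))

-- The polynomials of the half-open cubes

module CubePolynomials {A : Set} {plus times : Op₂ A} {0# 1# : A}
  (isCommutativeSemiring : IsCommutativeSemiring _≡_ plus times 0# 1#) (y : A) where

  open FiniteSums isCommutativeSemiring using (commutativeSemiring)
  open CommutativeSemiring commutativeSemiring
    using (_+_; _*_; +-identityʳ; +-identityˡ)
  open SemiringSolver commutativeSemiring using (solve; _:=_; _:+_; _:*_; con)

  -- A sequence s gives weight s n to the n-dimensional faces of a cube.  A
  -- coordinate in which a face may be one of α vertices or, in β ways, the
  -- whole edge acts on sequences by (α , β).
  Operator : Set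
  Operator = A × A

  apply₁ : Operator → (ℕ → A) → ℕ → A
  apply₁ (α , β) s n = α * s n + β * s (suc n)

  apply : List Operator → (ℕ → A) → ℕ → A
  apply []       s = s
  apply (φ ∷ φs) s = apply₁ φ (apply φs s)

  fullₒ halfₒ shiftₒ idₒ : Operator
  fullₒ  = 1# + 1# , 1#
  halfₒ  = 1# , 1#
  shiftₒ = 0# , 1#
  idₒ    = 1# , 0#

  apply₁-full : ∀ s n → apply₁ fullₒ s n ≡ apply₁ halfₒ s n + s n
  apply₁-full s n = solve 2 (λ a b → (con 1 :+ con 1) :* a :+ con 1 :* b := con 1 :* a :+ con 1 :* b :+ a)
    refl (s n) (s (suc n))

  apply₁-shift : ∀ s n → apply₁ shiftₒ s n ≡ s (suc n)
  apply₁-shift s n = solve 2 (λ a b → con 0 :* a :+ con 1 :* b := b) refl (s n) (s (suc n))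

  apply₁-id : ∀ s n → apply₁ idₒ s n ≡ s n
  apply₁-id s n = solve 2 (λ a b → con 1 :* a :+ con 0 :* b := a) refl (s n) (s (suc n))

  apply₁-half : ∀ s n → apply₁ halfₒ s n ≡ apply₁ shiftₒ s n + s n
  apply₁-half s n = solve 2 (λ a b → con 1 :* a :+ con 1 :* b := con 0 :* a :+ con 1 :* b :+ a)
    refl (s n) (s (suc n))

  apply₁-cong : ∀ φ {s s′} → s ≗ s′ → apply₁ φ s ≗ apply₁ φ s′
  apply₁-cong (α , β) eq n = cong₂ (λ a b → α * a + β * b) (eq n) (eq (suc n))

  -- Both operators are linear polynomials in the shift `s ↦ s ∘ suc`.
  apply₁-comm : ∀ φ ψ s → apply₁ φ (apply₁ ψ s) ≗ apply₁ ψ (apply₁ φ s)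
  apply₁-comm (α , β) (γ , δ) s n = solve 7 (λ α β γ δ a b c →
    α :* (γ :* a :+ δ :* b) :+ β :* (γ :* b :+ δ :* c) :=
    γ :* (α :* a :+ β :* b) :+ δ :* (α :* b :+ β :* c)) refl
    α β γ δ (s n) (s (suc n)) (s (suc (suc n)))

  apply-↭ : ∀ {φs ψs} → φs ↭ ψs → ∀ s → apply φs s ≗ apply ψs s
  apply-↭ ↭.refl         s n = refl
  apply-↭ (↭.prep φ p)   s n = apply₁-cong φ (apply-↭ p s) n
  apply-↭ (↭.swap {xs = φs} φ ψ p) s n = trans (apply₁-comm φ ψ (apply φs s) n)
    (apply₁-cong ψ (apply₁-cong φ (apply-↭ p s)) n)
  apply-↭ (↭.trans p q)  s n = trans (apply-↭ p s n) (apply-↭ q s n)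

  apply-shift : ∀ φs s n → apply φs (s ∘ suc) n ≡ apply φs s (suc n)
  apply-shift []       s n = refl
  apply-shift (φ@(α , β) ∷ φs) s n =
    cong₂ (λ a b → α * a + β * b) (apply-shift φs s n) (apply-shift φs s (suc n))

  -- A cube has a single face of full dimension `e`, so the value at `n + e` enters with coefficient
  -- one, and beyond it only the values at `n`, ..., `n + e - 1` enter.
  apply-full-≤ : ∀ e n {f g δ} → (∀ i → i ℕ.< e → f (n ℕ.+ i) ≡ g (n ℕ.+ i)) → f (n ℕ.+ e) ≡ g (n ℕ.+ e) + δ →
                 apply (replicate e fullₒ) f n ≡ apply (replicate e fullₒ) g n + δ
  apply-full-≤ zero n {f} {g} {δ} _ eq = subst (λ m → f m ≡ g m + δ) (ℕ.+-identityʳ n) eq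
  apply-full-≤ (suc e) n {f} {g} {δ} agree eq = trans
    (cong₂ (λ a b → (1# + 1#) * a + 1# * b)
      (apply-full-≤ e n {f} {g} {0#} (λ i i<e → agree i (ℕ.m<n⇒m<1+n i<e))
        (trans (agree e ℕ.≤-refl) (sym (+-identityʳ _))))
      (apply-full-≤ e (suc n) {f} {g} {δ}
        (λ i i<e → subst (λ m → f m ≡ g m) (ℕ.+-suc n i) (agree (suc i) (ℕ.s<s i<e)))
        (subst (λ m → f m ≡ g m + δ) (ℕ.+-suc n e) eq)))
    (solve 3 (λ a b δ → (con 1 :+ con 1) :* (a :+ con 0) :+ con 1 :* (b :+ δ) :=
      (con 1 :+ con 1) :* a :+ con 1 :* b :+ δ) refl _ _ δ)

  -- tops e sums y^|S| over the chains S of nonempty faces of a cube whose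
  -- largest element is a given e-dimensional face.  topsBelow e tabulates tops
  -- at the arguments below e, extended by 0.
  topsBelow : ℕ → ℕ → A
  topsBelow zero    _ = 0#
  topsBelow (suc e) i with i ℕ.≟ e
  ... | yes _ = y * (1# + apply (replicate e fullₒ) (topsBelow e) 0)
  ... | no _  = topsBelow e i

  tops : ℕ → A
  tops e = y * (1# + apply (replicate e fullₒ) (topsBelow e) 0)

  topsBelow-≥ : ∀ {e i} → e ℕ.≤ i → topsBelow e i ≡ 0#
  topsBelow-≥ {zero}      _   = refl
  topsBelow-≥ {suc e} {i} e<i with i ℕ.≟ e
  ... | yes refl = contradiction e<i (ℕ.<-irrefl refl)
  ... | no _     = topsBelow-≥ (ℕ.<⇒≤ e<i)

  topsBelow-< : ∀ {e i} → i ℕ.< e → topsBelow e i ≡ tops i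
  topsBelow-< {suc e} {i} i<e with i ℕ.≟ e
  ... | yes refl = refl
  ... | no i≢e   = topsBelow-< (ℕ.≤∧≢⇒< (ℕ.s≤s⁻¹ i<e) i≢e)

  1[_≡0] : ℕ → A
  1[ zero  ≡0] = 1#
  1[ suc _ ≡0] = 0#

  -- The generating polynomials of the chains in an (i + k)-cube with k
  -- pairwise intersecting facets removed (p), and with both facets removed in
  -- k directions and one facet in each of the remaining i directions (q).  The
  -- empty chain is counted only if no facet is removed.
  p q : ℕ → ℕ → A
  p i k = 1[ k ≡0] + apply (replicate i fullₒ ++ replicate k halfₒ) tops 0
  q i k = apply (replicate i halfₒ ++ replicate k shiftₒ) tops 0

  private
    move : ∀ (φ ψ : Operator) i k → replicate i φ ++ replicate (suc k) ψ ↭ ψ ∷ replicate i φ ++ replicate k ψ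
    move φ ψ i k = shift ψ (replicate i φ) (replicate k ψ)

  -- Removing one further facet takes away its faces, and these form an (i + k)-cube in which again
  -- `k` facets are removed. If `k` is zero, the empty chain goes to that second summand.
  p-step : ∀ i k → p (suc i) k ≡ p i (suc k) + p i k
  p-step i k = begin
    1[ k ≡0] + apply₁ fullₒ s 0
      ≡⟨ cong (1[ k ≡0] +_) (apply₁-full s 0) ⟩
    1[ k ≡0] + (apply₁ halfₒ s 0 + s 0)
      ≡⟨ solve 3 (λ a b c → a :+ (b :+ c) := con 0 :+ b :+ (a :+ c)) refl _ _ _ ⟩
    0# + apply₁ halfₒ s 0 + (1[ k ≡0] + s 0)
      ≡⟨ cong (λ z → 0# + z + (1[ k ≡0] + s 0)) (apply-↭ (move fullₒ halfₒ i k) tops 0) ⟨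
    p i (suc k) + p i k ∎
    where
    open ≡-Reasoning
    s = apply (replicate i fullₒ ++ replicate k halfₒ) tops

  -- In one direction with a single removed facet the opposite facet is removed as well; what is
  -- taken away is an (i + k)-cube of the same kind.
  q-step : ∀ i k → q (suc i) k ≡ q i (suc k) + q i k
  q-step i k = trans (apply₁-half (apply (replicate i halfₒ ++ replicate k shiftₒ) tops) 0)
    (cong (_+ q i k) (sym (apply-↭ (move halfₒ shiftₒ i k) tops 0)))

  apply-shifts : ∀ k s n → apply (replicate k shiftₒ) s n ≡ s (n ℕ.+ k)
  apply-shifts zero    s n = cong s (sym (ℕ.+-identityʳ n))
  apply-shifts (suc k) s n = trans (apply₁-shift (apply (replicate k shiftₒ) s) n)
    (trans (apply-shifts k s (suc n)) (cong s (sym (ℕ.+-suc n k))))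

  apply-++-[] : ∀ (φs : List Operator) s → apply (φs ++ []) s ≗ apply φs s
  apply-++-[] []       s n = refl
  apply-++-[] (φ ∷ φs) s n = apply₁-cong φ (apply-++-[] φs s) n

  -- Both sides remove one facet in each direction, that is, all facets through a vertex or all
  -- facets avoiding it. In dimension zero they differ, by the empty chain.
  p-q : ∀ k → p 0 (suc k) ≡ q (suc k) 0
  p-q k = trans (+-identityˡ _) (sym (apply-++-[] (replicate (suc k) halfₒ) tops 0))

  q-tops : ∀ k → q 0 k ≡ tops k
  q-tops k = apply-shifts k tops 0

  private
    p-tops : ∀ e → p e 0 ≡ 1# + (apply (replicate e fullₒ) (topsBelow e) 0 + tops e)
    p-tops e = cong (1# +_) (trans (apply-++-[] (replicate e fullₒ) tops 0)
      (apply-full-≤ e 0 (λ i i<e → sym (topsBelow-< i<e))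
        (sym (trans (cong (_+ tops e) (topsBelow-≥ {e} ℕ.≤-refl)) (+-identityˡ _)))))

  -- With c counting the chains of proper faces, the empty one included, the chains with the whole
  -- cube on top contribute y c, and all chains together contribute (1 + y) c.
  p-q-wrap : ∀ e → (1# + y) * q 0 e ≡ y * p e 0
  p-q-wrap e = trans (cong ((1# + y) *_) (q-tops e))
    (trans (solve 2 (λ y a → (con 1 :+ y) :* (y :* (con 1 :+ a)) := y :* (con 1 :+ (a :+ y :* (con 1 :+ a))))
      refl y (apply (replicate e fullₒ) (topsBelow e) 0))
    (sym (cong (y *_) (p-tops e))))

  p-00 : p 0 0 ≡ 1# + y
  p-00 = solve 1 (λ y → con 1 :+ y :* (con 1 :+ con 0) := con 1 :+ y) refl y

  q-00 : q 0 0 ≡ y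
  q-00 = solve 1 (λ y → y :* (con 1 :+ con 0) := y) refl y

  InFamily : ℕ → A → Set
  InFamily d x = (∃ λ i → ∃ λ k → i ℕ.+ k ≡ d × x ≡ p i k) ⊎
                 (∃ λ i → ∃ λ k → i ℕ.+ k ≡ d × x ≡ q i k)

-- Sums over the faces of a cube

infix 4 _≤ᶜ_ _≟ᶜ_ _≟⁺_

_≤ᶜ_ : ∀ {d} → Rel (Vec (Bool ⁺) d) 0ℓ
_≤ᶜ_ = Pointwise _≤⁺_

_≟⁺_ : DecidableEquality (Bool ⁺)
_≟⁺_ = ≡-dec Bool._≟_

_≟ᶜ_ : ∀ {d} → DecidableEquality (Vec (Bool ⁺) d)
_≟ᶜ_ = Vec.≡-dec _≟⁺_

≤⁺-refl : ∀ {a} → a ≤⁺ a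
≤⁺-refl = ≤⁺-reflexive-≡ (λ eq → eq) refl

≤ᶜ-refl : ∀ {d} {v : Vec (Bool ⁺) d} → v ≤ᶜ v
≤ᶜ-refl = Pointwise.refl ≤⁺-refl

≤ᶜ-antisym : ∀ {d} {u v : Vec (Bool ⁺) d} → u ≤ᶜ v → v ≤ᶜ u → u ≡ v
≤ᶜ-antisym []       []       = refl
≤ᶜ-antisym (p ∷ ps) (q ∷ qs) = cong₂ _∷ᵥ_ (≤⁺-antisym-≡ (λ e _ → e) p q) (≤ᶜ-antisym ps qs)

cubeFaces : ∀ d → List (Vec (Bool ⁺) d)
cubeFaces zero    = [] ∷ []
cubeFaces (suc d) = cartesianProductWith _∷ᵥ_ (⊤⁺ ∷ [ true ] ∷ [ false ] ∷ []) (cubeFaces d)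

∈-cubeFaces : ∀ {d} (v : Vec (Bool ⁺) d) → v ∈ₗ cubeFaces d
∈-cubeFaces []       = here refl
∈-cubeFaces (a ∷ᵥ v) = ∈-cartesianProductWith⁺ _∷ᵥ_ (∈-values a) (∈-cubeFaces v)
  where
  ∈-values : ∀ a → a ∈ₗ (⊤⁺ ∷ [ true ] ∷ [ false ] ∷ [])
  ∈-values ⊤⁺        = here refl
  ∈-values [ true ]  = there (here refl)
  ∈-values [ false ] = there (there (here refl))

cubeFaces-unique : ∀ d → Unique (cubeFaces d)
cubeFaces-unique zero    = [] ∷ []
cubeFaces-unique (suc d) = Unique.cartesianProductWith⁺ _∷ᵥ_ Vec.∷-injective
  (((λ ()) ∷ (λ ()) ∷ []) ∷ ((λ ()) ∷ []) ∷ [] ∷ []) (cubeFaces-unique d)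

dim codim : ∀ {d} → Vec (Bool ⁺) d → ℕ
dim []              = 0
dim (⊤⁺     ∷ᵥ v)   = suc (dim v)
dim ([ _ ]  ∷ᵥ v)   = dim v
codim []            = 0
codim (⊤⁺    ∷ᵥ v)  = codim v
codim ([ _ ] ∷ᵥ v)  = suc (codim v)

dim+codim : ∀ {d} (v : Vec (Bool ⁺) d) → dim v ℕ.+ codim v ≡ d
dim+codim []             = refl
dim+codim (⊤⁺    ∷ᵥ v)   = cong suc (dim+codim v)
dim+codim ([ _ ] ∷ᵥ v)   = trans (ℕ.+-suc (dim v) (codim v)) (cong suc (dim+codim v))

dim-mono : ∀ {d} {u v : Vec (Bool ⁺) d} → u ≤ᶜ v → dim u ℕ.≤ dim v
dim-mono [] = ℕ.z≤n
dim-mono ([ refl ] ∷ ps) = dim-mono ps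
dim-mono ((⊤⁺    ≤⊤⁺) ∷ ps) = ℕ.s≤s (dim-mono ps)
dim-mono (([ _ ] ≤⊤⁺) ∷ ps) = ℕ.m≤n⇒m≤1+n (dim-mono ps)

dim-mono-< : ∀ {d} {u v : Vec (Bool ⁺) d} → u ≤ᶜ v → u ≢ v → dim u ℕ.< dim v
dim-mono-< [] u≢v = contradiction refl u≢v
dim-mono-< ([ refl ] ∷ ps) u≢v = dim-mono-< ps (u≢v ∘ cong (_ ∷ᵥ_))
dim-mono-< ((⊤⁺    ≤⊤⁺) ∷ ps) u≢v = ℕ.s<s (dim-mono-< ps (u≢v ∘ cong (_ ∷ᵥ_)))
dim-mono-< (([ _ ] ≤⊤⁺) ∷ ps) u≢v = ℕ.s≤s (dim-mono ps)

top : ∀ {d} → Vec (Bool ⁺) d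
top = Vec.replicate _ ⊤⁺

≤-top : ∀ {d} (v : Vec (Bool ⁺) d) → v ≤ᶜ top
≤-top []       = []
≤-top (a ∷ᵥ v) = (a ≤⊤⁺) ∷ ≤-top v

dim-top : ∀ d → dim (top {d}) ≡ d
dim-top zero    = refl
dim-top (suc d) = cong suc (dim-top d)

-- Removing from the cube the facets (i , b) with Q (lookup f i) b, where
-- (i , b) stands for the facet with i-th coordinate b, leaves the faces
-- whose coordinates are related to those of f by Avoids Q.
Avoids : REL (Bool ⁺) Bool 0ℓ → Rel (Bool ⁺) 0ℓ
Avoids Q a u = ∀ b → Q a b → u ≢ [ b ]

avoids? : ∀ {Q} → Decidable₂ Q → Decidable₂ (Avoids Q)
avoids? Q? a u = map′ (λ (p , q) → λ { true → p ; false → q }) (λ r → r true , r false)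
  ((Q? a true →-dec ¬? (u ≟⁺ [ true ])) ×-dec (Q? a false →-dec ¬? (u ≟⁺ [ false ])))

Equals Differs : REL (Bool ⁺) Bool 0ℓ
Equals  a b = a ≡ [ b ]
Differs a b = a ≢ [ b ]

equals? : Decidable₂ Equals
equals? a b = a ≟⁺ [ b ]

differs? : Decidable₂ Differs
differs? a b = ¬? (a ≟⁺ [ b ])

Hits : ∀ {d} → REL (Bool ⁺) Bool 0ℓ → Rel (Vec (Bool ⁺) d) 0ℓ
Hits Q f u = ∃ λ i → ∃ λ b → Q (lookup f i) b × lookup u i ≡ [ b ]

avoids⇒¬hits : ∀ {d Q} {f u : Vec (Bool ⁺) d} → Pointwise (Avoids Q) f u → ¬ Hits Q f u
avoids⇒¬hits (a ∷ as) (zero  , b , q , eq) = a b q eq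
avoids⇒¬hits (a ∷ as) (suc i , b , q , eq) = avoids⇒¬hits as (i , b , q , eq)

¬hits⇒avoids : ∀ {d Q} (f u : Vec (Bool ⁺) d) → ¬ Hits Q f u → Pointwise (Avoids Q) f u
¬hits⇒avoids []       []       ¬h = []
¬hits⇒avoids (a ∷ᵥ f) (c ∷ᵥ u) ¬h = (λ b q eq → ¬h (zero , b , q , eq)) ∷
  ¬hits⇒avoids f u (λ (i , h) → ¬h (suc i , h))

module CubeSums {A : Set} {plus times : Op₂ A} {0# 1# : A}
  (isCommutativeSemiring : IsCommutativeSemiring _≡_ plus times 0# 1#) (y : A) where

  open FiniteSums isCommutativeSemiring
  open CommutativeSemiring commutativeSemiring
    using (_+_; _*_; +-identityʳ; *-identityˡ; zeroˡ; +-identityˡ; +-comm; distribʳ)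
  open CubePolynomials isCommutativeSemiring y

  module _ {R : Rel (Bool ⁺) 0ℓ} (R? : Decidable₂ R) where

    factor : Bool ⁺ → Operator
    factor a = when (R? a [ true ]) 1# + when (R? a [ false ]) 1# , when (R? a ⊤⁺) 1#

    factors : ∀ {d} → Vec (Bool ⁺) d → List Operator
    factors []       = []
    factors (a ∷ᵥ f) = factor a ∷ factors f

    private
      related? : ∀ {d} → Decidable₂ (Pointwise R {d} {d})
      related? = Pointwise.decidable R?

    -- The coordinates of `u` vary independently and `dim` adds up over them: a coordinate `⊤⁺`
    -- shifts the weight sequence by one, a coordinate in `Bool` leaves it alone. So the sum is a
    -- product of commuting operators.
    ∑-cubeFaces : ∀ {d} (f : Vec (Bool ⁺) d) (s : ℕ → A) →
      ∑ (cubeFaces d) (λ u → when (related? f u) (s (dim u))) ≡ apply (factors f) s 0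
    ∑-cubeFaces []       s = trans (∑-∷ [] [] _)
      (trans (cong₂ _+_ (when-yes (related? [] []) [] (s 0)) (∑-[] _)) (+-identityʳ (s 0)))
    ∑-cubeFaces {suc d} (a ∷ᵥ f) s = begin
      ∑ (cubeFaces (suc d)) (λ u → when (related? (a ∷ᵥ f) u) (s (dim u)))
        ≡⟨ trans (split ⊤⁺ ([ true ] ∷ [ false ] ∷ [])) (cong (slice ⊤⁺ +_) (trans (split [ true ] ([ false ] ∷ []))
             (cong (slice [ true ] +_) (trans (split [ false ] [])
               (trans (cong (slice [ false ] +_) (∑-[] _)) (+-identityʳ _)))))) ⟩
      slice ⊤⁺ + (slice [ true ] + slice [ false ])
        ≡⟨ cong₂ _+_ (slice-* ⊤⁺) (cong₂ _+_ (slice-* [ true ]) (slice-* [ false ])) ⟩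
      when (R? a ⊤⁺) 1# * ∑ (cubeFaces d) (term (s ∘ suc)) +
      (when (R? a [ true ]) 1# * ∑ (cubeFaces d) (term s) + when (R? a [ false ]) 1# * ∑ (cubeFaces d) (term s))
        ≡⟨ cong₂ _+_ (cong (when (R? a ⊤⁺) 1# *_) (trans (∑-cubeFaces f (s ∘ suc)) (apply-shift (factors f) s 0)))
             (trans (sym (distribʳ _ _ _)) (cong (proj₁ (factor a) *_) (∑-cubeFaces f s))) ⟩
      when (R? a ⊤⁺) 1# * apply (factors f) s 1 + proj₁ (factor a) * apply (factors f) s 0
        ≡⟨ +-comm _ _ ⟩
      apply (factors (a ∷ᵥ f)) s 0 ∎
      where
      open ≡-Reasoning
      term : (ℕ → A) → Vec (Bool ⁺) d → A
      term s u = when (related? f u) (s (dim u))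
      slice : Bool ⁺ → A
      slice c = ∑ (cubeFaces d) (λ u → when (related? (a ∷ᵥ f) (c ∷ᵥ u)) (s (dim (c ∷ᵥ u))))
      split : ∀ c cs → ∑ (cartesianProductWith _∷ᵥ_ (c ∷ cs) (cubeFaces d)) (λ u → when (related? (a ∷ᵥ f) u) (s (dim u))) ≡
              slice c + ∑ (cartesianProductWith _∷ᵥ_ cs (cubeFaces d)) (λ u → when (related? (a ∷ᵥ f) u) (s (dim u)))
      split c cs = trans (∑-++ (map (c ∷ᵥ_) (cubeFaces d)) _ _) (cong₂ _+_ (∑-map (c ∷ᵥ_) (cubeFaces d) _) refl)
      slice-* : ∀ c → slice c ≡ when (R? a c) 1# * ∑ (cubeFaces d) (λ u → when (related? f u) (s (dim (c ∷ᵥ u))))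
      slice-* c = trans (∑-cong (cubeFaces d) λ u → trans
          (when-⇔ (related? (a ∷ᵥ f) (c ∷ᵥ u)) (R? a c ×-dec related? f u)
            (λ { (r ∷ rs) → r , rs }) (λ (r , rs) → r ∷ rs) (λ _ → refl))
          (trans (when-× (R? a c) (related? f u) _) (scale (R? a c) _)))
        (∑-* (cubeFaces d) _ _)
        where
        scale : ∀ {P : Set} (d : Dec P) x → when d x ≡ when d 1# * x
        scale (yes p) x = trans (when-yes (yes p) p x)
          (trans (sym (*-identityˡ x)) (cong (_* x) (sym (when-yes (yes p) p 1#))))
        scale (no ¬p) x = trans (when-no (no ¬p) ¬p x)
          (trans (sym (zeroˡ x)) (cong (_* x) (sym (when-no (no ¬p) ¬p 1#))))

  Above : Rel (Bool ⁺) 0ℓ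
  Above a u = u ≤⁺ a

  above? : Decidable₂ Above
  above? a u = ≤⁺-dec Bool._≟_ u a

  above⇒≥ : ∀ {d} {f u : Vec (Bool ⁺) d} → Pointwise Above f u → u ≤ᶜ f
  above⇒≥ []       = []
  above⇒≥ (p ∷ ps) = p ∷ above⇒≥ ps

  ≥⇒above : ∀ {d} {f u : Vec (Bool ⁺) d} → u ≤ᶜ f → Pointwise Above f u
  ≥⇒above []       = []
  ≥⇒above (p ∷ ps) = p ∷ ≥⇒above ps

  private
    factor-≡ : ∀ {R : Rel (Bool ⁺) 0ℓ} (R? : Decidable₂ R) a {x y z} →
      when (R? a [ true ]) 1# ≡ x → when (R? a [ false ]) 1# ≡ y → when (R? a ⊤⁺) 1# ≡ z →
      factor R? a ≡ (x + y , z)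
    factor-≡ R? a ex ey ez = cong₂ _,_ (cong₂ _+_ ex ey) ez

    idₒ≡ : ∀ b → (when (above? [ b ] [ true ]) 1# + when (above? [ b ] [ false ]) 1# , when (above? [ b ] ⊤⁺) 1#) ≡ idₒ
    idₒ≡ true  = trans (factor-≡ above? [ true ] (when-yes (above? [ true ] [ true ]) [ refl ] 1#)
      (when-no (above? [ true ] [ false ]) (λ { [ () ] }) 1#) (when-no (above? [ true ] ⊤⁺) (λ ()) 1#))
      (cong (_, 0#) (+-identityʳ 1#))
    idₒ≡ false = trans (factor-≡ above? [ false ] (when-no (above? [ false ] [ true ]) (λ { [ () ] }) 1#)
      (when-yes (above? [ false ] [ false ]) [ refl ] 1#) (when-no (above? [ false ] ⊤⁺) (λ ()) 1#))
      (cong (_, 0#) (+-identityˡ 1#))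

    above-⊤ : factor above? ⊤⁺ ≡ fullₒ
    above-⊤ = factor-≡ above? ⊤⁺ (when-yes (above? ⊤⁺ [ true ]) (_ ≤⊤⁺) 1#)
      (when-yes (above? ⊤⁺ [ false ]) (_ ≤⊤⁺) 1#) (when-yes (above? ⊤⁺ ⊤⁺) (_ ≤⊤⁺) 1#)

  apply-above : ∀ {d} (f : Vec (Bool ⁺) d) s → apply (factors above? f) s ≗ apply (replicate (dim f) fullₒ) s
  apply-above []             s n = refl
  apply-above (⊤⁺    ∷ᵥ f)   s n = trans (cong (λ φ → apply₁ φ (apply (factors above? f) s) n) above-⊤)
    (apply₁-cong fullₒ (apply-above f s) n)
  apply-above ([ b ] ∷ᵥ f)   s n = trans (cong (λ φ → apply₁ φ (apply (factors above? f) s) n) (idₒ≡ b))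
    (trans (apply₁-id (apply (factors above? f) s) n) (apply-above f s n))

  ∑-cubeFaces-≤ : ∀ {d} (f : Vec (Bool ⁺) d) s →
    ∑ (cubeFaces d) (λ u → when (Pointwise.decidable above? f u) (s (dim u))) ≡
    apply (replicate (dim f) fullₒ) s 0
  ∑-cubeFaces-≤ f s = trans (∑-cubeFaces above? f s) (apply-above f s 0)

  private
    avoidsEquals? : Decidable₂ (Avoids Equals)
    avoidsEquals? = avoids? equals?

    avoidsDiffers? : Decidable₂ (Avoids Differs)
    avoidsDiffers? = avoids? differs?

    equals-⊤ : factor avoidsEquals? ⊤⁺ ≡ fullₒ
    equals-⊤ = factor-≡ avoidsEquals? ⊤⁺ (when-yes (avoidsEquals? ⊤⁺ [ true ]) (λ _ ()) 1#)
      (when-yes (avoidsEquals? ⊤⁺ [ false ]) (λ _ ()) 1#) (when-yes (avoidsEquals? ⊤⁺ ⊤⁺) (λ _ ()) 1#)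

    equals-[] : ∀ b → factor avoidsEquals? [ b ] ≡ halfₒ
    equals-[] true  = trans (factor-≡ avoidsEquals? [ true ]
      (when-no (avoidsEquals? [ true ] [ true ]) (λ a → a true refl refl) 1#)
      (when-yes (avoidsEquals? [ true ] [ false ]) (λ { true _ () ; false () }) 1#)
      (when-yes (avoidsEquals? [ true ] ⊤⁺) (λ { _ _ () }) 1#)) (cong (_, 1#) (+-identityˡ 1#))
    equals-[] false = trans (factor-≡ avoidsEquals? [ false ]
      (when-yes (avoidsEquals? [ false ] [ true ]) (λ { false _ () ; true () }) 1#)
      (when-no (avoidsEquals? [ false ] [ false ]) (λ a → a false refl refl) 1#)
      (when-yes (avoidsEquals? [ false ] ⊤⁺) (λ { _ _ () }) 1#)) (cong (_, 1#) (+-identityʳ 1#))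

    differs-⊤ : factor avoidsDiffers? ⊤⁺ ≡ shiftₒ
    differs-⊤ = trans (factor-≡ avoidsDiffers? ⊤⁺
      (when-no (avoidsDiffers? ⊤⁺ [ true ]) (λ a → a true (λ ()) refl) 1#)
      (when-no (avoidsDiffers? ⊤⁺ [ false ]) (λ a → a false (λ ()) refl) 1#)
      (when-yes (avoidsDiffers? ⊤⁺ ⊤⁺) (λ { _ _ () }) 1#)) (cong (_, 1#) (+-identityˡ 0#))

    differs-[] : ∀ b → factor avoidsDiffers? [ b ] ≡ halfₒ
    differs-[] true  = trans (factor-≡ avoidsDiffers? [ true ]
      (when-yes (avoidsDiffers? [ true ] [ true ]) (λ { true n _ → n refl ; false _ () }) 1#)
      (when-no (avoidsDiffers? [ true ] [ false ]) (λ a → a false (λ ()) refl) 1#)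
      (when-yes (avoidsDiffers? [ true ] ⊤⁺) (λ { _ _ () }) 1#)) (cong (_, 1#) (+-identityʳ 1#))
    differs-[] false = trans (factor-≡ avoidsDiffers? [ false ]
      (when-no (avoidsDiffers? [ false ] [ true ]) (λ a → a true (λ ()) refl) 1#)
      (when-yes (avoidsDiffers? [ false ] [ false ]) (λ { false n _ → n refl ; true _ () }) 1#)
      (when-yes (avoidsDiffers? [ false ] ⊤⁺) (λ { _ _ () }) 1#)) (cong (_, 1#) (+-identityˡ 1#))

    factors-equals : ∀ {d} (f : Vec (Bool ⁺) d) →
      factors avoidsEquals? f ↭ replicate (dim f) fullₒ ++ replicate (codim f) halfₒ
    factors-equals []             = ↭.refl
    factors-equals (⊤⁺    ∷ᵥ f) rewrite equals-⊤ = prep fullₒ (factors-equals f)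
    factors-equals ([ b ] ∷ᵥ f) rewrite equals-[] b =
      ↭.trans (prep halfₒ (factors-equals f)) (↭.↭-sym (shift halfₒ (replicate (dim f) fullₒ) _))

    factors-differs : ∀ {d} (f : Vec (Bool ⁺) d) →
      factors avoidsDiffers? f ↭ replicate (codim f) halfₒ ++ replicate (dim f) shiftₒ
    factors-differs []             = ↭.refl
    factors-differs (⊤⁺    ∷ᵥ f) rewrite differs-⊤ =
      ↭.trans (prep shiftₒ (factors-differs f)) (↭.↭-sym (shift shiftₒ (replicate (codim f) halfₒ) _))
    factors-differs ([ b ] ∷ᵥ f) rewrite differs-[] b = prep halfₒ (factors-differs f)

  ∑-avoids-equals : ∀ {d} (f : Vec (Bool ⁺) d) → codim f ≢ 0 →
    ∑ (cubeFaces d) (λ u → when (Pointwise.decidable (avoids? equals?) f u) (tops (dim u))) ≡ p (dim f) (codim f)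
  ∑-avoids-equals f c≢0 = trans (∑-cubeFaces avoidsEquals? f tops)
    (trans (apply-↭ (factors-equals f) tops 0)
      (sym (trans (cong (_+ apply (replicate (dim f) fullₒ ++ replicate (codim f) halfₒ) tops 0) (1[≢0] (codim f) c≢0))
        (+-identityˡ _))))
    where
    1[≢0] : ∀ k → k ≢ 0 → 1[ k ≡0] ≡ 0#
    1[≢0] zero    k≢0 = contradiction refl k≢0
    1[≢0] (suc k) _   = refl

  ∑-avoids-differs : ∀ {d} (f : Vec (Bool ⁺) d) →
    ∑ (cubeFaces d) (λ u → when (Pointwise.decidable (avoids? differs?) f u) (tops (dim u))) ≡ q (codim f) (dim f)
  ∑-avoids-differs f = trans (∑-cubeFaces avoidsDiffers? f tops) (apply-↭ (factors-differs f) tops 0)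

-- Cubical facets and stable pieces

≤-lookup : ∀ {d} {u v : Vec (Bool ⁺) d} i {b} → u ≤ᶜ v → lookup v i ≡ [ b ] → lookup u i ≡ [ b ]
≤-lookup zero    ([ refl ] ∷ _) refl = refl
≤-lookup (suc i) (_ ∷ ps)       eq   = ≤-lookup i ps eq

cubeFacet : ∀ {d} → Fin d → Bool → Vec (Bool ⁺) d
cubeFacet i b = top [ i ]≔ [ b ]

lookup-cubeFacet : ∀ {d} (i : Fin d) b → lookup (cubeFacet i b) i ≡ [ b ]
lookup-cubeFacet i b = Vec.lookup∘update i top [ b ]

≤-cubeFacet : ∀ {d} {u : Vec (Bool ⁺) d} i {b} → lookup u i ≡ [ b ] → u ≤ᶜ cubeFacet i b
≤-cubeFacet {u = _ ∷ᵥ u} zero    refl = [ refl ] ∷ ≤-top u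
≤-cubeFacet {u = a ∷ᵥ u} (suc i) eq   = (a ≤⊤⁺) ∷ ≤-cubeFacet i eq

≢top⇒lookup : ∀ {d} (u : Vec (Bool ⁺) d) → u ≢ top → ∃ λ i → ∃ λ b → lookup u i ≡ [ b ]
≢top⇒lookup []             u≢top = contradiction refl u≢top
≢top⇒lookup (⊤⁺    ∷ᵥ u)   u≢top with ≢top⇒lookup u (u≢top ∘ cong (⊤⁺ ∷ᵥ_))
... | i , b , eq = suc i , b , eq
≢top⇒lookup ([ b ] ∷ᵥ u)   u≢top = zero , b , refl

lookup-top : ∀ {d} (i : Fin d) {b : Bool} → lookup top i ≢ [ b ]
lookup-top zero    ()
lookup-top (suc i) eq = lookup-top i eq

cubeFacet≢top : ∀ {d} (i : Fin d) {b} → cubeFacet i b ≢ top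
cubeFacet≢top i {b} eq = lookup-top i (trans (cong (λ v → lookup v i) (sym eq)) (lookup-cubeFacet i b))

cubeFacet-coatom : ∀ {d} i {b} (w : Vec (Bool ⁺) d) → cubeFacet i b ≤ᶜ w → w ≢ top → w ≡ cubeFacet i b
cubeFacet-coatom i {b} w f≤w w≢top with ≢top⇒lookup w w≢top
... | j , c , eq with i Fin.≟ j
...   | yes refl = ≤ᶜ-antisym (≤-cubeFacet i (trans eq
                     (trans (sym (≤-lookup i f≤w eq)) (lookup-cubeFacet i b)))) f≤w
...   | no i≢j   = contradiction
                     (trans (sym (Vec.lookup∘update′ (i≢j ∘ sym) top [ b ])) (≤-lookup j f≤w eq)) (lookup-top j)

codim≡0⇒top : ∀ {d} (v : Vec (Bool ⁺) d) → codim v ≡ 0 → v ≡ top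
codim≡0⇒top []             _  = refl
codim≡0⇒top (⊤⁺    ∷ᵥ v)   eq = cong (⊤⁺ ∷ᵥ_) (codim≡0⇒top v eq)

module _ {d : ℕ} where
  open AddInfimum (_≤ᶜ_ {d}) public using (_≤₋_; ⊥₋≤_; [_])

module CubicalFacet (C : PolytopalComplex) (F : PolytopalComplex.Face C) (d : ℕ)
  (iso : PolytopalComplex.↓ C F ≅ cube d) where

  open PolytopalComplex C
  private
    module ≤ = IsPartialOrder isPartialOrder
    module iso = IsOrderIsomorphism (_≅_.isOrderIsomorphism iso)

  to : Poset.Carrier (↓ F) → (Vec (Bool ⁺) d) ₋
  to = _≅_.to iso

  preimage : (Vec (Bool ⁺) d) ₋ → Poset.Carrier (↓ F)
  preimage c = proj₁ (iso.surjective c)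

  to-preimage : ∀ c → to (preimage c) ≡ c
  to-preimage c = proj₂ (iso.surjective c) refl

  from : (Vec (Bool ⁺) d) ₋ → Face
  from c = proj₁ (preimage c)

  from≤F : ∀ c → from c ≤ F
  from≤F c = proj₂ (preimage c)

  from-mono : ∀ {b c} → b ≤₋ c → from b ≤ from c
  from-mono {b} {c} b≤c = iso.cancel (subst (_≤₋ to (preimage c)) (sym (to-preimage b))
    (subst (b ≤₋_) (sym (to-preimage c)) b≤c))

  from-cancel : ∀ {b c} → from b ≤ from c → b ≤₋ c
  from-cancel {b} {c} b≤c = subst (_≤₋ c) (to-preimage b)
    (subst (to (preimage b) ≤₋_) (to-preimage c) (iso.mono b≤c))

  from-injective : ∀ {b c} → from b ≡ from c → b ≡ c
  from-injective {b} {c} eq = trans (sym (to-preimage b)) (trans (iso.cong eq) (to-preimage c))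

  from-surjective : ∀ {G} → G ≤ F → ∃ λ c → G ≡ from c
  from-surjective {G} G≤F = to (G , G≤F) , sym (iso.injective (to-preimage (to (G , G≤F))))

  from-⊥₋ : from ⊥₋ ≡ ∅
  from-⊥₋ with from-surjective (∅-minimum F)
  ... | c , ∅≡ = ≤.antisym (subst (from ⊥₋ ≤_) (sym ∅≡) (from-mono (⊥₋≤ c))) (∅-minimum _)

  from-[]≢∅ : ∀ v → from [ v ] ≢ ∅
  from-[]≢∅ v eq with from-injective (trans eq (sym from-⊥₋))
  ... | ()

  module FacetSums {A : Set} {plus times : Op₂ A} {0# 1# : A}
    (isCommutativeSemiring : IsCommutativeSemiring _≡_ plus times 0# 1#) (y : A) where

    open FiniteSums isCommutativeSemiring
    open CommutativeSemiring commutativeSemiring using (_+_; _*_; +-identityˡ)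
    open CubePolynomials isCommutativeSemiring y
    open CubeSums isCommutativeSemiring y
    open ChainPolynomial isCommutativeSemiring C y

    ∑-facet : ∀ h → ∑ (allFin size) (λ G → when (G ≤? F) (h G)) ≡
                    h ∅ + ∑ (cubeFaces d) (λ v → h (from [ v ]))
    ∑-facet h = begin
      ∑ (allFin size) (λ G → when (G ≤? F) (h G))
        ≡⟨ ∑-reindex (Unique.allFin⁺ size) unique from from-injective (_≤? F)
             (λ _ G≤F → let c , eq = from-surjective G≤F in c , ∈-faces c , eq)
             (λ {c} _ → ∈-allFin (from c) , from≤F c) h ⟩
      ∑ (⊥₋ ∷ map [_] (cubeFaces d)) (h ∘ from)
        ≡⟨ ∑-∷ ⊥₋ _ _ ⟩
      h (from ⊥₋) + ∑ (map [_] (cubeFaces d)) (h ∘ from)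
        ≡⟨ cong₂ _+_ (cong h from-⊥₋) (∑-map [_] (cubeFaces d) (h ∘ from)) ⟩
      h ∅ + ∑ (cubeFaces d) (λ v → h (from [ v ])) ∎
      where
      open ≡-Reasoning
      ∈-faces : ∀ c → c ∈ₗ (⊥₋ ∷ map [_] (cubeFaces d))
      ∈-faces ⊥₋    = here refl
      ∈-faces [ v ] = there (∈-map⁺ [_] (∈-cubeFaces v))
      unique : Unique (⊥₋ ∷ map [_] (cubeFaces d))
      unique = All.tabulate (λ c∈ eq → bad (∈-map⁻ [_] c∈) eq) ∷ Unique.map⁺ []-injective (cubeFaces-unique d)
        where
        bad : ∀ {c : (Vec (Bool ⁺) d) ₋} → ∃ (λ v → v ∈ₗ cubeFaces d × c ≡ [ v ]) → ⊥₋ ≢ c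
        bad (v , _ , refl) ()

    chainsWithMax-cubeFace : ∀ v → chainsWithMax (from [ v ]) ≡ tops (dim v)
    chainsWithMax-cubeFace v = go v (<-wellFounded (dim v))
      where
      go : ∀ v → Acc ℕ._<_ (dim v) → chainsWithMax (from [ v ]) ≡ tops (dim v)
      go v (acc rs) = begin
        chainsWithMax (from [ v ])
          ≡⟨ chainsWithMax-≢∅ (from-[]≢∅ v) ⟩
        y * ∑ (allFin size) (λ G → when (below? (from [ v ]) G) (chainsWithMax G))
          ≡⟨ cong (y *_) (∑-cong (allFin size) (λ G → trans
               (when-⇔ (below? (from [ v ]) G) ((G ≤? F) ×-dec below? (from [ v ]) G)
                 (λ b → ≤.trans (proj₁ b) (from≤F [ v ]) , b) proj₂ (λ _ → refl))
               (when-× (G ≤? F) (below? (from [ v ]) G) _))) ⟩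
        y * ∑ (allFin size) (λ G → when (G ≤? F) (when (below? (from [ v ]) G) (chainsWithMax G)))
          ≡⟨ cong (y *_) (∑-facet _) ⟩
        y * (when (below? (from [ v ]) ∅) (chainsWithMax ∅) +
             ∑ (cubeFaces d) (λ u → when (below? (from [ v ]) (from [ u ])) (chainsWithMax (from [ u ]))))
          ≡⟨ cong (y *_) (cong₂ _+_
               (trans (when-yes (below? (from [ v ]) ∅) (∅-minimum _ , from-[]≢∅ v ∘ sym) _) chainsWithMax-∅)
               (∑-cong (cubeFaces d) (λ u → pointwise u (u ≟ᶜ v)))) ⟩
        y * (1# + ∑ (cubeFaces d) (λ u → when (Pointwise.decidable above? v u) (topsBelow (dim v) (dim u))))
          ≡⟨ cong (λ s → y * (1# + s)) (∑-cubeFaces-≤ v (topsBelow (dim v))) ⟩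
        tops (dim v) ∎
        where
        open ≡-Reasoning
        pointwise : ∀ u → Dec (u ≡ v) → when (below? (from [ v ]) (from [ u ])) (chainsWithMax (from [ u ])) ≡
                    when (Pointwise.decidable above? v u) (topsBelow (dim v) (dim u))
        -- `topsBelow (dim v)` vanishes from `dim v` on, which drops the face `v` itself from the
        -- sum over all faces below `v`.
        pointwise u (yes refl) = trans (when-no (below? (from [ v ]) (from [ v ])) (λ b → proj₂ b refl) _)
          (sym (trans (cong (when (Pointwise.decidable above? v v)) (topsBelow-≥ {dim v} ℕ.≤-refl))
            (when-0 (Pointwise.decidable above? v v))))
        pointwise u (no u≢v) = when-⇔ (below? (from [ v ]) (from [ u ])) (Pointwise.decidable above? v u)
          (λ (u≤v , _) → ≥⇒above (AddInfimum.[≤]-injective _≤ᶜ_ (from-cancel u≤v)))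
          (λ v≥u → from-mono [ above⇒≥ v≥u ] , λ eq → u≢v ([]-injective (from-injective eq)))
          (λ (u≤v , _) → let u<v = dim-mono-< (AddInfimum.[≤]-injective _≤ᶜ_ (from-cancel u≤v)) u≢v in
            trans (go u (rs u<v)) (sym (topsBelow-< u<v)))

    piece-cube : ∀ earlier → piece earlier F ≡
      when (¬? (𝒞? C earlier ∅)) 1# +
      ∑ (cubeFaces d) (λ u → when (¬? (𝒞? C earlier (from [ u ]))) (tops (dim u)))
    piece-cube earlier = begin
      piece earlier F
        ≡⟨ ∑-cong (allFin size) (λ G → when-× (G ≤? F) (¬? (𝒞? C earlier G)) _) ⟩
      ∑ (allFin size) (λ G → when (G ≤? F) (when (¬? (𝒞? C earlier G)) (chainsWithMax G)))
        ≡⟨ ∑-facet _ ⟩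
      when (¬? (𝒞? C earlier ∅)) (chainsWithMax ∅) +
      ∑ (cubeFaces d) (λ u → when (¬? (𝒞? C earlier (from [ u ]))) (chainsWithMax (from [ u ])))
        ≡⟨ cong₂ _+_ (cong (when (¬? (𝒞? C earlier ∅))) chainsWithMax-∅)
             (∑-cong (cubeFaces d) λ u → cong (when (¬? (𝒞? C earlier (from [ u ])))) (chainsWithMax-cubeFace u)) ⟩
      when (¬? (𝒞? C earlier ∅)) 1# +
      ∑ (cubeFaces d) (λ u → when (¬? (𝒞? C earlier (from [ u ]))) (tops (dim u))) ∎
      where open ≡-Reasoning

    piece-first : piece [] F ≡ p d 0
    piece-first = begin
      piece [] F
        ≡⟨ piece-cube [] ⟩
      when (¬? (𝒞? C [] ∅)) 1# + ∑ (cubeFaces d) (λ u → when (¬? (𝒞? C [] (from [ u ]))) (tops (dim u)))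
        ≡⟨ cong₂ _+_ (when-yes (¬? (𝒞? C [] ∅)) (λ ()) 1#) (∑-cong (cubeFaces d) λ u →
             when-⇔ (¬? (𝒞? C [] (from [ u ]))) (Pointwise.decidable above? top u)
               (λ _ → ≥⇒above (≤-top u)) (λ _ ()) (λ _ → refl)) ⟩
      1# + ∑ (cubeFaces d) (λ u → when (Pointwise.decidable above? top u) (tops (dim u)))
        ≡⟨ cong (1# +_) (∑-cubeFaces-≤ {d} top tops) ⟩
      1# + apply (replicate (dim (top {d})) fullₒ) tops 0
        ≡⟨ cong (λ n → 1# + apply (replicate n fullₒ) tops 0) (dim-top d) ⟩
      1# + apply (replicate d fullₒ) tops 0
        ≡⟨ cong (1# +_) (apply-++-[] (replicate d fullₒ) tops 0) ⟨
      p d 0 ∎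
      where open ≡-Reasoning

    piece-hits : ∀ {earlier Q} (Q? : Decidable₂ Q) f → 𝒞 earlier ∅ →
      (∀ u → 𝒞 earlier (from [ u ]) ⇔ Hits Q f u) →
      piece earlier F ≡ ∑ (cubeFaces d) (λ u → when (Pointwise.decidable (avoids? Q?) f u) (tops (dim u)))
    piece-hits {earlier} Q? f ∅∈ hits = trans (piece-cube earlier)
      (trans (cong₂ _+_ (when-no (¬? (𝒞? C earlier ∅)) (λ ∅∉ → ∅∉ ∅∈) 1#) (∑-cong (cubeFaces d) λ u →
        when-⇔ (¬? (𝒞? C earlier (from [ u ]))) (Pointwise.decidable (avoids? Q?) f u)
          (λ ¬r → ¬hits⇒avoids f u (¬r ∘ Equivalence.from (hits u)))
          (λ a → avoids⇒¬hits a ∘ Equivalence.to (hits u)) (λ _ → refl)))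
      (+-identityˡ _))

  -- The first alternative removes the facets containing `f`, the second those not containing `f`.
  -- Removing all facets is the second alternative with `f = top`; it arises from the empty face in
  -- `reciprocal₁` and from the whole polytope in `reciprocal₂`. Only nonempty faces are described,
  -- since for `d = 0` the sole facet is the empty face, which no pair (i , b) names.
  StableRemoval : List Face → Set
  StableRemoval earlier = ∃ λ f →
    (codim f ≢ 0 × (∀ u → 𝒞 earlier (from [ u ]) ⇔ Hits Equals f u)) ⊎
    (∀ u → 𝒞 earlier (from [ u ]) ⇔ Hits Differs f u)

  module _ (P : Polytope) (α : ↓ F ≅ Polytope.poset P) where
    private
      module P = Polytope P
      module ≤ₚ = IsPartialOrder P.isPartialOrder
      module α = IsOrderIsomorphism (_≅_.isOrderIsomorphism α)
      module L = IsBoundedLattice P.isBoundedLattice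

    image : (Vec (Bool ⁺) d) ₋ → P.Face
    image c = _≅_.to α (preimage c)

    image-mono : ∀ {b c} → b ≤₋ c → image b P.≤ image c
    image-mono b≤c = α.mono (from-mono b≤c)

    image-cancel : ∀ {b c} → image b P.≤ image c → b ≤₋ c
    image-cancel b≤c = from-cancel (α.cancel b≤c)

    image-injective : ∀ {b c} → image b ≡ image c → b ≡ c
    image-injective eq = from-injective (α.injective eq)

    image-surjective : ∀ H → ∃ λ c → H ≡ image c
    image-surjective H with α.surjective H
    ... | (G , G≤F) , α-G with from-surjective G≤F
    ...   | c , G≡ = c , sym (α-G (sym G≡))

    image-top : image [ top ] ≡ P.⊤
    image-top with image-surjective P.⊤
    ... | ⊥₋    , eq = ≤ₚ.antisym (L.maximum _) (subst (P._≤ image [ top ]) (sym eq) (image-mono (⊥₋≤ [ top ])))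
    ... | [ v ] , eq = ≤ₚ.antisym (L.maximum _) (subst (P._≤ image [ top ]) (sym eq) (image-mono [ ≤-top v ]))

    image-cubeFacet-⋖ : ∀ i b → image [ cubeFacet i b ] P.⋖ P.⊤
    image-cubeFacet-⋖ i b =
      (L.maximum _ , λ eq → cubeFacet≢top i ([]-injective (image-injective (trans eq (sym image-top))))) ,
      between
      where
      between : ∀ H → ¬ P.Between (image [ cubeFacet i b ]) P.⊤ H
      between H ((f≤H , f≢H) , (_ , H≢⊤)) with image-surjective H
      ... | ⊥₋    , refl with image-cancel f≤H
      ...   | ()
      between H ((f≤H , f≢H) , (_ , H≢⊤)) | [ w ] , refl = f≢H (cong (image ∘ [_])
        (sym (cubeFacet-coatom i w (AddInfimum.[≤]-injective _≤ᶜ_ (image-cancel f≤H)) λ { refl → H≢⊤ image-top })))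

    -- The face `u` below `H` rules out that `H` is the empty face, which is covered by the top when
    -- `d = 0`. Any other `H` has a fixed coordinate, lies in the corresponding cube facet, and
    -- equals it because nothing fits between `H` and the top.
    ⋖⇒cubeFacet : ∀ {H} u → H P.⋖ P.⊤ → image [ u ] P.≤ H →
                  ∃ λ i → ∃ λ b → H ≡ image [ cubeFacet i b ]
    ⋖⇒cubeFacet {H} u ((_ , H≢⊤) , ¬between) u≤H with image-surjective H
    ... | ⊥₋    , refl with image-cancel u≤H
    ...   | ()
    ⋖⇒cubeFacet {H} u ((_ , H≢⊤) , ¬between) u≤H | [ w ] , refl
      with ≢top⇒lookup w (λ { refl → H≢⊤ image-top })
    ... | i , b , eq with w ≟ᶜ cubeFacet i b
    ...   | yes w≡ = i , b , cong (image ∘ [_]) w≡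
    ...   | no w≢  = contradiction
      ((image-mono [ ≤-cubeFacet i eq ] , w≢ ∘ []-injective ∘ image-injective) , proj₁ (image-cubeFacet-⋖ i b))
      (¬between (image [ cubeFacet i b ]))

    ≤-image-cubeFacet : ∀ {u i b} → image [ u ] P.≤ image [ cubeFacet i b ] ⇔ lookup u i ≡ [ b ]
    ≤-image-cubeFacet {u} {i} {b} = mk⇔
      (λ u≤ → ≤-lookup i (AddInfimum.[≤]-injective _≤ᶜ_ (image-cancel u≤)) (lookup-cubeFacet i b))
      (λ eq → image-mono [ ≤-cubeFacet i eq ])

    reciprocal-hits : ∀ {Q} {S : Pred P.Face 0ℓ} f →
      (∀ i b → S (image [ cubeFacet i b ]) ⇔ Q (lookup f i) b) → ∀ u →
      (∃ λ H → H P.⋖ P.⊤ × S H × image [ u ] P.≤ H) ⇔ Hits Q f u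
    reciprocal-hits {Q} {S} f S⇔Q u = mk⇔ to-hits from-hits
      where
      to-hits : (∃ λ H → H P.⋖ P.⊤ × S H × image [ u ] P.≤ H) → Hits Q f u
      to-hits (H , H⋖⊤ , SH , u≤H) with ⋖⇒cubeFacet u H⋖⊤ u≤H
      ... | i , b , refl = i , b , Equivalence.to (S⇔Q i b) SH , Equivalence.to ≤-image-cubeFacet u≤H
      from-hits : Hits Q f u → ∃ λ H → H P.⋖ P.⊤ × S H × image [ u ] P.≤ H
      from-hits (i , b , q , eq) = image [ cubeFacet i b ] , image-cubeFacet-⋖ i b ,
        Equivalence.from (S⇔Q i b) q , Equivalence.from ≤-image-cubeFacet eq

  module _ {earlier : List Face} (∅∈ : 𝒞 earlier ∅) (P : Polytope) (α : ↓ F ≅ Polytope.poset P) where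
    private
      module P = Polytope P

    reciprocal₁⇒removal : ∀ F₀ → (∀ G → 𝒞 earlier (proj₁ G) ⇔ RelativeComplex.Removed (reciprocal₁ P F₀) (_≅_.to α G)) →
                          ∀ c → F₀ ≡ image P α c → StableRemoval earlier
    reciprocal₁⇒removal _ removed [ f ] refl = f , inj₁ ((λ codim≡0 → ≢⊤ (codim≡0⇒top f codim≡0)) ,
      λ u → reciprocal-hits P α {Equals} f (λ i b → ≤-image-cubeFacet P α) u ⇔-∘ removed (preimage [ u ]))
      where
      module ≤ₚ = IsPartialOrder P.isPartialOrder
      module L = IsBoundedLattice P.isBoundedLattice
      -- No facet contains the whole polytope, so nothing would be removed, whereas `∅` is.
      ≢⊤ : f ≢ top
      ≢⊤ refl with Equivalence.to (removed (preimage ⊥₋)) (subst (𝒞 earlier) (sym from-⊥₋) ∅∈)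
      ... | H , ((_ , H≢⊤) , _) , ⊤≤H , _ = H≢⊤ (≤ₚ.antisym (L.maximum H) (subst (P._≤ H) (image-top P α) ⊤≤H))
    -- The empty face lies in every facet, so all of them are removed; `top` differs from every
    -- `[ b ]` in each coordinate.
    reciprocal₁⇒removal _ removed ⊥₋ refl = top , inj₂
      (λ u → reciprocal-hits P α {Differs} top (λ i b → mk⇔ (λ _ eq → lookup-top i eq)
        (λ _ → image-mono P α (⊥₋≤ [ cubeFacet i b ]))) u ⇔-∘ removed (preimage [ u ]))

    reciprocal₂⇒removal : ∀ F₀ → (∀ G → 𝒞 earlier (proj₁ G) ⇔ RelativeComplex.Removed (reciprocal₂ P F₀) (_≅_.to α G)) →
                          ∀ c → F₀ ≡ image P α c → StableRemoval earlier
    reciprocal₂⇒removal _ removed [ f ] refl = f , inj₂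
      (λ u → reciprocal-hits P α {Differs} f (λ i b → mk⇔
        (λ ≰ eq → ≰ (Equivalence.from (≤-image-cubeFacet P α) eq))
        (λ ≢ ≤f → ≢ (Equivalence.to (≤-image-cubeFacet P α) ≤f))) u ⇔-∘ removed (preimage [ u ]))
    -- Every facet contains the empty face, so nothing would be removed, whereas `∅` is.
    reciprocal₂⇒removal _ removed ⊥₋ refl
      with Equivalence.to (removed (preimage ⊥₋)) (subst (𝒞 earlier) (sym from-⊥₋) ∅∈)
    ... | H , _ , ⊥≰H , ⊥≤H = contradiction ⊥≤H ⊥≰H

  stable⇒removal : ∀ {earlier} → 𝒞 earlier ∅ →
    PieceIsStable C earlier F → StableRemoval earlier
  stable⇒removal ∅∈ (P , F₀ , inj₁ r) = let c , eq = image-surjective P (_≅ᵣ_.iso r) F₀ in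
    reciprocal₁⇒removal ∅∈ P (_≅ᵣ_.iso r) F₀ (_≅ᵣ_.removed r) c eq
  stable⇒removal ∅∈ (P , F₀ , inj₂ r) = let c , eq = image-surjective P (_≅ᵣ_.iso r) F₀ in
    reciprocal₂⇒removal ∅∈ P (_≅ᵣ_.iso r) F₀ (_≅ᵣ_.removed r) c eq

-- Decomposition along the shelling

IsVertex : ∀ {d} → Vec (Bool ⁺) d → Set
IsVertex v = ∀ u → u ≤ᶜ v → u ≡ v

dim≡0⇒vertex : ∀ {d} (v : Vec (Bool ⁺) d) → dim v ≡ 0 → IsVertex v
dim≡0⇒vertex []           _  [] [] = refl
dim≡0⇒vertex ([ b ] ∷ᵥ v) eq (_ ∷ᵥ u) ([ refl ] ∷ u≤v) = cong ([ b ] ∷ᵥ_) (dim≡0⇒vertex v eq u u≤v)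

record Covers {d} (u v : Vec (Bool ⁺) d) : Set where
  field
    ≤-cover : u ≤ᶜ v
    ≢-cover : u ≢ v
    between : ∀ w → u ≤ᶜ w → w ≤ᶜ v → w ≡ u ⊎ w ≡ v

open Covers

covered : ∀ {d} (v : Vec (Bool ⁺) d) {n} → dim v ≡ suc n → ∃ λ u → dim u ≡ n × Covers u v
covered (⊤⁺ ∷ᵥ v) eq = [ true ] ∷ᵥ v , ℕ.suc-injective eq , record
  { ≤-cover = (_ ≤⊤⁺) ∷ ≤ᶜ-refl
  ; ≢-cover = λ ()
  ; between = λ where
      (_ ∷ᵥ w) ([ refl ]     ∷ v≤w) (_ ∷ w≤v) → inj₁ (cong ([ true ] ∷ᵥ_) (≤ᶜ-antisym w≤v v≤w))
      (_ ∷ᵥ w) ((_ ≤⊤⁺) ∷ v≤w) (_ ∷ w≤v) → inj₂ (cong (⊤⁺ ∷ᵥ_) (≤ᶜ-antisym w≤v v≤w))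
  }
covered ([ b ] ∷ᵥ v) eq with covered v eq
... | u , dim-u , cov = [ b ] ∷ᵥ u , dim-u , record
  { ≤-cover = [ refl ] ∷ ≤-cover cov
  ; ≢-cover = λ { refl → ≢-cover cov refl }
  ; between = λ { (_ ∷ᵥ w) ([ refl ] ∷ u≤w) ([ refl ] ∷ w≤v) → lift (between cov w u≤w w≤v) }
  }
  where
  lift : ∀ {w} → w ≡ u ⊎ w ≡ v → [ b ] ∷ᵥ w ≡ [ b ] ∷ᵥ u ⊎ [ b ] ∷ᵥ w ≡ [ b ] ∷ᵥ v
  lift (inj₁ refl) = inj₁ refl
  lift (inj₂ refl) = inj₂ refl

module _ (C : PolytopalComplex) {F : PolytopalComplex.Face C} {d : ℕ}
  (iso : PolytopalComplex.↓ C F ≅ cube d) where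

  open PolytopalComplex C
  open CubicalFacet C F d iso
  private
    module ≤ = IsPartialOrder isPartialOrder
    module F = IsPolytope (isPolytope F)
    module L = IsBoundedLattice F.isBoundedLattice

  rank-preimage-⊥₋ : F.rank (preimage ⊥₋) ≡ 0
  rank-preimage-⊥₋ = trans (F.rank-cong (≤.antisym
    (subst (_≤ proj₁ F.⊥) (sym from-⊥₋) (∅-minimum _)) (L.minimum (preimage ⊥₋)))) F.rank-⊥

  -- The rank function of `isPolytope F` is abstract and determined only by its value at the bottom
  -- and its growth along coverings. The induction climbs from the empty face to a vertex and then
  -- frees one coordinate at a time.
  rank-preimage : ∀ n v → dim v ≡ n → F.rank (preimage [ v ]) ≡ suc n
  rank-preimage zero    v eq = trans
    (F.rank-⋖ ((from-mono (⊥₋≤ [ v ]) , λ e → ⊥≢ (from-injective e)) , between₀))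
    (cong suc rank-preimage-⊥₋)
    where
    ⊥≢ : ⊥₋ ≢ [ v ]
    ⊥≢ ()
    between₀ : ∀ H → ¬ F.Between (preimage ⊥₋) (preimage [ v ]) H
    between₀ (G , G≤F) ((_ , ⊥≢G) , (G≤v , G≢v)) with from-surjective G≤F
    ... | ⊥₋    , refl = ⊥≢G refl
    ... | [ w ] , refl = G≢v (cong (from ∘ [_])
      (dim≡0⇒vertex v eq w (AddInfimum.[≤]-injective _≤ᶜ_ (from-cancel G≤v))))
  rank-preimage (suc n) v eq with covered v eq
  ... | u , dim-u , cov = trans
    (F.rank-⋖ ((from-mono [ ≤-cover cov ] , λ e → ≢-cover cov ([]-injective (from-injective e))) , between₁))
    (cong suc (rank-preimage n u dim-u))
    where
    between₁ : ∀ H → ¬ F.Between (preimage [ u ]) (preimage [ v ]) H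
    between₁ (G , G≤F) ((u≤G , u≢G) , (G≤v , G≢v)) with from-surjective G≤F
    ... | ⊥₋    , refl with from-cancel u≤G
    ...   | ()
    between₁ (G , G≤F) ((u≤G , u≢G) , (G≤v , G≢v)) | [ w ] , refl
      with between cov w (AddInfimum.[≤]-injective _≤ᶜ_ (from-cancel u≤G))
                         (AddInfimum.[≤]-injective _≤ᶜ_ (from-cancel G≤v))
    ... | inj₁ refl = u≢G refl
    ... | inj₂ refl = G≢v refl

  from-top : from [ top ] ≡ F
  from-top with from-surjective (≤.refl {F})
  ... | ⊥₋    , eq = ≤.antisym (from≤F _) (subst (_≤ from [ top ]) (sym eq) (from-mono (⊥₋≤ [ top ])))
  ... | [ v ] , eq = ≤.antisym (from≤F _) (subst (_≤ from [ top ]) (sym eq) (from-mono [ ≤-top v ]))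

  -- Purity bounds facets by rank, while cubicality gives each facet a cube dimension of its own.
  -- This equation makes all facets cubes of the same dimension, so that one family serves all
  -- pieces.
  rank-cubicalFacet : rank F ≡ suc d
  rank-cubicalFacet = trans (F.rank-cong (≤.antisym
    (subst (proj₁ F.⊤ ≤_) (sym from-top) (proj₂ F.⊤)) (L.maximum (preimage [ top ]))))
    (rank-preimage d top (dim-top d))

module ShellingDecomposition {A : Set} {plus times : Op₂ A} {0# 1# : A}
  (isCommutativeSemiring : IsCommutativeSemiring _≡_ plus times 0# 1#) (y : A)
  (C : PolytopalComplex) (cubical : IsCubical C) where

  open FiniteSums isCommutativeSemiring
  open CommutativeSemiring commutativeSemiring using (_+_)
  open CubePolynomials isCommutativeSemiring y
  open CubeSums isCommutativeSemiring y
  open ChainPolynomial isCommutativeSemiring C y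
  open PolytopalComplex C

  private
    module ≤ = IsPartialOrder isPartialOrder

  pieces : List Face → List Face → List A
  pieces earlier []          = []
  pieces earlier (F ∷ later) = piece earlier F ∷ pieces (earlier ++ F ∷ []) later

  -- Every member is counted at the first facet containing it. The induction moves `F` from `later`
  -- to `earlier` and splits the members according to whether they lie in `F`.
  ∑-pieces : ∀ earlier later →
    ∑ (allFin size) (λ G → when (¬? (𝒞? C earlier G) ×-dec 𝒞? C later G) (chainsWithMax G)) ≡
    ∑ (pieces earlier later) (λ x → x)
  ∑-pieces earlier [] = trans
    (∑-zero′ (allFin size) λ G → when-no (¬? (𝒞? C earlier G) ×-dec 𝒞? C [] G) (λ ()) _) (sym (∑-[] _))
  ∑-pieces earlier (F ∷ later) = begin
    ∑ (allFin size) (λ G → when (d G) (chainsWithMax G))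
      ≡⟨ ∑-cong (allFin size) (λ G → trans (when-split (G ≤? F) _) (cong₂ _+_
           (trans (sym (when-× (G ≤? F) (d G) _)) (when-⇔ ((G ≤? F) ×-dec d G) ((G ≤? F) ×-dec ¬? (𝒞? C earlier G))
             (λ (≤F , ∉e , _) → ≤F , ∉e) (λ (≤F , ∉e) → ≤F , ∉e , here ≤F) (λ _ → refl)))
           (trans (sym (when-× (¬? (G ≤? F)) (d G) _)) (when-⇔ (¬? (G ≤? F) ×-dec d G)
             (¬? (𝒞? C (earlier ++ F ∷ []) G) ×-dec 𝒞? C later G) fwd bwd (λ _ → refl))))) ⟩
    ∑ (allFin size) (λ G → when ((G ≤? F) ×-dec ¬? (𝒞? C earlier G)) (chainsWithMax G) +
                           when (¬? (𝒞? C (earlier ++ F ∷ []) G) ×-dec 𝒞? C later G) (chainsWithMax G))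
      ≡⟨ ∑-+ (allFin size) _ _ ⟩
    piece earlier F +
      ∑ (allFin size) (λ G → when (¬? (𝒞? C (earlier ++ F ∷ []) G) ×-dec 𝒞? C later G) (chainsWithMax G))
      ≡⟨ cong (piece earlier F +_) (∑-pieces (earlier ++ F ∷ []) later) ⟩
    piece earlier F + ∑ (pieces (earlier ++ F ∷ []) later) (λ x → x)
      ≡⟨ ∑-∷ _ _ _ ⟨
    ∑ (pieces earlier (F ∷ later)) (λ x → x) ∎
    where
    open ≡-Reasoning
    d : ∀ G → Dec (¬ 𝒞 earlier G × 𝒞 (F ∷ later) G)
    d G = ¬? (𝒞? C earlier G) ×-dec 𝒞? C (F ∷ later) G
    fwd : ∀ {G} → ¬ G ≤ F × ¬ 𝒞 earlier G × 𝒞 (F ∷ later) G → ¬ 𝒞 (earlier ++ F ∷ []) G × 𝒞 later G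
    fwd (≰F , ∉e , here ≤F)  = contradiction ≤F ≰F
    fwd (≰F , ∉e , there ∈l) = (λ ∈eF → bad (Any.++⁻ earlier ∈eF)) , ∈l
      where
      bad : ¬ (𝒞 earlier _ ⊎ 𝒞 (F ∷ []) _)
      bad (inj₁ ∈e)        = ∉e ∈e
      bad (inj₂ (here ≤F)) = ≰F ≤F
    bwd : ∀ {G} → ¬ 𝒞 (earlier ++ F ∷ []) G × 𝒞 later G → ¬ G ≤ F × ¬ 𝒞 earlier G × 𝒞 (F ∷ later) G
    bwd (∉eF , ∈l) = (λ ≤F → ∉eF (Any.++⁺ʳ earlier (here ≤F))) , ∉eF ∘ Any.++⁺ˡ , there ∈l

  piece-stable : ∀ {d earlier F} → ↓ F ≅ cube d → 𝒞 earlier ∅ →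
    PieceIsStable C earlier F →
    InFamily d (piece earlier F)
  piece-stable {d} {earlier} {F} iso ∅∈ stable
    with CubicalFacet.stable⇒removal C F d iso ∅∈ stable
  ... | f , inj₁ (codim≢0 , hits) = inj₁ (dim f , codim f , dim+codim f ,
    trans (CubicalFacet.FacetSums.piece-hits C F d iso isCommutativeSemiring y equals? f ∅∈ hits)
      (∑-avoids-equals f codim≢0))
  ... | f , inj₂ hits = inj₂ (codim f , dim f , trans (ℕ.+-comm (codim f) (dim f)) (dim+codim f) ,
    trans (CubicalFacet.FacetSums.piece-hits C F d iso isCommutativeSemiring y differs? f ∅∈ hits)
      (∑-avoids-differs f))

  module _ {d Fs} (pure : PureOfDim d U) (ordering : IsFacetOrdering U Fs)
    (stable : PiecesAreStable C Fs) where

    belowFacet : ∀ G → 𝒞 Fs G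
    belowFacet G = go G (po-noetherian isPartialOrder G)
      where
      go : ∀ G → Acc _ G → 𝒞 Fs G
      go G (acc rs) with Fin.any? (λ H → (G ≤? H) ×-dec ¬? (G ≟ H))
      ... | yes (H , G≤H , G≢H) = Any.map (≤.trans G≤H) (go H (rs (G≤H , G≢H)))
      ... | no ¬∃ = lose (Equivalence.from (proj₂ ordering G) (_ , maximal)) ≤.refl
        where
        maximal : ∀ H → U H → G ≤ H → G ≡ H
        maximal H _ G≤H with G ≟ H
        ... | yes eq = eq
        ... | no G≢H = contradiction (H , G≤H , G≢H) ¬∃

    facetIso : ∀ {F} → F ∈ₗ Fs → ↓ F ≅ cube d
    facetIso {F} F∈ with Equivalence.to (proj₂ ordering F) F∈
    ... | facet with cubical F facet
    ...   | d′ , iso = subst (λ n → ↓ F ≅ cube n)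
      (ℕ.suc-injective (trans (sym (rank-cubicalFacet C iso)) (pure F facet))) iso

    piece-first : ∀ {F} → F ∈ₗ Fs → piece [] F ≡ p d 0
    piece-first {F} F∈ = CubicalFacet.FacetSums.piece-first C F d (facetIso F∈) isCommutativeSemiring y

    piece-later : ∀ E earlier F later → Fs ≡ (E ∷ earlier) ++ F ∷ later →
                  InFamily d (piece (E ∷ earlier) F)
    piece-later E earlier F later eq = piece-stable (facetIso (subst (F ∈ₗ_) (sym eq) (∈-++⁺ʳ (E ∷ earlier) (here refl))))
      (here (∅-minimum E)) (stable (E ∷ earlier) F later eq)

    pieces-family : ∀ E earlier later → Fs ≡ (E ∷ earlier) ++ later →
                    All (InFamily d) (pieces (E ∷ earlier) later)
    pieces-family E earlier []          eq = []
    pieces-family E earlier (F ∷ later) eq = piece-later E earlier F later eq ∷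
      pieces-family E (earlier ++ F ∷ []) later (trans eq (sym (++-assoc (E ∷ earlier) (F ∷ []) later)))

    ∑-allFaces-family : ∃ λ xs → ∑ (allFaces (sd C)) weight ≡ p d 0 + ∑ xs (λ x → x) ×
                                 All (InFamily d) xs
    ∑-allFaces-family = go Fs refl
      where
      open ≡-Reasoning
      total : ∑ (allFaces (sd C)) weight ≡ ∑ (pieces [] Fs) (λ x → x)
      total = begin
        ∑ (allFaces (sd C)) weight
          ≡⟨ ∑-allFaces-weight ⟩
        ∑ (allFin size) chainsWithMax
          ≡⟨ ∑-cong (allFin size) (λ G → sym (when-yes (¬? (𝒞? C [] G) ×-dec 𝒞? C Fs G) ((λ ()) , belowFacet G) _)) ⟩
        ∑ (allFin size) (λ G → when (¬? (𝒞? C [] G) ×-dec 𝒞? C Fs G) (chainsWithMax G))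
          ≡⟨ ∑-pieces [] Fs ⟩
        ∑ (pieces [] Fs) (λ x → x) ∎
      go : ∀ Gs → Fs ≡ Gs → ∃ λ xs → ∑ (allFaces (sd C)) weight ≡ p d 0 + ∑ xs (λ x → x) ×
                                     All (InFamily d) xs
      -- The member `∅` lies below some facet, so the shelling has a first facet.
      go []       eq with subst (λ Hs → 𝒞 Hs ∅) eq (belowFacet ∅)
      ... | ()
      go (F ∷ Gs) eq = pieces (F ∷ []) Gs ,
        trans total (trans (cong (λ Hs → ∑ (pieces [] Hs) (λ x → x)) eq) (trans (∑-∷ _ _ _)
          (cong₂ _+_ (piece-first (subst (F ∈ₗ_) (sym eq) (here refl))) refl)))  ,
        pieces-family F [] Gs eq

-- Spirals

-- `R u v` stands for: `v` is ahead of `u` by at most the angle from `1# + a` to `a`. As `0#` is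
-- related to everything in both directions, `R` cannot be assumed transitive; spirals are therefore
-- lists related in all pairs, not merely in adjacent ones. The conclusion of `R-rotate` compares
-- the vectors before and after the entry `v` is passed, where `u` and `w` are the sums of the
-- entries before and after it.
module Spiral {A : Set} {plus times : Op₂ A} {0# 1# : A}
  (isCommutativeSemiring : IsCommutativeSemiring _≡_ plus times 0# 1#)
  (cancelˡ : ∀ x {y z} → plus x y ≡ plus x z → y ≡ z) (a : A)
  (R : Rel A 0ℓ) (R-refl : ∀ u → R u u) (R-0ˡ : ∀ u → R 0# u) (R-0ʳ : ∀ u → R u 0#)
  (R-+ˡ : ∀ {u v w} → R u w → R v w → R (plus u v) w)
  (R-+ʳ : ∀ {u v w} → R u v → R u w → R u (plus v w))
  (R-rotate : ∀ {u v w} → R u v → R v w →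
     R (plus (times (plus 1# a) v) (plus (times a u) (times (plus 1# a) w)))
       (plus (times a v) (plus (times a u) (times (plus 1# a) w))))
  (R-base : R (plus 1# a) a) where

  open FiniteSums isCommutativeSemiring
  open CommutativeSemiring commutativeSemiring
    using (_+_; _*_; +-identityˡ; +-identityʳ; +-assoc; +-comm; distribˡ)
  open CubePolynomials isCommutativeSemiring a
  open SemiringSolver commutativeSemiring using (solve; _:=_; _:+_; _:*_; con)

  b : A
  b = 1# + a

  ∑′ : List A → A
  ∑′ xs = ∑ xs (λ x → x)

  ∑′-∷ : ∀ x xs → ∑′ (x ∷ xs) ≡ x + ∑′ xs
  ∑′-∷ x xs = ∑-∷ x xs _

  R-∑ : ∀ {u xs} → All (R u) xs → R u (∑′ xs)
  R-∑ {u} []                  = subst (R u) (sym (∑-[] _)) (R-0ʳ u)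
  R-∑ {u} {x ∷ xs} (r ∷ rs)   = subst (R u) (sym (∑′-∷ x xs)) (R-+ʳ r (R-∑ rs))

  -- With x = a / b, the vectors of winding 0# us are b times the sums of the
  -- windows of length |us| in the sequence us, x us.
  wind : A → List A → A
  wind s us = a * s + b * ∑′ us

  winding : A → List A → List A
  winding s []       = wind s [] ∷ []
  winding s (u ∷ us) = wind s (u ∷ us) ∷ winding (s + u) us

  wind-∷ : ∀ s u us → wind s (u ∷ us) ≡ wind (s + u) us + u
  wind-∷ s u us = trans (cong (λ t → a * s + b * t) (∑′-∷ u us))
    (solve 4 (λ a s u t → a :* s :+ (con 1 :+ a) :* (u :+ t) := a :* (s :+ u) :+ (con 1 :+ a) :* t :+ u)
      refl a s u (∑′ us))

  -- The vectors of `winding s us` decrease by the successive entries of `us`. Hence a list with the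
  -- same decrements is recognised as a winding by its first entry alone.
  wind-≡ : ∀ s u us {x x′} → wind s (u ∷ us) ≡ x → x ≡ x′ + u → wind (s + u) us ≡ x′
  wind-≡ s u us {x} {x′} eq x≡ = cancelˡ u (trans (+-comm u _)
    (trans (sym (wind-∷ s u us)) (trans eq (trans x≡ (+-comm x′ u)))))

  R-wind : ∀ {s v us} → R s v → All (R v) us → R (a * s + b * (v + ∑′ us)) (wind (s + v) us)
  R-wind {s} {v} {us} sv vus = subst₂ R
    (solve 4 (λ a s v t → (con 1 :+ a) :* v :+ (a :* s :+ (con 1 :+ a) :* t) := a :* s :+ (con 1 :+ a) :* (v :+ t))
      refl a s v (∑′ us))
    (solve 4 (λ a s v t → a :* v :+ (a :* s :+ (con 1 :+ a) :* t) := a :* (s :+ v) :+ (con 1 :+ a) :* t)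
      refl a s v (∑′ us))
    (R-rotate sv (R-∑ vus))

  -- For a pair of vectors that are not adjacent, the entries passed between them are merged into
  -- the single entry `v`; the relations needed for the merged entry follow by additivity of `R`.
  R-winding : ∀ {s v us} → R s v → All (R v) us → All (R s) us → AllPairs R us →
              All (R (a * s + b * (v + ∑′ us))) (winding (s + v) us)
  R-winding {us = []}     sv vus sus uus = R-wind sv vus ∷ []
  R-winding {s} {v} {u ∷ us} sv vus@(vu ∷ vus′) (su ∷ sus) (uus ∷ uus′) = R-wind sv vus ∷
    subst₂ (λ x t → All (R x) (winding t us))
      (cong (λ t → a * s + b * t) (trans (+-assoc v u _) (cong (v +_) (sym (∑′-∷ u us)))))
      (sym (+-assoc s v u))
      (R-winding (R-+ʳ sv su) (All.zipWith (λ (r , r′) → R-+ˡ r r′) (vus′ , uus)) sus uus′)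

  winding-spiral : ∀ {s us} → All (R s) us → AllPairs R us → AllPairs R (winding s us)
  winding-spiral {us = []}         _          _            = [] ∷ []
  winding-spiral {s} {u ∷ us} (su ∷ sus) (uus ∷ uus′) =
    subst (λ t → All (R (a * s + b * t)) (winding (s + u) us)) (sym (∑′-∷ u us)) (R-winding su uus sus uus′) ∷
    winding-spiral (All.zipWith (λ (r , r′) → R-+ˡ r r′) (sus , uus)) uus′

  ps qs : ℕ → ℕ → List A
  ps zero    k = p 0 k ∷ []
  ps (suc i) k = p (suc i) k ∷ ps i (suc k)
  qs zero    k = q 0 k ∷ []
  qs (suc i) k = q (suc i) k ∷ qs i (suc k)

  family : ℕ → List A
  family d = ps d 0 ++ qs d 0

  -- Telescoping of `p-step` along i + k constant, down to the last member.
  ∑-ps : ∀ i k → p (suc i) k ≡ p 0 (suc (i ℕ.+ k)) + ∑′ (ps i k)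
  ∑-ps zero    k = trans (p-step 0 k) (cong (p 0 (suc k) +_)
    (sym (trans (∑′-∷ (p 0 k) []) (trans (cong (p 0 k +_) (∑-[] _)) (+-identityʳ _)))))
  ∑-ps (suc i) k = begin
    p (suc (suc i)) k
      ≡⟨ p-step (suc i) k ⟩
    p (suc i) (suc k) + p (suc i) k
      ≡⟨ cong (_+ p (suc i) k) (∑-ps i (suc k)) ⟩
    p 0 (suc (i ℕ.+ suc k)) + ∑′ (ps i (suc k)) + p (suc i) k
      ≡⟨ trans (+-assoc _ _ _) (cong₂ _+_ (cong (p 0 ∘ suc) (ℕ.+-suc i k)) (+-comm _ _)) ⟩
    p 0 (suc (suc i ℕ.+ k)) + (p (suc i) k + ∑′ (ps i (suc k)))
      ≡⟨ cong (p 0 (suc (suc i ℕ.+ k)) +_) (∑′-∷ _ _) ⟨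
    p 0 (suc (suc i ℕ.+ k)) + ∑′ (ps (suc i) k) ∎
    where open ≡-Reasoning

  ∑-qs : ∀ i k → q (suc i) k ≡ q 0 (suc (i ℕ.+ k)) + ∑′ (qs i k)
  ∑-qs zero    k = trans (q-step 0 k) (cong (q 0 (suc k) +_)
    (sym (trans (∑′-∷ (q 0 k) []) (trans (cong (q 0 k +_) (∑-[] _)) (+-identityʳ _)))))
  ∑-qs (suc i) k = begin
    q (suc (suc i)) k
      ≡⟨ q-step (suc i) k ⟩
    q (suc i) (suc k) + q (suc i) k
      ≡⟨ cong (_+ q (suc i) k) (∑-qs i (suc k)) ⟩
    q 0 (suc (i ℕ.+ suc k)) + ∑′ (qs i (suc k)) + q (suc i) k
      ≡⟨ trans (+-assoc _ _ _) (cong₂ _+_ (cong (q 0 ∘ suc) (ℕ.+-suc i k)) (+-comm _ _)) ⟩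
    q 0 (suc (suc i ℕ.+ k)) + (q (suc i) k + ∑′ (qs i (suc k)))
      ≡⟨ cong (q 0 (suc (suc i ℕ.+ k)) +_) (∑′-∷ _ _) ⟨
    q 0 (suc (suc i ℕ.+ k)) + ∑′ (qs (suc i) k) ∎
    where open ≡-Reasoning

  -- Summing the steps gives p (suc d) 0 = ∑ + q 0 (suc d), and the two ends
  -- are related by b * q 0 (suc d) = a * p (suc d) 0.
  p≡b*∑ : ∀ d → p (suc d) 0 ≡ b * ∑′ (family d)
  p≡b*∑ d = cancelˡ (a * p (suc d) 0) (begin
    a * p (suc d) 0 + p (suc d) 0
      ≡⟨ solve 2 (λ a x → a :* x :+ x := (con 1 :+ a) :* x) refl a (p (suc d) 0) ⟩
    b * p (suc d) 0
      ≡⟨ cong (b *_) (trans (∑-ps d 0) (cong (_+ ∑′ (ps d 0))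
           (trans (cong (p 0 ∘ suc) (ℕ.+-identityʳ d)) (trans (p-q d) (∑-qs d 0))))) ⟩
    b * (q 0 (suc (d ℕ.+ 0)) + ∑′ (qs d 0) + ∑′ (ps d 0))
      ≡⟨ cong (b *_) (trans (+-assoc _ _ _) (cong (q 0 (suc (d ℕ.+ 0)) +_)
           (trans (+-comm _ _) (sym (∑-++ (ps d 0) (qs d 0) _))))) ⟩
    b * (q 0 (suc (d ℕ.+ 0)) + ∑′ (family d))
      ≡⟨ distribˡ b _ _ ⟩
    b * q 0 (suc (d ℕ.+ 0)) + b * ∑′ (family d)
      ≡⟨ cong (_+ b * ∑′ (family d)) (trans (p-q-wrap (suc (d ℕ.+ 0)))
           (cong (λ n → a * p (suc n) 0) (ℕ.+-identityʳ d))) ⟩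
    a * p (suc d) 0 + b * ∑′ (family d) ∎)
    where open ≡-Reasoning

  winding-qs : ∀ i k s → wind s (qs i k) ≡ q (suc i) k → winding s (qs i k) ≡ qs (suc i) k
  winding-qs zero    k s eq = cong₂ (λ x y → x ∷ y ∷ []) eq (wind-≡ s (q 0 k) [] eq (q-step 0 k))
  winding-qs (suc i) k s eq = cong₂ _∷_ eq
    (winding-qs i (suc k) (s + q (suc i) k) (wind-≡ s (q (suc i) k) (qs i (suc k)) eq (q-step (suc i) k)))

  winding-ps : ∀ i k s → wind s (ps i k ++ 0# ∷ qs (i ℕ.+ k) 0) ≡ p (suc i) k →
    winding s (ps i k ++ 0# ∷ qs (i ℕ.+ k) 0) ≡ ps (suc i) k ++ qs (suc (i ℕ.+ k)) 0
  winding-ps zero k s eq = cong₂ _∷_ eq (cong₂ _∷_ eq₁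
    (winding-qs k 0 (s + p 0 k + 0#) (wind-≡ (s + p 0 k) 0# (qs k 0) eq₁ (trans (p-q k) (sym (+-identityʳ _))))))
    where
    eq₁ : wind (s + p 0 k) (0# ∷ qs k 0) ≡ p 0 (suc k)
    eq₁ = wind-≡ s (p 0 k) (0# ∷ qs k 0) eq (p-step 0 k)
  winding-ps (suc i) k s eq = cong₂ _∷_ eq
    (subst (λ n → winding (s + p (suc i) k) (ps i (suc k) ++ 0# ∷ qs n 0) ≡ ps (suc i) (suc k) ++ qs (suc n) 0)
      (ℕ.+-suc i k)
      (winding-ps i (suc k) (s + p (suc i) k)
        (subst (λ n → wind (s + p (suc i) k) (ps i (suc k) ++ 0# ∷ qs n 0) ≡ p (suc i) (suc k)) (sym (ℕ.+-suc i k))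
          (wind-≡ s (p (suc i) k) (ps i (suc k) ++ 0# ∷ qs (suc i ℕ.+ k) 0) eq (p-step (suc i) k)))))

  ∑-insert-0 : ∀ xs ys → ∑′ (xs ++ 0# ∷ ys) ≡ ∑′ (xs ++ ys)
  ∑-insert-0 xs ys = trans (∑-++ xs (0# ∷ ys) _) (trans
    (cong (∑′ xs +_) (trans (∑′-∷ 0# ys) (+-identityˡ _))) (sym (∑-++ xs ys _)))

  AllPairs-insert-0 : ∀ xs {ys} → AllPairs R (xs ++ ys) → AllPairs R (xs ++ 0# ∷ ys)
  AllPairs-insert-0 []       rs       = All.universal R-0ˡ _ ∷ rs
  AllPairs-insert-0 (x ∷ xs) (r ∷ rs) =
    All.++⁺ (All.++⁻ˡ xs r) (R-0ʳ x ∷ All.++⁻ʳ xs r) ∷ AllPairs-insert-0 xs rs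

  -- p 0 (suc d) = q (suc d) 0 occurs twice in family (suc d); the step between
  -- the two copies is the inserted 0#.
  family-winding : ∀ d → winding 0# (ps d 0 ++ 0# ∷ qs d 0) ≡ family (suc d)
  family-winding d = subst
    (λ n → winding 0# (ps d 0 ++ 0# ∷ qs n 0) ≡ ps (suc d) 0 ++ qs (suc n) 0) (ℕ.+-identityʳ d)
    (winding-ps d 0 0# (subst (λ n → wind 0# (ps d 0 ++ 0# ∷ qs n 0) ≡ p (suc d) 0) (sym (ℕ.+-identityʳ d)) start))
    where
    start : wind 0# (ps d 0 ++ 0# ∷ qs d 0) ≡ p (suc d) 0
    start = trans (cong (λ t → a * 0# + b * t) (∑-insert-0 (ps d 0) (qs d 0)))
      (trans (solve 2 (λ a x → a :* con 0 :+ x := x) refl a (b * ∑′ (family d))) (sym (p≡b*∑ d)))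

  family-spiral : ∀ d → AllPairs R (family d)
  family-spiral zero    = (subst₂ R (sym p-00) (sym q-00) R-base ∷ []) ∷ [] ∷ []
  family-spiral (suc d) = subst (AllPairs R) (family-winding d)
    (winding-spiral (All.universal R-0ˡ _) (AllPairs-insert-0 (ps d 0) (family-spiral d)))

  ∈-ps : ∀ j k l → p j (l ℕ.+ k) ∈ₗ ps (l ℕ.+ j) k
  ∈-ps zero    k zero    = here refl
  ∈-ps (suc j) k zero    = here refl
  ∈-ps j       k (suc l) = there (subst (λ n → p j n ∈ₗ ps (l ℕ.+ j) (suc k)) (ℕ.+-suc l k) (∈-ps j (suc k) l))

  ∈-qs : ∀ j k l → q j (l ℕ.+ k) ∈ₗ qs (l ℕ.+ j) k
  ∈-qs zero    k zero    = here refl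
  ∈-qs (suc j) k zero    = here refl
  ∈-qs j       k (suc l) = there (subst (λ n → q j n ∈ₗ qs (l ℕ.+ j) (suc k)) (ℕ.+-suc l k) (∈-qs j (suc k) l))

  p∈family : ∀ {d} i k → i ℕ.+ k ≡ d → p i k ∈ₗ family d
  p∈family i k refl = ∈-++⁺ˡ (subst₂ (λ m n → p i m ∈ₗ ps n 0) (ℕ.+-identityʳ k) (ℕ.+-comm k i) (∈-ps i 0 k))

  q∈family : ∀ {d} i k → i ℕ.+ k ≡ d → q i k ∈ₗ family d
  q∈family i k refl = ∈-++⁺ʳ (ps (i ℕ.+ k) 0)
    (subst₂ (λ m n → q i m ∈ₗ qs n 0) (ℕ.+-identityʳ k) (ℕ.+-comm k i) (∈-qs i 0 k))

  family-∷ : ∀ d → ∃ λ us → family d ≡ p d 0 ∷ us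
  family-∷ zero    = _ , refl
  family-∷ (suc d) = _ , refl

  p-first : ∀ d → All (R (p d 0)) (family d)
  p-first d with family d | family-∷ d | family-spiral d
  ... | _ | us , refl | r ∷ _ = R-refl (p d 0) ∷ r

  -- `v` is the sum of all members of the family but the first. Splitting off the first, to which
  -- the others are ahead, is what permits a lower bound for the sum.
  p-suc : ∀ d → ∃ λ v → R (p d 0) v × p (suc d) 0 ≡ b * (p d 0 + v)
  p-suc d with family d | family-∷ d | family-spiral d | p≡b*∑ d
  ... | _ | us , refl | r ∷ _ | eq = ∑′ us , R-∑ r , trans eq (cong (b *_) (∑′-∷ (p d 0) us))

-- Evaluation of the h-polynomial

∈⇒≤-foldr-⊔ : ∀ {n ns} → n ∈ₗ ns → n ℕ.≤ foldr ℕ._⊔_ 0 ns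
∈⇒≤-foldr-⊔ {ns = m ∷ ns} (here refl) = ℕ.m≤m⊔n m _
∈⇒≤-foldr-⊔ {ns = m ∷ ns} (there n∈)  = ℕ.≤-trans (∈⇒≤-foldr-⊔ n∈) (ℕ.m≤n⊔m m _)

module Evaluation {A : Set} {plus times : Op₂ A} {0# 1# : A}
  (isCommutativeSemiring : IsCommutativeSemiring _≡_ plus times 0# 1#)
  (ι : ℤ → A) (ι-+ : ∀ m n → ι (m ℤ.+ n) ≡ plus (ι m) (ι n))
  (ι-* : ∀ m n → ι (m ℤ.* n) ≡ times (ι m) (ι n))
  (ι-0 : ι 0ℤ ≡ 0#) (ι-1 : ι 1ℤ ≡ 1#) (z : A) where

  open FiniteSums isCommutativeSemiring
  open CommutativeSemiring commutativeSemiring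
    using (_+_; _*_; +-identityˡ; +-identityʳ; *-identityʳ; +-assoc; zeroˡ; zeroʳ; *-comm)
  open SemiringSolver commutativeSemiring using (solve; _:=_; _:+_; _:*_; con)
  open Exp commutativeSemiring using (^-homo-*; ^-distrib-*) renaming (_^_ to pow)

  value : ℤ[x] → A
  value []      = 0#
  value (a ∷ f) = ι a + z * value f

  value-⊕ : ∀ f g → value (f ⊕ g) ≡ value f + value g
  value-⊕ []      g       = sym (+-identityˡ _)
  value-⊕ (a ∷ f) []      = sym (+-identityʳ _)
  value-⊕ (a ∷ f) (b ∷ g) = trans (cong₂ (λ s t → s + z * t) (ι-+ a b) (value-⊕ f g))
    (solve 5 (λ z a b s t → a :+ b :+ z :* (s :+ t) := a :+ z :* s :+ (b :+ z :* t)) refl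
      z (ι a) (ι b) (value f) (value g))

  value-scale : ∀ a g → value (map (a ℤ.*_) g) ≡ ι a * value g
  value-scale a []      = sym (zeroʳ (ι a))
  value-scale a (b ∷ g) = trans (cong₂ (λ s t → s + z * t) (ι-* a b) (value-scale a g))
    (solve 4 (λ z a b t → a :* b :+ z :* (a :* t) := a :* (b :+ z :* t)) refl z (ι a) (ι b) (value g))

  value-⊗ : ∀ f g → value (f ⊗ g) ≡ value f * value g
  value-⊗ []      g = sym (zeroˡ _)
  value-⊗ (a ∷ f) g = trans (value-⊕ (map (a ℤ.*_) g) (0ℤ ∷ f ⊗ g))
    (trans (cong₂ _+_ (value-scale a g) (cong₂ (λ s t → s + z * t) ι-0 (value-⊗ f g)))
    (solve 4 (λ z a s t → a :* t :+ (con 0 :+ z :* (s :* t)) := (a :+ z :* s) :* t) refl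
      z (ι a) (value f) (value g)))

  value-const : ∀ a → value (a ∷ []) ≡ ι a
  value-const a = trans (cong (λ t → ι a + t) (zeroʳ z)) (+-identityʳ _)

  value-^ : ∀ f k → value (f ^ k) ≡ pow (value f) k
  value-^ f zero    = trans (value-const 1ℤ) ι-1
  value-^ f (suc k) = trans (value-⊗ f (f ^ k)) (cong (value f *_) (value-^ f k))

  value-∑ : ∀ {X : Set} (h : X → ℤ[x]) xs → value (foldr _⊕_ [] (map h xs)) ≡ ∑ xs (λ x → value (h x))
  value-∑ h []       = sym (∑-[] _)
  value-∑ h (x ∷ xs) = trans (value-⊕ (h x) _) (trans (cong (λ t → value (h x) + t) (value-∑ h xs))
    (sym (∑-∷ x xs (λ x → value (h x)))))

  value-x : value (0ℤ ∷ 1ℤ ∷ []) ≡ z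
  value-x = trans (cong₂ (λ s t → s + z * t) ι-0 (trans (value-const 1ℤ) ι-1))
    (solve 1 (λ z → con 0 :+ z :* con 1 := z) refl z)

  -- A semiring has no subtraction, so 1 - z is available only as the value of a polynomial,
  -- characterised by its sum with `z`.
  value-1-x : value (1ℤ ∷ -1ℤ ∷ []) + z ≡ 1#
  value-1-x = trans (cong (λ s → ι 1ℤ + z * s + z) (value-const -1ℤ))
    (trans (solve 3 (λ z s t → s :+ z :* t :+ z := s :+ z :* (con 1 :+ t)) refl z (ι 1ℤ) (ι -1ℤ))
    (trans (cong₂ (λ s t → s + z * t) ι-1 (trans (cong (_+ ι -1ℤ) (sym ι-1)) (trans (sym (ι-+ 1ℤ -1ℤ)) ι-0)))
    (trans (cong (λ t → 1# + t) (zeroʳ z)) (+-identityʳ 1#))))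

  ι-length-filter : ∀ {X : Set} {P : Pred X 0ℓ} (P? : Decidable P) xs →
                    ι (ℤ.+ length (filter P? xs)) ≡ ∑ xs (λ x → when (P? x) 1#)
  ι-length-filter P? xs = trans (ι-length (filter P? xs)) (∑-filter P? xs (λ _ → 1#))
    where
    ι-length : ∀ {X : Set} (xs : List X) → ι (ℤ.+ length xs) ≡ ∑ xs (λ _ → 1#)
    ι-length []       = trans ι-0 (sym (∑-[] _))
    ι-length (x ∷ xs) = trans (ι-+ 1ℤ (ℤ.+ length xs)) (trans (cong₂ _+_ ι-1 (ι-length xs)) (sym (∑-∷ x xs _)))

  module _ {n} (K : SimplicialComplex n) {y : A} where

    private
      m : ℕ
      m = rankₛ K
      1-z : A
      1-z = value (1ℤ ∷ -1ℤ ∷ [])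

    ∑-faceCount : ∑ (upTo (suc m)) (λ k → ι (ℤ.+ faceCount K k) * pow y k) ≡ ∑ (allFaces K) (λ S → pow y ∣ S ∣)
    ∑-faceCount = begin
      ∑ (upTo (suc m)) (λ k → ι (ℤ.+ faceCount K k) * pow y k)
        ≡⟨ ∑-cong (upTo (suc m)) (λ k → trans (cong (_* pow y k) (ι-length-filter (λ S → ∣ S ∣ ℕ.≟ k) (allFaces K)))
             (trans (*-comm _ _) (trans (sym (∑-* (allFaces K) (pow y k) _))
             (∑-cong (allFaces K) λ S → trans (when-* (∣ S ∣ ℕ.≟ k) _ _)
               (cong (when (∣ S ∣ ℕ.≟ k)) (*-identityʳ (pow y k))))))) ⟩
      ∑ (upTo (suc m)) (λ k → ∑ (allFaces K) (λ S → when (∣ S ∣ ℕ.≟ k) (pow y k)))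
        ≡⟨ ∑-swap (upTo (suc m)) (allFaces K) _ ⟩
      ∑ (allFaces K) (λ S → ∑ (upTo (suc m)) (λ k → when (∣ S ∣ ℕ.≟ k) (pow y k)))
        ≡⟨ ∑-cong-∈ (allFaces K) (λ S S∈ → ∑-δ ℕ._≟_ (Unique.upTo⁺ (suc m))
             (∈-upTo⁺ (ℕ.s≤s (∈⇒≤-foldr-⊔ (∈-map⁺ ∣_∣ S∈)))) (pow y)) ⟩
      ∑ (allFaces K) (λ S → pow y ∣ S ∣) ∎
      where open ≡-Reasoning

    -- The hypothesis is y = z / (1 - z) without the division; it turns z^k (1 - z)^(m - k) into (1
    -- - z)^m y^k.
    value-hPolynomial : z ≡ y * 1-z →
      value (hPolynomial K) ≡ pow 1-z m * ∑ (allFaces K) (λ S → pow y ∣ S ∣)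
    value-hPolynomial z≡ = begin
      value (hPolynomial K)
        ≡⟨ value-∑ term (upTo (suc m)) ⟩
      ∑ (upTo (suc m)) (λ k → value (term k))
        ≡⟨ ∑-cong-∈ (upTo (suc m)) (λ k k∈ → value-term k (upTo-≤ k∈)) ⟩
      ∑ (upTo (suc m)) (λ k → pow 1-z m * (ι (ℤ.+ faceCount K k) * pow y k))
        ≡⟨ ∑-* (upTo (suc m)) (pow 1-z m) _ ⟩
      pow 1-z m * ∑ (upTo (suc m)) (λ k → ι (ℤ.+ faceCount K k) * pow y k)
        ≡⟨ cong (pow 1-z m *_) ∑-faceCount ⟩
      pow 1-z m * ∑ (allFaces K) (λ S → pow y ∣ S ∣) ∎
      where
      open ≡-Reasoning
      term : ℕ → ℤ[x]
      term k = (ℤ.+ faceCount K k ∷ []) ⊗ (0ℤ ∷ 1ℤ ∷ []) ^ k ⊗ (1ℤ ∷ -1ℤ ∷ []) ^ (m ∸ k)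
      upTo-≤ : ∀ {k} → k ∈ₗ upTo (suc m) → k ℕ.≤ m
      upTo-≤ k∈ = ℕ.s≤s⁻¹ (∈-upTo⁻ k∈)
      value-term : ∀ k → k ℕ.≤ m → value (term k) ≡ pow 1-z m * (ι (ℤ.+ faceCount K k) * pow y k)
      value-term k k≤m = begin
        value (term k)
          ≡⟨ trans (value-⊗ ((ℤ.+ faceCount K k ∷ []) ⊗ (0ℤ ∷ 1ℤ ∷ []) ^ k) ((1ℤ ∷ -1ℤ ∷ []) ^ (m ∸ k)))
               (cong₂ _*_ (trans (value-⊗ (ℤ.+ faceCount K k ∷ []) ((0ℤ ∷ 1ℤ ∷ []) ^ k))
                 (cong₂ _*_ (value-const _) (trans (value-^ (0ℤ ∷ 1ℤ ∷ []) k) (cong (λ t → pow t k) (trans value-x z≡)))))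
               (value-^ (1ℤ ∷ -1ℤ ∷ []) (m ∸ k))) ⟩
        ι (ℤ.+ faceCount K k) * pow (y * 1-z) k * pow 1-z (m ∸ k)
          ≡⟨ cong (λ t → ι (ℤ.+ faceCount K k) * t * pow 1-z (m ∸ k)) (^-distrib-* y 1-z k) ⟩
        ι (ℤ.+ faceCount K k) * (pow y k * pow 1-z k) * pow 1-z (m ∸ k)
          ≡⟨ solve 4 (λ c s t u → c :* (s :* t) :* u := t :* u :* (c :* s)) refl
               (ι (ℤ.+ faceCount K k)) (pow y k) (pow 1-z k) (pow 1-z (m ∸ k)) ⟩
        pow 1-z k * pow 1-z (m ∸ k) * (ι (ℤ.+ faceCount K k) * pow y k)
          ≡⟨ cong (_* (ι (ℤ.+ faceCount K k) * pow y k)) (trans (sym (^-homo-* 1-z k (m ∸ k)))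
               (cong (pow 1-z) (ℕ.m+[n∸m]≡n k≤m))) ⟩
        pow 1-z m * (ι (ℤ.+ faceCount K k) * pow y k) ∎

-- Gaussian rationals

open ℚSolver.+-*-Solver using (solve; _:=_; _:+_; _:*_; _:-_; :-_; con)

record ℚ[i] : Set where
  constructor _+𝐢_
  field
    re im : ℚ

open ℚ[i]

infixl 6 _+ᵍ_
infixl 7 _*ᵍ_

-- The formulas repeat those of `_+ᶜ_` and `_*ᶜ_` literally, so that the terms of a product of
-- Cauchy complex numbers are by computation the products of the terms.
_+ᵍ_ _*ᵍ_ : ℚ[i] → ℚ[i] → ℚ[i]
(a +𝐢 b) +ᵍ (c +𝐢 d) = (a ℚ.+ c) +𝐢 (b ℚ.+ d)
(a +𝐢 b) *ᵍ (c +𝐢 d) = (a ℚ.* c ℚ.+ ℚ.- (b ℚ.* d)) +𝐢 (a ℚ.* d ℚ.+ b ℚ.* c)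

0ᵍ 1ᵍ : ℚ[i]
0ᵍ = 0ℚ +𝐢 0ℚ
1ᵍ = 1ℚ +𝐢 0ℚ

+ᵍ-*ᵍ-isCommutativeSemiring : IsCommutativeSemiring _≡_ _+ᵍ_ _*ᵍ_ 0ᵍ 1ᵍ
+ᵍ-*ᵍ-isCommutativeSemiring = isCommutativeSemiringˡ record
  { +-isCommutativeMonoid = record
    { isMonoid = record
      { isSemigroup = record
        { isMagma = record { isEquivalence = isEquivalence ; ∙-cong = cong₂ _+ᵍ_ }
        ; assoc   = λ x y z → cong₂ _+𝐢_ (ℚ.+-assoc (re x) (re y) (re z)) (ℚ.+-assoc (im x) (im y) (im z))
        }
      ; identity = (λ x → cong₂ _+𝐢_ (ℚ.+-identityˡ (re x)) (ℚ.+-identityˡ (im x))) ,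
                   (λ x → cong₂ _+𝐢_ (ℚ.+-identityʳ (re x)) (ℚ.+-identityʳ (im x)))
      }
    ; comm = λ x y → cong₂ _+𝐢_ (ℚ.+-comm (re x) (re y)) (ℚ.+-comm (im x) (im y))
    }
  ; *-isCommutativeMonoid = record
    { isMonoid = record
      { isSemigroup = record
        { isMagma = record { isEquivalence = isEquivalence ; ∙-cong = cong₂ _*ᵍ_ }
        ; assoc   = λ (a +𝐢 b) (c +𝐢 d) (e +𝐢 f) → cong₂ _+𝐢_
          (solve 6 (λ a b c d e f → (a :* c :+ :- (b :* d)) :* e :+ :- ((a :* d :+ b :* c) :* f) :=
            a :* (c :* e :+ :- (d :* f)) :+ :- (b :* (c :* f :+ d :* e))) refl a b c d e f)
          (solve 6 (λ a b c d e f → (a :* c :+ :- (b :* d)) :* f :+ (a :* d :+ b :* c) :* e :=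
            a :* (c :* f :+ d :* e) :+ b :* (c :* e :+ :- (d :* f))) refl a b c d e f)
        }
      ; identity = (λ (a +𝐢 b) → cong₂ _+𝐢_
          (solve 2 (λ a b → con 1ℚ :* a :+ :- (con 0ℚ :* b) := a) refl a b)
          (solve 2 (λ a b → con 1ℚ :* b :+ con 0ℚ :* a := b) refl a b)) ,
        (λ (a +𝐢 b) → cong₂ _+𝐢_
          (solve 2 (λ a b → a :* con 1ℚ :+ :- (b :* con 0ℚ) := a) refl a b)
          (solve 2 (λ a b → a :* con 0ℚ :+ b :* con 1ℚ := b) refl a b))
      }
    ; comm = λ (a +𝐢 b) (c +𝐢 d) → cong₂ _+𝐢_
        (solve 4 (λ a b c d → a :* c :+ :- (b :* d) := c :* a :+ :- (d :* b)) refl a b c d)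
        (solve 4 (λ a b c d → a :* d :+ b :* c := c :* b :+ d :* a) refl a b c d)
    }
  ; distribʳ = λ (e +𝐢 f) (a +𝐢 b) (c +𝐢 d) → cong₂ _+𝐢_
      (solve 6 (λ a b c d e f → (a :+ c) :* e :+ :- ((b :+ d) :* f) :=
        (a :* e :+ :- (b :* f)) :+ (c :* e :+ :- (d :* f))) refl a b c d e f)
      (solve 6 (λ a b c d e f → (a :+ c) :* f :+ (b :+ d) :* e :=
        (a :* f :+ b :* e) :+ (c :* f :+ d :* e)) refl a b c d e f)
  ; zeroˡ = λ (a +𝐢 b) → cong₂ _+𝐢_
      (solve 2 (λ a b → con 0ℚ :* a :+ :- (con 0ℚ :* b) := con 0ℚ) refl a b)
      (solve 2 (λ a b → con 0ℚ :* b :+ con 0ℚ :* a := con 0ℚ) refl a b)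
  }

+ᵍ-cancelˡ : ∀ x {y z} → x +ᵍ y ≡ x +ᵍ z → y ≡ z
+ᵍ-cancelˡ (a +𝐢 b) {c +𝐢 d} {e +𝐢 f} eq = cong₂ _+𝐢_
  (∙-cancelˡ a c e (cong re eq)) (∙-cancelˡ b d f (cong im eq))
  where open GroupProperties ℚ.+-0-group using (∙-cancelˡ)

norm : ℚ[i] → ℚ
norm (a +𝐢 b) = a ℚ.* a ℚ.+ b ℚ.* b

-- The imaginary part of the conjugate of the first argument times the second; its sign tells on
-- which side of the first vector the second one lies.
cross : ℚ[i] → ℚ[i] → ℚ
cross (a +𝐢 b) (c +𝐢 d) = a ℚ.* d ℚ.- b ℚ.* c

norm-* : ∀ u v → norm (u *ᵍ v) ≡ norm u ℚ.* norm v
norm-* (a +𝐢 b) (c +𝐢 d) = solve 4 (λ a b c d →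
  (a :* c :+ :- (b :* d)) :* (a :* c :+ :- (b :* d)) :+ (a :* d :+ b :* c) :* (a :* d :+ b :* c) :=
  (a :* a :+ b :* b) :* (c :* c :+ d :* d)) refl a b c d

cross-+ˡ : ∀ u v w → cross (u +ᵍ v) w ≡ cross u w ℚ.+ cross v w
cross-+ˡ (a +𝐢 b) (c +𝐢 d) (e +𝐢 f) = solve 6 (λ a b c d e f →
  (a :+ c) :* f :- (b :+ d) :* e := (a :* f :- b :* e) :+ (c :* f :- d :* e)) refl a b c d e f

cross-+ʳ : ∀ u v w → cross u (v +ᵍ w) ≡ cross u v ℚ.+ cross u w
cross-+ʳ (a +𝐢 b) (c +𝐢 d) (e +𝐢 f) = solve 6 (λ a b c d e f →
  a :* (d :+ f) :- b :* (c :+ e) := (a :* d :- b :* c) :+ (a :* f :- b :* e)) refl a b c d e f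

cross-* : ∀ c u v → cross (c *ᵍ u) (c *ᵍ v) ≡ norm c ℚ.* cross u v
cross-* (e +𝐢 f) (a +𝐢 b) (c +𝐢 d) = solve 6 (λ a b c d e f →
  (e :* a :+ :- (f :* b)) :* (e :* d :+ f :* c) :- (e :* b :+ f :* a) :* (e :* c :+ :- (f :* d)) :=
  (e :* e :+ f :* f) :* (a :* d :- b :* c)) refl a b c d e f

cross-refl : ∀ u → cross u u ≡ 0ℚ
cross-refl (a +𝐢 b) = solve 2 (λ a b → a :* b :- b :* a := con 0ℚ) refl a b

cross-0ˡ : ∀ u → cross 0ᵍ u ≡ 0ℚ
cross-0ˡ (a +𝐢 b) = solve 2 (λ a b → con 0ℚ :* b :- con 0ℚ :* a := con 0ℚ) refl a b

cross-0ʳ : ∀ u → cross u 0ᵍ ≡ 0ℚ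
cross-0ʳ (a +𝐢 b) = solve 2 (λ a b → a :* con 0ℚ :- b :* con 0ℚ := con 0ℚ) refl a b

cross-shift : ∀ u v w → cross (u +ᵍ w) (v +ᵍ w) ≡ cross u v ℚ.+ cross u w ℚ.+ cross w v
cross-shift (a +𝐢 b) (c +𝐢 d) (e +𝐢 f) = solve 6 (λ a b c d e f →
  (a :+ e) :* (d :+ f) :- (b :+ f) :* (c :+ e) :=
  (a :* d :- b :* c) :+ (a :* f :- b :* e) :+ (e :* d :- f :* c)) refl a b c d e f

-- Lagrange's identity: the difference of the two sides is the square of the inner product.
cross²≤norms : ∀ u v → cross u v ℚ.* cross u v ℚ.≤ norm u ℚ.* norm v

*-nonNeg : ∀ {p q} → 0ℚ ℚ.≤ p → 0ℚ ℚ.≤ q → 0ℚ ℚ.≤ p ℚ.* q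
*-nonNeg {p} {q} 0≤p 0≤q = ℚ.nonNegative⁻¹ (p ℚ.* q) {{ℚ.nonNeg*nonNeg⇒nonNeg p {{ℚ.nonNegative 0≤p}} q {{ℚ.nonNegative 0≤q}}}}

+-nonNeg : ∀ {p q} → 0ℚ ℚ.≤ p → 0ℚ ℚ.≤ q → 0ℚ ℚ.≤ p ℚ.+ q
+-nonNeg 0≤p 0≤q = ℚ.+-mono-≤ 0≤p 0≤q

*-mono-≤-nonNeg : ∀ {p q r s} → 0ℚ ℚ.≤ p → 0ℚ ℚ.≤ s → p ℚ.≤ q → r ℚ.≤ s → p ℚ.* r ℚ.≤ q ℚ.* s
*-mono-≤-nonNeg {p} {q} {r} {s} 0≤p 0≤s p≤q r≤s = ℚ.≤-trans
  (ℚ.*-monoˡ-≤-nonNeg p {{ℚ.nonNegative 0≤p}} r≤s) (ℚ.*-monoʳ-≤-nonNeg s {{ℚ.nonNegative 0≤s}} p≤q)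

square-nonNeg : ∀ p → 0ℚ ℚ.≤ p ℚ.* p
square-nonNeg p with ℚ.≤-total 0ℚ p
... | inj₁ 0≤p = *-nonNeg 0≤p 0≤p
... | inj₂ p≤0 = subst (0ℚ ℚ.≤_) (solve 1 (λ p → :- p :* :- p := p :* p) refl p)
  (*-nonNeg (ℚ.neg-antimono-≤ p≤0) (ℚ.neg-antimono-≤ p≤0))

norm-nonNeg : ∀ u → 0ℚ ℚ.≤ norm u
norm-nonNeg (a +𝐢 b) = +-nonNeg (square-nonNeg a) (square-nonNeg b)

p≤p+q : ∀ {p q} → 0ℚ ℚ.≤ q → p ℚ.≤ p ℚ.+ q
p≤p+q {p} {q} 0≤q = subst (ℚ._≤ p ℚ.+ q) (ℚ.+-identityʳ p) (ℚ.+-monoʳ-≤ p 0≤q)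

cross²≤norms (a +𝐢 b) (c +𝐢 d) = subst (cross (a +𝐢 b) (c +𝐢 d) ℚ.* cross (a +𝐢 b) (c +𝐢 d) ℚ.≤_)
  (solve 4 (λ a b c d →
    (a :* d :- b :* c) :* (a :* d :- b :* c) :+ (a :* c :+ b :* d) :* (a :* c :+ b :* d) :=
    (a :* a :+ b :* b) :* (c :* c :+ d :* d)) refl a b c d)
  (p≤p+q (square-nonNeg (a ℚ.* c ℚ.+ b ℚ.* d)))

-- Turning of vectors in the plane

module Turning (y : ℚ[i]) where

  τ : ℚ
  τ = im y

  b : ℚ[i]
  b = 1ᵍ +ᵍ y

  -- Since `cross b y` equals `τ`, the factor `τ` makes the direction from 1 + y to y the positive
  -- one in both half planes; for real `y` every turn is zero.
  turn : ℚ[i] → ℚ[i] → ℚ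
  turn u v = τ ℚ.* cross u v

  -- v is reached from u by turning, in the direction from 1 + y to y, through
  -- an angle not exceeding the angle between 1 + y and y.
  Ahead : ℚ[i] → ℚ[i] → Set
  Ahead u v = 0ℚ ℚ.≤ turn u v × 0ℚ ℚ.≤ turn (b *ᵍ v) (y *ᵍ u)

  private
    turn-≡ : ∀ {u v x} → cross u v ≡ x → 0ℚ ℚ.≤ τ ℚ.* x → 0ℚ ℚ.≤ turn u v
    turn-≡ eq = subst (λ x → 0ℚ ℚ.≤ τ ℚ.* x) (sym eq)

    turn-+ : ∀ {p q} → 0ℚ ℚ.≤ τ ℚ.* p → 0ℚ ℚ.≤ τ ℚ.* q → 0ℚ ℚ.≤ τ ℚ.* (p ℚ.+ q)
    turn-+ {p} {q} 0≤p 0≤q = subst (0ℚ ℚ.≤_) (sym (ℚ.*-distribˡ-+ τ p q)) (+-nonNeg 0≤p 0≤q)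

    turn-0 : 0ℚ ℚ.≤ τ ℚ.* 0ℚ
    turn-0 = ℚ.≤-reflexive (sym (ℚ.*-zeroʳ τ))

    *ᵍ-distribˡ : ∀ u v w → u *ᵍ (v +ᵍ w) ≡ u *ᵍ v +ᵍ u *ᵍ w
    *ᵍ-distribˡ = IsCommutativeSemiring.distribˡ +ᵍ-*ᵍ-isCommutativeSemiring

    *ᵍ-zeroʳ : ∀ u → u *ᵍ 0ᵍ ≡ 0ᵍ
    *ᵍ-zeroʳ = IsCommutativeSemiring.zeroʳ +ᵍ-*ᵍ-isCommutativeSemiring

    *ᵍ-assoc : ∀ u v w → (u *ᵍ v) *ᵍ w ≡ u *ᵍ (v *ᵍ w)
    *ᵍ-assoc = IsCommutativeSemiring.*-assoc +ᵍ-*ᵍ-isCommutativeSemiring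

    *ᵍ-comm : ∀ u v → u *ᵍ v ≡ v *ᵍ u
    *ᵍ-comm = IsCommutativeSemiring.*-comm +ᵍ-*ᵍ-isCommutativeSemiring

  turn-+ˡ : ∀ {u v w} → 0ℚ ℚ.≤ turn u w → 0ℚ ℚ.≤ turn v w → 0ℚ ℚ.≤ turn (u +ᵍ v) w
  turn-+ˡ {u} {v} {w} p q = turn-≡ {u +ᵍ v} {w} (cross-+ˡ u v w) (turn-+ p q)

  turn-+ʳ : ∀ {u v w} → 0ℚ ℚ.≤ turn u v → 0ℚ ℚ.≤ turn u w → 0ℚ ℚ.≤ turn u (v +ᵍ w)
  turn-+ʳ {u} {v} {w} p q = turn-≡ {u} {v +ᵍ w} (cross-+ʳ u v w) (turn-+ p q)

  turn-* : ∀ c {u v} → 0ℚ ℚ.≤ turn u v → 0ℚ ℚ.≤ turn (c *ᵍ u) (c *ᵍ v)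
  turn-* c {u} {v} 0≤ = subst (0ℚ ℚ.≤_)
    (trans (solve 3 (λ t n x → n :* (t :* x) := t :* (n :* x)) refl τ (norm c) (cross u v))
      (cong (τ ℚ.*_) (sym (cross-* c u v))))
    (*-nonNeg (norm-nonNeg c) 0≤)

  -- By `cross-*` a common factor `u` contributes `norm u`, and `cross b y` is `τ`. This square is
  -- the positive quantity from which the lower bound starts.
  turn-self : ∀ u → turn (b *ᵍ u) (y *ᵍ u) ≡ τ ℚ.* τ ℚ.* norm u
  turn-self (c +𝐢 d) = solve 4 (λ p t c d →
    t :* (((con 1ℚ :+ p) :* c :+ :- ((con 0ℚ :+ t) :* d)) :* (p :* d :+ t :* c) :-
          ((con 1ℚ :+ p) :* d :+ (con 0ℚ :+ t) :* c) :* (p :* c :+ :- (t :* d))) :=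
    t :* t :* (c :* c :+ d :* d)) refl (re y) τ c d

  turn-self-nonNeg : ∀ u → 0ℚ ℚ.≤ turn (b *ᵍ u) (y *ᵍ u)
  turn-self-nonNeg u = subst (0ℚ ℚ.≤_) (sym (turn-self u)) (*-nonNeg (square-nonNeg τ) (norm-nonNeg u))

  -- The cross product of `w` with itself vanishes, so adding to both vectors a `w` between them
  -- keeps their orientation.
  turn-shift : ∀ {u v w} → 0ℚ ℚ.≤ turn u v → 0ℚ ℚ.≤ turn u w → 0ℚ ℚ.≤ turn w v →
               0ℚ ℚ.≤ turn (u +ᵍ w) (v +ᵍ w)
  turn-shift {u} {v} {w} p q r = turn-≡ {u +ᵍ w} {v +ᵍ w} (cross-shift u v w) (turn-+ (turn-+ p q) r)

  ahead-refl : ∀ u → Ahead u u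
  ahead-refl u = turn-≡ {u} {u} (cross-refl u) turn-0 , turn-self-nonNeg u

  ahead-0ˡ : ∀ u → Ahead 0ᵍ u
  ahead-0ˡ u = turn-≡ {0ᵍ} {u} (cross-0ˡ u) turn-0 ,
    turn-≡ {b *ᵍ u} {y *ᵍ 0ᵍ} (trans (cong (cross (b *ᵍ u)) (*ᵍ-zeroʳ y)) (cross-0ʳ (b *ᵍ u))) turn-0

  ahead-0ʳ : ∀ u → Ahead u 0ᵍ
  ahead-0ʳ u = turn-≡ {u} {0ᵍ} (cross-0ʳ u) turn-0 ,
    turn-≡ {b *ᵍ 0ᵍ} {y *ᵍ u} (trans (cong (λ v → cross v (y *ᵍ u)) (*ᵍ-zeroʳ b)) (cross-0ˡ (y *ᵍ u))) turn-0

  ahead-+ˡ : ∀ {u v w} → Ahead u w → Ahead v w → Ahead (u +ᵍ v) w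
  ahead-+ˡ {u} {v} {w} (p , q) (p′ , q′) = turn-+ˡ {u} {v} {w} p p′ ,
    subst (λ x → 0ℚ ℚ.≤ turn (b *ᵍ w) x) (sym (*ᵍ-distribˡ y u v)) (turn-+ʳ {b *ᵍ w} {y *ᵍ u} {y *ᵍ v} q q′)

  ahead-+ʳ : ∀ {u v w} → Ahead u v → Ahead u w → Ahead u (v +ᵍ w)
  ahead-+ʳ {u} {v} {w} (p , q) (p′ , q′) = turn-+ʳ {u} {v} {w} p p′ ,
    subst (λ x → 0ℚ ℚ.≤ turn x (y *ᵍ u)) (sym (*ᵍ-distribˡ b v w)) (turn-+ˡ {b *ᵍ v} {b *ᵍ w} {y *ᵍ u} q q′)

  -- With x = y u + b w, both turns are instances of turn-shift: the first is
  -- turn (b v + x) (y v + x), and b (y v + x), y (b v + x) have the summand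
  -- b y v in common.
  ahead-rotate : ∀ {u v w} → Ahead u v → Ahead v w →
                 Ahead (b *ᵍ v +ᵍ (y *ᵍ u +ᵍ b *ᵍ w)) (y *ᵍ v +ᵍ (y *ᵍ u +ᵍ b *ᵍ w))
  ahead-rotate {u} {v} {w} (uv , bv-yu) (vw , bw-yv) =
    turn-shift {b *ᵍ v} {y *ᵍ v} {x} (turn-self-nonNeg v) bv-x x-yv ,
    subst₂ (λ s t → 0ℚ ℚ.≤ turn s t)
      (trans (+ᵍ-comm (b *ᵍ x) (b *ᵍ (y *ᵍ v))) (sym (*ᵍ-distribˡ b (y *ᵍ v) x)))
      (trans (cong (y *ᵍ x +ᵍ_) byv) (trans (+ᵍ-comm (y *ᵍ x) (y *ᵍ (b *ᵍ v))) (sym (*ᵍ-distribˡ y (b *ᵍ v) x))))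
      (turn-shift {b *ᵍ x} {y *ᵍ x} {b *ᵍ (y *ᵍ v)} (turn-self-nonNeg x) (turn-* b {x} {y *ᵍ v} x-yv)
        (subst (λ s → 0ℚ ℚ.≤ turn s (y *ᵍ x)) (sym byv) (turn-* y {b *ᵍ v} {x} bv-x)))
    where
    +ᵍ-comm = IsCommutativeSemiring.+-comm +ᵍ-*ᵍ-isCommutativeSemiring
    x = y *ᵍ u +ᵍ b *ᵍ w
    byv : b *ᵍ (y *ᵍ v) ≡ y *ᵍ (b *ᵍ v)
    byv = trans (sym (*ᵍ-assoc b y v)) (trans (cong (_*ᵍ v) (*ᵍ-comm b y)) (*ᵍ-assoc y b v))
    bv-x : 0ℚ ℚ.≤ turn (b *ᵍ v) x
    bv-x = turn-+ʳ {b *ᵍ v} {y *ᵍ u} {b *ᵍ w} bv-yu (turn-* b {v} {w} vw)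
    x-yv : 0ℚ ℚ.≤ turn x (y *ᵍ v)
    x-yv = turn-+ˡ {y *ᵍ u} {b *ᵍ w} {y *ᵍ v} (turn-* y {u} {v} uv) bw-yv

  ahead-base : Ahead b y
  ahead-base = subst (0ℚ ℚ.≤_) (solve 2 (λ p t → t :* t := t :* ((con 1ℚ :+ p) :* t :- (con 0ℚ :+ t) :* p)) refl (re y) τ)
    (square-nonNeg τ) ,
    turn-≡ {b *ᵍ y} {y *ᵍ b} (trans (cong (cross (b *ᵍ y)) (*ᵍ-comm y b)) (cross-refl (b *ᵍ y))) turn-0

  -- τ²|u|² is at most X = turn (b (u + v)) (y u), and X² ≤ τ²|b (u + v)|²|y u|²
  -- by the Cauchy–Schwarz inequality.
  norm-ahead : ∀ {u v} → Ahead u v → τ ℚ.* τ ℚ.* norm u ℚ.≤ norm (u +ᵍ v) ℚ.* (norm b ℚ.* norm y)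
  norm-ahead {u} {v} (_ , bv-yu) = cancel (*-nonNeg (square-nonNeg τ) (norm-nonNeg u)) n≤X X²≤nM
      (*-nonNeg (norm-nonNeg (u +ᵍ v)) (*-nonNeg (norm-nonNeg b) (norm-nonNeg y)))
    where
    X = turn (b *ᵍ (u +ᵍ v)) (y *ᵍ u)
    n = τ ℚ.* τ ℚ.* norm u
    M = norm (u +ᵍ v) ℚ.* (norm b ℚ.* norm y)
    n≤X : n ℚ.≤ X
    n≤X = subst₂ ℚ._≤_ (turn-self u)
      (trans (sym (ℚ.*-distribˡ-+ τ _ _)) (cong (τ ℚ.*_) (trans (sym (cross-+ˡ (b *ᵍ u) (b *ᵍ v) (y *ᵍ u)))
        (cong (λ s → cross s (y *ᵍ u)) (sym (*ᵍ-distribˡ b u v))))))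
      (p≤p+q {turn (b *ᵍ u) (y *ᵍ u)} bv-yu)
    X²≤nM : X ℚ.* X ℚ.≤ n ℚ.* M
    X²≤nM = subst₂ ℚ._≤_
      (solve 2 (λ t c → t :* t :* (c :* c) := t :* c :* (t :* c)) refl τ (cross (b *ᵍ (u +ᵍ v)) (y *ᵍ u)))
      (trans (cong₂ (λ s s′ → τ ℚ.* τ ℚ.* (s ℚ.* s′)) (norm-* b (u +ᵍ v)) (norm-* y u))
        (solve 5 (λ t nb ns ny nu → t :* t :* (nb :* ns :* (ny :* nu)) := t :* t :* nu :* (ns :* (nb :* ny))) refl
          τ (norm b) (norm (u +ᵍ v)) (norm y) (norm u)))
      (ℚ.*-monoˡ-≤-nonNeg (τ ℚ.* τ) {{ℚ.nonNegative (square-nonNeg τ)}} (cross²≤norms (b *ᵍ (u +ᵍ v)) (y *ᵍ u)))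
    -- From n² ≤ X² ≤ n M the factor n cancels if it is positive; otherwise 0 ≤ M is enough.
    cancel : ∀ {n X M} → 0ℚ ℚ.≤ n → n ℚ.≤ X → X ℚ.* X ℚ.≤ n ℚ.* M → 0ℚ ℚ.≤ M → n ℚ.≤ M
    cancel {n} {X} {M} 0≤n n≤X X²≤nM 0≤M with 0ℚ ℚ.<? n
    ... | yes 0<n = ℚ.*-cancelˡ-≤-pos n {{ℚ.positive 0<n}}
      (ℚ.≤-trans (*-mono-≤-nonNeg 0≤n (ℚ.≤-trans 0≤n n≤X) n≤X n≤X) X²≤nM)
    ... | no n≯0  = ℚ.≤-trans (ℚ.≮⇒≥ n≯0) 0≤M

-- Lower bounds

open Exp (CommutativeRing.commutativeSemiring ℚ.+-*-commutativeRing) using (^-homo-*) renaming (_^_ to _^ℚ_)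

^ℚ-nonNeg : ∀ {p} n → 0ℚ ℚ.≤ p → 0ℚ ℚ.≤ p ^ℚ n
^ℚ-nonNeg zero    _   = ℚ.nonNegative⁻¹ 1ℚ
^ℚ-nonNeg (suc n) 0≤p = *-nonNeg 0≤p (^ℚ-nonNeg n 0≤p)

^ℚ-mono-≤ : ∀ {p q} n → 0ℚ ℚ.≤ p → p ℚ.≤ q → p ^ℚ n ℚ.≤ q ^ℚ n
^ℚ-mono-≤ zero    _   _   = ℚ.≤-refl
^ℚ-mono-≤ (suc n) 0≤p p≤q = *-mono-≤-nonNeg 0≤p (^ℚ-nonNeg n (ℚ.≤-trans 0≤p p≤q)) p≤q (^ℚ-mono-≤ n 0≤p p≤q)

-- The numbers D, g and Nz clear the denominators of y = z / (1 - z): they are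
-- instantiated to |1 - z|², Im z and |z|².
module Bounds (y : ℚ[i]) (D Nz g : ℚ) (0≤D : 0ℚ ℚ.≤ D) (Dτ : D ℚ.* im y ≡ g)
  (D-y : D ℚ.* norm y ≡ Nz) (D-b : D ℚ.* norm (1ᵍ +ᵍ y) ≡ 1ℚ) where

  open Turning y

  G E : ℚ
  G = g ℚ.* g
  E = Nz ℚ.* D

  -- Each step of the recursion for `p` costs a factor `E`, as in `norm-step`; the square of `D`
  -- comes from the start, where D² τ² ≤ D² |b|².
  scale : ℕ → ℚ
  scale d = E ^ℚ d ℚ.* (D ℚ.* D)

  0≤Nz : 0ℚ ℚ.≤ Nz
  0≤Nz = subst (0ℚ ℚ.≤_) D-y (*-nonNeg 0≤D (norm-nonNeg y))

  0≤G : 0ℚ ℚ.≤ G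
  0≤G = square-nonNeg g

  0≤scale : ∀ d → 0ℚ ℚ.≤ scale d
  0≤scale d = *-nonNeg (^ℚ-nonNeg d (*-nonNeg 0≤Nz 0≤D)) (square-nonNeg D)

  τ²≤norm-b : τ ℚ.* τ ℚ.≤ norm b
  τ²≤norm-b = subst (τ ℚ.* τ ℚ.≤_)
    (solve 2 (λ p t → t :* t :+ (con 1ℚ :+ p) :* (con 1ℚ :+ p) :=
      (con 1ℚ :+ p) :* (con 1ℚ :+ p) :+ (con 0ℚ :+ t) :* (con 0ℚ :+ t)) refl (re y) τ)
    (p≤p+q (square-nonNeg (1ℚ ℚ.+ re y)))

  clear : ∀ {m n} → τ ℚ.* τ ℚ.* m ℚ.≤ n → G ℚ.* m ℚ.≤ (D ℚ.* D) ℚ.* n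
  clear {m} {n} le = subst (ℚ._≤ (D ℚ.* D) ℚ.* n)
    (trans (solve 3 (λ D t n → D :* D :* (t :* t :* n) := D :* t :* (D :* t) :* n) refl D τ m)
      (cong (λ x → x ℚ.* x ℚ.* m) Dτ))
    (ℚ.*-monoˡ-≤-nonNeg (D ℚ.* D) {{ℚ.nonNegative (square-nonNeg D)}} le)

  norm-sum : ∀ {u v} → Ahead u v → G ℚ.* norm u ℚ.≤ norm (u +ᵍ v) ℚ.* Nz
  norm-sum {u} {v} uv = subst (G ℚ.* norm u ℚ.≤_)
    (trans (solve 4 (λ D s b y → D :* D :* (s :* (b :* y)) := s :* (D :* y) :* (D :* b)) refl
        D (norm (u +ᵍ v)) (norm b) (norm y))
      (trans (cong₂ (λ s t → norm (u +ᵍ v) ℚ.* s ℚ.* t) D-y D-b) (ℚ.*-identityʳ _)))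
    (clear (norm-ahead {u} {v} uv))

  -- The `norm b` in the estimate of `norm-ahead` is absorbed by the factor `b` of `w`. What remains
  -- is D² |y|², which is `E`.
  norm-step : ∀ {u v w} → Ahead u v → w ≡ b *ᵍ (u +ᵍ v) → G ℚ.* norm u ℚ.≤ norm w ℚ.* E
  norm-step {u} {v} {w} uv eq = subst (G ℚ.* norm u ℚ.≤_)
    (trans (solve 4 (λ D s b y → D :* D :* (s :* (b :* y)) := b :* s :* (D :* y :* D)) refl
        D (norm (u +ᵍ v)) (norm b) (norm y))
      (cong₂ ℚ._*_ (trans (sym (norm-* b (u +ᵍ v))) (cong norm (sym eq))) (cong (ℚ._* D) D-y)))
    (clear (norm-ahead {u} {v} uv))

  norm-chain : (p : ℕ → ℚ[i]) → p 0 ≡ b → (∀ d → ∃ λ v → Ahead (p d) v × p (suc d) ≡ b *ᵍ (p d +ᵍ v)) →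
               ∀ d → G ^ℚ suc d ℚ.≤ norm (p d) ℚ.* scale d
  norm-chain p p-0 p-suc zero = subst (G ^ℚ 1 ℚ.≤_)
    (trans (solve 2 (λ D n → D :* D :* n := n :* (con 1ℚ :* (D :* D))) refl D (norm b))
      (cong (λ x → norm x ℚ.* scale 0) (sym p-0)))
    (clear (subst (ℚ._≤ norm b) (sym (ℚ.*-identityʳ (τ ℚ.* τ))) τ²≤norm-b))
  norm-chain p p-0 p-suc (suc d) with p-suc d
  ... | v , uv , eq = ℚ.≤-trans (ℚ.*-monoˡ-≤-nonNeg G {{ℚ.nonNegative 0≤G}} (norm-chain p p-0 p-suc d))
    (subst₂ ℚ._≤_ (ℚ.*-assoc G (norm (p d)) (scale d))
      (solve 4 (λ n E x D² → n :* E :* (x :* D²) := n :* (E :* x :* D²)) refl (norm (p (suc d))) E (E ^ℚ d) (D ℚ.* D))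
      (ℚ.*-monoʳ-≤-nonNeg (scale d) {{ℚ.nonNegative (0≤scale d)}} (norm-step {p d} {v} uv eq)))

  norm-chain-sum : ∀ d {u v} → G ^ℚ suc d ℚ.≤ norm u ℚ.* scale d → Ahead u v →
                   G ^ℚ suc (suc d) ℚ.≤ norm (u +ᵍ v) ℚ.* (Nz ℚ.* scale d)
  norm-chain-sum d {u} {v} le uv = ℚ.≤-trans (ℚ.*-monoˡ-≤-nonNeg G {{ℚ.nonNegative 0≤G}} le)
    (subst₂ ℚ._≤_ (ℚ.*-assoc G (norm u) (scale d)) (ℚ.*-assoc (norm (u +ᵍ v)) Nz (scale d))
      (ℚ.*-monoʳ-≤-nonNeg (scale d) {{ℚ.nonNegative (0≤scale d)}} (norm-sum {u} {v} uv)))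

  norm-chain-≡ : (p : ℕ → ℚ[i]) → p 0 ≡ b → (∀ d → ∃ λ v → Ahead (p d) v × p (suc d) ≡ b *ᵍ (p d +ᵍ v)) →
                 ∀ d {v s} → Ahead (p d) v → s ≡ p d +ᵍ v → G ^ℚ suc (suc d) ℚ.≤ norm s ℚ.* (Nz ℚ.* scale d)
  norm-chain-≡ p p-0 p-suc d {v} uv refl = norm-chain-sum d {p d} {v} (norm-chain p p-0 p-suc d) uv

module FamilySum (y : ℚ[i]) where
  open Turning y
  open CubePolynomials +ᵍ-*ᵍ-isCommutativeSemiring y using (p; p-00; InFamily)
  open FiniteSums +ᵍ-*ᵍ-isCommutativeSemiring using (∑)

  private
    module S = Spiral +ᵍ-*ᵍ-isCommutativeSemiring +ᵍ-cancelˡ y Ahead ahead-refl ahead-0ˡ ahead-0ʳ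
      (λ {u} {v} {w} → ahead-+ˡ {u} {v} {w}) (λ {u} {v} {w} → ahead-+ʳ {u} {v} {w})
      (λ {u} {v} {w} → ahead-rotate {u} {v} {w}) ahead-base

  p-0 : p 0 0 ≡ b
  p-0 = p-00

  p-suc : ∀ d → ∃ λ v → Ahead (p d 0) v × p (suc d) 0 ≡ b *ᵍ (p d 0 +ᵍ v)
  p-suc = S.p-suc

  ahead-∑ : ∀ d {xs} → All (InFamily d) xs →
            Ahead (p d 0) (∑ xs (λ x → x))
  ahead-∑ d all = S.R-∑ (All.map ahead all)
    where
    ahead : ∀ {x} → InFamily d x →
            Ahead (p d 0) x
    ahead (inj₁ (i , k , i+k≡d , eq)) = subst (Ahead (p d 0)) (sym eq) (All.lookup (S.p-first d) (S.p∈family i k i+k≡d))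
    ahead (inj₂ (i , k , i+k≡d , eq)) = subst (Ahead (p d 0)) (sym eq) (All.lookup (S.p-first d) (S.q∈family i k i+k≡d))

fromℤᵍ : ℤ → ℚ[i]
fromℤᵍ a = (a ℚ./ 1) +𝐢 0ℚ

private
  /1-+ : ∀ a b → (a ℤ.+ b) ℚ./ 1 ≡ (a ℚ./ 1) ℚ.+ (b ℚ./ 1)
  /1-+ a b = ℚ.toℚᵘ-injective (begin
    ℚ.toℚᵘ ((a ℤ.+ b) ℚ./ 1)                   ≈⟨ ℚ.toℚᵘ-fromℚᵘ (mkℚᵘ (a ℤ.+ b) 0) ⟩
    mkℚᵘ (a ℤ.+ b) 0                           ≈⟨ ℚᵘ.*≡* (cong (ℤ._* 1ℤ) (sym (cong₂ ℤ._+_ (ℤ.*-identityʳ a) (ℤ.*-identityʳ b)))) ⟩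
    mkℚᵘ a 0 ℚᵘ.+ mkℚᵘ b 0                     ≈⟨ ℚᵘ.+-cong (ℚ.toℚᵘ-fromℚᵘ (mkℚᵘ a 0)) (ℚ.toℚᵘ-fromℚᵘ (mkℚᵘ b 0)) ⟨
    ℚ.toℚᵘ (a ℚ./ 1) ℚᵘ.+ ℚ.toℚᵘ (b ℚ./ 1)     ≈⟨ ℚ.toℚᵘ-homo-+ (a ℚ./ 1) (b ℚ./ 1) ⟨
    ℚ.toℚᵘ ((a ℚ./ 1) ℚ.+ (b ℚ./ 1))             ∎)
    where open ℚᵘ.≃-Reasoning

  /1-* : ∀ a b → (a ℤ.* b) ℚ./ 1 ≡ (a ℚ./ 1) ℚ.* (b ℚ./ 1)
  /1-* a b = ℚ.toℚᵘ-injective (begin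
    ℚ.toℚᵘ ((a ℤ.* b) ℚ./ 1)                   ≈⟨ ℚ.toℚᵘ-fromℚᵘ (mkℚᵘ (a ℤ.* b) 0) ⟩
    mkℚᵘ a 0 ℚᵘ.* mkℚᵘ b 0                     ≈⟨ ℚᵘ.*-cong (ℚ.toℚᵘ-fromℚᵘ (mkℚᵘ a 0)) (ℚ.toℚᵘ-fromℚᵘ (mkℚᵘ b 0)) ⟨
    ℚ.toℚᵘ (a ℚ./ 1) ℚᵘ.* ℚ.toℚᵘ (b ℚ./ 1)     ≈⟨ ℚ.toℚᵘ-homo-* (a ℚ./ 1) (b ℚ./ 1) ⟨
    ℚ.toℚᵘ ((a ℚ./ 1) ℚ.* (b ℚ./ 1))           ∎)
    where open ℚᵘ.≃-Reasoning

fromℤᵍ-+ : ∀ a b → fromℤᵍ (a ℤ.+ b) ≡ fromℤᵍ a +ᵍ fromℤᵍ b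
fromℤᵍ-+ a b = cong₂ _+𝐢_ (/1-+ a b) refl

fromℤᵍ-* : ∀ a b → fromℤᵍ (a ℤ.* b) ≡ fromℤᵍ a *ᵍ fromℤᵍ b
fromℤᵍ-* a b = cong₂ _+𝐢_
  (trans (/1-* a b) (solve 2 (λ a b → a :* b := a :* b :+ :- (con 0ℚ :* con 0ℚ)) refl (a ℚ./ 1) (b ℚ./ 1)))
  (solve 2 (λ a b → con 0ℚ := a :* con 0ℚ :+ con 0ℚ :* b) refl (a ℚ./ 1) (b ℚ./ 1))

-- Null sequences

open ℝ

p-0≡p : ∀ p → p ℚ.- 0ℚ ≡ p
p-0≡p p = ℚ.+-identityʳ p

≈0⇒null : ∀ {x} → x ≈ 0ᴿ → ∀ ε → 0ℚ ℚ.< ε → ∃ λ N → ∀ n → N ℕ.≤ n → ℚ.∣ seq x n ∣ ℚ.< ε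
≈0⇒null {x} x≈0 ε 0<ε with x≈0 ε 0<ε
... | N , h = N , λ n N≤n → subst (λ p → ℚ.∣ p ∣ ℚ.< ε) (p-0≡p (seq x n)) (h n N≤n)

null⇒≈0 : ∀ {x} → (∀ ε → 0ℚ ℚ.< ε → ∃ λ N → ∀ n → N ℕ.≤ n → ℚ.∣ seq x n ∣ ℚ.< ε) → x ≈ 0ᴿ
null⇒≈0 {x} null ε 0<ε with null ε 0<ε
... | N , h = N , λ n N≤n → subst (λ p → ℚ.∣ p ∣ ℚ.< ε) (sym (p-0≡p (seq x n))) (h n N≤n)

eventuallyBounded : ∀ x → ∃ λ B → 0ℚ ℚ.< B × ∃ λ N → ∀ n → N ℕ.≤ n → ℚ.∣ seq x n ∣ ℚ.≤ B
eventuallyBounded x with cauchy x 1ℚ (ℚ.positive⁻¹ 1ℚ)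
... | N , h = 1ℚ ℚ.+ ℚ.∣ seq x N ∣ , ℚ.+-mono-<-≤ (ℚ.positive⁻¹ 1ℚ) (ℚ.0≤∣p∣ (seq x N)) , N , λ n N≤n → begin
  ℚ.∣ seq x n ∣
    ≡⟨ cong ℚ.∣_∣ (solve 2 (λ a b → a := a :- b :+ b) refl (seq x n) (seq x N)) ⟩
  ℚ.∣ (seq x n ℚ.- seq x N) ℚ.+ seq x N ∣
    ≤⟨ ℚ.∣p+q∣≤∣p∣+∣q∣ (seq x n ℚ.- seq x N) (seq x N) ⟩
  ℚ.∣ seq x n ℚ.- seq x N ∣ ℚ.+ ℚ.∣ seq x N ∣
    ≤⟨ ℚ.+-monoˡ-≤ ℚ.∣ seq x N ∣ (ℚ.<⇒≤ (h n N N≤n ℕ.≤-refl)) ⟩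
  1ℚ ℚ.+ ℚ.∣ seq x N ∣ ∎
  where open ℚ.≤-Reasoning

divide : ∀ B → 0ℚ ℚ.< B → ∀ ε → 0ℚ ℚ.< ε → ∃ λ δ → 0ℚ ℚ.< δ × δ ℚ.* B ≡ ε
divide B 0<B ε 0<ε = ε ℚ.* 1/B ,
  subst (ℚ._< ε ℚ.* 1/B) (ℚ.*-zeroˡ 1/B) (ℚ.*-monoˡ-<-pos 1/B 0<ε) ,
  trans (ℚ.*-assoc ε 1/B B) (trans (cong (ε ℚ.*_) (ℚ.*-inverseˡ B)) (ℚ.*-identityʳ ε))
  where
  instance
    _ = ℚ.positive 0<B
    _ = ℚ.pos⇒nonZero B
  1/B = ℚ.1/ B
  instance
    _ = ℚ.1/pos⇒pos B

≈0-* : ∀ x y → x ≈ 0ᴿ → x *ᴿ y ≈ 0ᴿ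
≈0-* x y x≈0 = null⇒≈0 {x *ᴿ y} λ ε 0<ε →
  let B , 0<B , M , y≤B = eventuallyBounded y
      δ , 0<δ , δB≡ε    = divide B 0<B ε 0<ε
      N , x<δ           = ≈0⇒null {x} x≈0 δ 0<δ
  in M ℕ.⊔ N , λ n l → begin-strict
    ℚ.∣ seq x n ℚ.* seq y n ∣
      ≡⟨ ℚ.∣p*q∣≡∣p∣*∣q∣ (seq x n) (seq y n) ⟩
    ℚ.∣ seq x n ∣ ℚ.* ℚ.∣ seq y n ∣
      ≤⟨ ℚ.*-monoˡ-≤-nonNeg ℚ.∣ seq x n ∣ {{ℚ.∣-∣-nonNeg (seq x n)}} (y≤B n (ℕ.m⊔n≤o⇒m≤o M N l)) ⟩
    ℚ.∣ seq x n ∣ ℚ.* B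
      <⟨ ℚ.*-monoˡ-<-pos B {{ℚ.positive 0<B}} (x<δ n (ℕ.m⊔n≤o⇒n≤o M N l)) ⟩
    δ ℚ.* B
      ≡⟨ δB≡ε ⟩
    ε ∎
  where open ℚ.≤-Reasoning

≈0-+ : ∀ x y → x ≈ 0ᴿ → y ≈ 0ᴿ → x +ᴿ y ≈ 0ᴿ
≈0-+ x y x≈0 y≈0 = null⇒≈0 {x +ᴿ y} λ ε 0<ε →
  let 0<½ε = subst (ℚ._< ½ ℚ.* ε) (ℚ.*-zeroʳ ½) (ℚ.*-monoʳ-<-pos ½ 0<ε)
      M , hx = ≈0⇒null {x} x≈0 (½ ℚ.* ε) 0<½ε
      N , hy = ≈0⇒null {y} y≈0 (½ ℚ.* ε) 0<½ε
  in M ℕ.⊔ N , λ n l → begin-strict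
    ℚ.∣ seq x n ℚ.+ seq y n ∣          ≤⟨ ℚ.∣p+q∣≤∣p∣+∣q∣ (seq x n) (seq y n) ⟩
    ℚ.∣ seq x n ∣ ℚ.+ ℚ.∣ seq y n ∣    <⟨ ℚ.+-mono-< (hx n (ℕ.m⊔n≤o⇒m≤o M N l)) (hy n (ℕ.m⊔n≤o⇒n≤o M N l)) ⟩
    ½ ℚ.* ε ℚ.+ ½ ℚ.* ε                ≡⟨ trans (sym (ℚ.*-distribʳ-+ ε ½ ½)) (ℚ.*-identityˡ ε) ⟩
    ε                                  ∎
  where open ℚ.≤-Reasoning

-- The inequality at a rational complex point

+ᵍ-*ᵍ-commutativeSemiring : CommutativeSemiring 0ℓ 0ℓ
+ᵍ-*ᵍ-commutativeSemiring = record { isCommutativeSemiring = +ᵍ-*ᵍ-isCommutativeSemiring }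

open Exp +ᵍ-*ᵍ-commutativeSemiring using () renaming (_^_ to _^ᵍ_)

norm-^ : ∀ u n → norm (u ^ᵍ n) ≡ norm u ^ℚ n
norm-^ u zero    = refl
norm-^ u (suc n) = trans (norm-* u (u ^ᵍ n)) (cong (norm u ℚ.*_) (norm-^ u n))

square≤0⇒≡0 : ∀ p → p ℚ.* p ℚ.≤ 0ℚ → p ≡ 0ℚ
square≤0⇒≡0 p p²≤0 with ℚ.<-cmp p 0ℚ
... | tri≈ _ p≡0 _ = p≡0
... | tri> _ _ p>0 = contradiction (ℚ.<-≤-trans
  (subst (ℚ._< p ℚ.* p) (ℚ.*-zeroˡ p) (ℚ.*-monoˡ-<-pos p {{ℚ.positive p>0}} p>0)) p²≤0) (ℚ.<-irrefl refl)
... | tri< p<0 _ _ = contradiction (ℚ.<-≤-trans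
  (subst (ℚ._< p ℚ.* p) (ℚ.*-zeroˡ p) (ℚ.*-monoˡ-<-neg p {{ℚ.negative p<0}} p<0)) p²≤0) (ℚ.<-irrefl refl)

inverse : ∀ c → norm c ≢ 0ℚ → ∃ λ e → c *ᵍ e ≡ 1ᵍ
inverse c@(a +𝐢 b) n≢0 = (a ℚ.* k) +𝐢 (ℚ.- b ℚ.* k) , cong₂ _+𝐢_
  (trans (solve 3 (λ a b k → a :* (a :* k) :+ :- (b :* (:- b :* k)) := (a :* a :+ b :* b) :* k) refl a b k)
    (ℚ.*-inverseʳ (norm c)))
  (solve 3 (λ a b k → a :* (:- b :* k) :+ b :* (a :* k) := con 0ℚ) refl a b k)
  where
  instance
    _ = ℚ.≢-nonZero n≢0
  k = ℚ.1/ norm c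

-- For `c` equal to 1 - z this is `Nz * scale d`, a polynomial in the coordinates of `z`.
bound : ℚ[i] → ℚ[i] → ℕ → ℚ
bound z c d = norm z ℚ.* ((norm z ℚ.* norm c) ^ℚ d ℚ.* (norm c ℚ.* norm c))

0≤bound : ∀ z c d → 0ℚ ℚ.≤ bound z c d
0≤bound z c d = *-nonNeg (norm-nonNeg z)
  (*-nonNeg (^ℚ-nonNeg d (*-nonNeg (norm-nonNeg z) (norm-nonNeg c))) (square-nonNeg (norm c)))

module RationalPoint (z : ℚ[i]) where

  open Evaluation +ᵍ-*ᵍ-isCommutativeSemiring fromℤᵍ fromℤᵍ-+ fromℤᵍ-* refl refl z public

  1-z : ℚ[i]
  1-z = value (1ℤ ∷ -1ℤ ∷ [])

  im²≤norm : im z ℚ.* im z ℚ.≤ norm 1-z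
  im²≤norm = subst₂ ℚ._≤_ eq (ℚ.+-comm (im 1-z ℚ.* im 1-z) (re 1-z ℚ.* re 1-z)) (p≤p+q {im 1-z ℚ.* im 1-z} {re 1-z ℚ.* re 1-z} (square-nonNeg (re 1-z)))
    where
    eq : im 1-z ℚ.* im 1-z ≡ im z ℚ.* im z
    eq = trans (solve 2 (λ s t → s :* s := (s :+ t) :* (s :- t) :+ t :* t) refl (im 1-z) (im z))
      (trans (cong (λ x → x ℚ.* (im 1-z ℚ.- im z) ℚ.+ im z ℚ.* im z) (cong im value-1-x))
      (solve 2 (λ s t → con 0ℚ :* s :+ t := t) refl (im 1-z ℚ.- im z) (im z ℚ.* im z)))

  module _ (C : PolytopalComplex) (cubical : IsCubical C) (d : ℕ) (Fs : List (PolytopalComplex.Face C))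
    (pure : PolytopalComplex.PureOfDim C d U) (ordering : PolytopalComplex.IsFacetOrdering C U Fs)
    (stable : PiecesAreStable C Fs) where

    private
      h : ℚ[i]
      h = value (hPolynomial (sd C))
      m : ℕ
      m = rankₛ (sd C)

    -- The exponent collects `m` from h = (1 - z)^m S together with (Im z)² ≤ |1 - z|², then d + 1
    -- from the recursion for the first piece, and one more from adding the other pieces to it.
    unit-bound : ∀ e → 1-z *ᵍ e ≡ 1ᵍ → (im z ℚ.* im z) ^ℚ (m ℕ.+ suc (suc d)) ℚ.≤ norm h ℚ.* bound z 1-z d
    unit-bound e 1-z*e≡1 = subst₂ ℚ._≤_ (sym (^-homo-* (im z ℚ.* im z) m (suc (suc d)))) h-bound
        (*-mono-≤-nonNeg (^ℚ-nonNeg m (square-nonNeg (im z)))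
          (*-nonNeg (norm-nonNeg S) (0≤bound z 1-z d)) (^ℚ-mono-≤ m (square-nonNeg (im z)) im²≤norm) S-bound)
      where
      module K = IsCommutativeSemiring +ᵍ-*ᵍ-isCommutativeSemiring
      y : ℚ[i]
      y = z *ᵍ e
      b : ℚ[i]
      b = 1ᵍ +ᵍ y
      1-z*y : 1-z *ᵍ y ≡ z
      1-z*y = trans (K.*-comm 1-z y) (trans (K.*-assoc z e 1-z) (trans (cong (z *ᵍ_) (trans (K.*-comm e 1-z) 1-z*e≡1)) (K.*-identityʳ z)))
      1-z*b : 1-z *ᵍ b ≡ 1ᵍ
      1-z*b = trans (K.distribˡ 1-z 1ᵍ y) (trans (cong₂ _+ᵍ_ (K.*-identityʳ 1-z) 1-z*y) value-1-x)
      D*im : norm 1-z ℚ.* im y ≡ im z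
      D*im = begin
        norm 1-z ℚ.* im y
          ≡⟨ cong (norm 1-z ℚ.*_) (solve 2 (λ p t → t := (con 1ℚ :+ p) :* t :- (con 0ℚ :+ t) :* p) refl (re y) (im y)) ⟩
        norm 1-z ℚ.* cross b y       ≡⟨ cross-* 1-z b y ⟨
        cross (1-z *ᵍ b) (1-z *ᵍ y)  ≡⟨ cong₂ cross 1-z*b 1-z*y ⟩
        cross 1ᵍ z
          ≡⟨ solve 2 (λ p t → con 1ℚ :* t :- con 0ℚ :* p := t) refl (re z) (im z) ⟩
        im z                         ∎
        where open ≡-Reasoning
      open Bounds y (norm 1-z) (norm z) (im z) (norm-nonNeg 1-z) D*im
        (trans (sym (norm-* 1-z y)) (cong norm 1-z*y)) (trans (sym (norm-* 1-z b)) (cong norm 1-z*b))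
      open FamilySum y
      open ShellingDecomposition +ᵍ-*ᵍ-isCommutativeSemiring y C cubical
      open CubePolynomials +ᵍ-*ᵍ-isCommutativeSemiring y using (p)
      open FiniteSums +ᵍ-*ᵍ-isCommutativeSemiring using (∑)

      S : ℚ[i]
      S = ∑ (allFaces (sd C)) (λ T → y ^ᵍ ∣ T ∣)

      S-bound : (im z ℚ.* im z) ^ℚ suc (suc d) ℚ.≤ norm S ℚ.* bound z 1-z d
      S-bound = let xs , S≡ , all = ∑-allFaces-family pure ordering stable in
        norm-chain-≡ (λ n → p n 0) p-0 p-suc d {∑ xs (λ x → x)} {S} (ahead-∑ d all) S≡

      h-bound : norm 1-z ^ℚ m ℚ.* (norm S ℚ.* bound z 1-z d) ≡ norm h ℚ.* bound z 1-z d
      h-bound = trans (sym (ℚ.*-assoc (norm 1-z ^ℚ m) (norm S) (bound z 1-z d))) (cong (ℚ._* bound z 1-z d)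
        (sym (trans (cong norm (value-hPolynomial (sd C) (sym (trans (K.*-comm y 1-z) 1-z*y))))
          (trans (norm-* (1-z ^ᵍ m) S) (cong (ℚ._* norm S) (norm-^ 1-z m))))))

    -- If Im z is not zero then neither is 1 - z, and y exists. If Im z is zero, the left side is a
    -- positive power of zero.
    im-bound : (im z ℚ.* im z) ^ℚ (m ℕ.+ suc (suc d)) ℚ.≤ norm h ℚ.* bound z 1-z d
    im-bound = decide (im z ℚ.≟ 0ℚ)
      where
      decide : Dec (im z ≡ 0ℚ) → (im z ℚ.* im z) ^ℚ (m ℕ.+ suc (suc d)) ℚ.≤ norm h ℚ.* bound z 1-z d
      decide (no im≢0)  = let e , 1-z*e≡1 = inverse 1-z λ n≡0 → im≢0
                                (square≤0⇒≡0 (im z) (subst (im z ℚ.* im z ℚ.≤_) n≡0 im²≤norm))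
                          in unit-bound e 1-z*e≡1
      decide (yes im≡0) = subst (ℚ._≤ norm h ℚ.* bound z 1-z d)
        (sym (trans (cong₂ (λ t n → (t ℚ.* t) ^ℚ n) im≡0 (ℕ.+-suc m (suc d)))
          (ℚ.*-zeroˡ ((0ℚ ℚ.* 0ℚ) ^ℚ (m ℕ.+ suc d)))))
        (*-nonNeg (norm-nonNeg h) (0≤bound z 1-z d))

-- From rational points to Cauchy sequences

_at_ : ℂ → ℕ → ℚ[i]
z at n = seq (ℂ.re z) n +𝐢 seq (ℂ.im z) n

evaluate-at : ∀ f z n → evaluate (toℝ[x] f) z at n ≡ RationalPoint.value (z at n) f
evaluate-at []      z n = refl
evaluate-at (a ∷ f) z n = cong (λ w → fromℤᵍ a +ᵍ (z at n) *ᵍ w) (evaluate-at f z n)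

normᴿ : ℂ → ℝ
normᴿ z = ℂ.re z *ᴿ ℂ.re z +ᴿ ℂ.im z *ᴿ ℂ.im z

powᴿ : ℝ → ℕ → ℝ
powᴿ x zero    = fromℚ 1ℚ
powᴿ x (suc n) = x *ᴿ powᴿ x n

seq-powᴿ : ∀ x k n → seq (powᴿ x k) n ≡ seq x n ^ℚ k
seq-powᴿ x zero    n = refl
seq-powᴿ x (suc k) n = cong (seq x n ℚ.*_) (seq-powᴿ x k n)

boundᴿ : ℂ → ℂ → ℕ → ℝ
boundᴿ z w d = normᴿ z *ᴿ (powᴿ (normᴿ z *ᴿ normᴿ w) d *ᴿ (normᴿ w *ᴿ normᴿ w))

seq-boundᴿ : ∀ z w d n → seq (boundᴿ z w d) n ≡ bound (z at n) (w at n) d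
seq-boundᴿ z w d n = cong (λ t → norm (z at n) ℚ.* (t ℚ.* (norm (w at n) ℚ.* norm (w at n))))
  (seq-powᴿ (normᴿ z *ᴿ normᴿ w) d n)

∣p∣²≡p² : ∀ p → ℚ.∣ p ∣ ℚ.* ℚ.∣ p ∣ ≡ p ℚ.* p
∣p∣²≡p² p = trans (sym (ℚ.∣p*q∣≡∣p∣*∣q∣ p p)) (ℚ.0≤p⇒∣p∣≡p (square-nonNeg p))

^ℚ-pos : ∀ {p} n → 0ℚ ℚ.< p → 0ℚ ℚ.< p ^ℚ n
^ℚ-pos zero    _   = ℚ.positive⁻¹ 1ℚ
^ℚ-pos {p} (suc n) 0<p = subst (ℚ._< p ℚ.* p ^ℚ n) (ℚ.*-zeroʳ p)
  (ℚ.*-monoʳ-<-pos p {{ℚ.positive 0<p}} (^ℚ-pos n 0<p))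

-- Roots are avoided by asking `r` to fall below the same power of ε: a term of `x` with absolute
-- value at least ε would force the term of `r` up to (ε²)^e.
≈0-root : ∀ x r e → r ≈ 0ᴿ → (∀ n → (seq x n ℚ.* seq x n) ^ℚ e ℚ.≤ seq r n) → x ≈ 0ᴿ
≈0-root x r e r≈0 le = null⇒≈0 {x} null
  where
  null : ∀ ε → 0ℚ ℚ.< ε → ∃ λ N → ∀ n → N ℕ.≤ n → ℚ.∣ seq x n ∣ ℚ.< ε
  null ε 0<ε with ≈0⇒null {r} r≈0 ((ε ℚ.* ε) ^ℚ e) (^ℚ-pos e (subst (ℚ._< ε ℚ.* ε) (ℚ.*-zeroʳ ε) (ℚ.*-monoʳ-<-pos ε {{ℚ.positive 0<ε}} 0<ε)))
  ... | N , r<ε = N , λ n N≤n → ℚ.≰⇒> λ ε≤∣x∣ → ℚ.<-irrefl refl (begin-strict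
    (ε ℚ.* ε) ^ℚ e
      ≤⟨ ^ℚ-mono-≤ e (square-nonNeg ε) (subst (ε ℚ.* ε ℚ.≤_) (∣p∣²≡p² (seq x n))
           (*-mono-≤-nonNeg (ℚ.<⇒≤ 0<ε) (ℚ.0≤∣p∣ (seq x n)) ε≤∣x∣ ε≤∣x∣)) ⟩
    (seq x n ℚ.* seq x n) ^ℚ e ≤⟨ le n ⟩
    seq r n                    ≤⟨ p≤∣p∣ (seq r n) ⟩
    ℚ.∣ seq r n ∣              <⟨ r<ε n N≤n ⟩
    (ε ℚ.* ε) ^ℚ e             ∎)
    where
    open ℚ.≤-Reasoning
    p≤∣p∣ : ∀ p → p ℚ.≤ ℚ.∣ p ∣
    p≤∣p∣ p with ℚ.≤-total 0ℚ p
    ... | inj₁ 0≤p = ℚ.≤-reflexive (sym (ℚ.0≤p⇒∣p∣≡p 0≤p))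
    ... | inj₂ p≤0 = ℚ.≤-trans p≤0 (ℚ.0≤∣p∣ p)

shelling⇒pure : ∀ C d {𝒟 Fs} → PolytopalComplex.IsShelling C d 𝒟 Fs →
  PolytopalComplex.PureOfDim C d 𝒟 × PolytopalComplex.IsFacetOrdering C 𝒟 Fs
shelling⇒pure C zero    (pure , ordering)     = pure , ordering
shelling⇒pure C (suc d) (pure , ordering , _) = pure , ordering

theorem4p7 : (C : PolytopalComplex) → IsCubical C → HasStableShelling C →
    RealRooted (toℝ[x] (hPolynomial (sd C)))
theorem4p7 C cubical (d , Fs , shelling , stable) = inj₂ λ z (re≈0 , im≈0) →
  let w = evaluate (toℝ[x] (hPolynomial (sd C))) z
      -- The number 1 - z, obtained as a polynomial value so that its terms match `1-z` at the
      -- rational points.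
      v = evaluate (toℝ[x] (1ℤ ∷ -1ℤ ∷ [])) z
      pure , ordering = shelling⇒pure C d shelling
  in ≈0-root (ℂ.im z) (normᴿ w *ᴿ boundᴿ z v d) (rankₛ (sd C) ℕ.+ suc (suc d))
    (≈0-* (normᴿ w) (boundᴿ z v d) (≈0-+ (ℂ.re w *ᴿ ℂ.re w) (ℂ.im w *ᴿ ℂ.im w)
      (≈0-* (ℂ.re w) (ℂ.re w) re≈0) (≈0-* (ℂ.im w) (ℂ.im w) im≈0)))
    (λ n → subst ((seq (ℂ.im z) n ℚ.* seq (ℂ.im z) n) ^ℚ (rankₛ (sd C) ℕ.+ suc (suc d)) ℚ.≤_)
      (sym (cong₂ ℚ._*_ (cong norm (evaluate-at (hPolynomial (sd C)) z n))
        (trans (seq-boundᴿ z v d n) (cong (λ c → bound (z at n) c d) (evaluate-at (1ℤ ∷ -1ℤ ∷ []) z n)))))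
      (RationalPoint.im-bound (z at n) C cubical d Fs pure ordering stable))
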